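{- Let $n\ge 1$ and let $X$ be a finite pure $n$-dimensional simplicial complex with connected links, equipped with the homogeneous weight function $m$. Assume that $X$ is $(n+1)$-partite with sides $S_0,\dots,S_n$ and partite-regular in the following sense: for every $0\le i\le n$ there is a constant $K_i$ such that every vertex $\{v\}$ with $v\in S_i$ is contained in exactly $K_i$ $n$-dimensional simplices of $X$, i.e. $m(\{v\})=n!\,K_i$. Assume there is a constant $0<\lambda<1$ such that for every $0\le k\le n-1$ and every $\tau\in X(k-1)$, $\mathrm{Spec}((M')^+_{\tau,0})\subseteq[-1,\lambda]\cup\{1\}$. Then $$\mathrm{overlap}(X)\ge\mathcal{P}_n\left(\mathcal{P}_n^n-C_n\lambda\right),$$ where $\mathcal{P}_n$ is the constant of Pach's theorem and $$C_n=\sum_{k=0}^{n-1}n!\,\frac{(n+1-k)^{n-k}}{(n-k-1)!}\left((k+1)(k+2)^{n-k}-(k+1)^{n-k+1}\right).$$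
   Context: $X(k)$ denotes the set of simplices of $X$ with $k+1$ vertices, $X(-1)=\{\emptyset\}$; a vertex $v$ is identified with $\{v\}\in X(0)$. $X$ is pure $n$-dimensional if every simplex is contained in a simplex of $X(n)$. For $\tau\in X(k)$ the link $X_\tau$ is the complex with $\eta\in X_\tau(l)$ iff $\eta\in X(l)$ and $\tau\cup\eta\in X(k+l+1)$; $X_\emptyset=X$. "Connected links" means that for every $-1\le k\le n-2$ and every $\tau\in X(k)$ the one-skeleton of $X_\tau$ (the graph with vertices $X_\tau(0)$ and edges $X_\tau(1)$) is connected; in particular the one-skeleton of $X$ is connected. $X$ is $(n+1)$-partite with sides $S_0,\dots,S_n\subseteq X(0)$ if the $S_i$ are disjoint, $X(0)=\bigcup_i S_i$, and $|\sigma\cap S_i|=1$ for every $\sigma\in X(n)$ and every $0\le i\le n$. Homogeneous weight: for $-1\le k\le n$ and $\tau\in X(k)$, $m(\tau)=(n-k)!\,|\{\sigma\in X(n):\tau\subseteq\sigma\}|$. On the link, $m_\tau(\eta)=m(\tau\cup\eta)$. The weighted random walk operator $(M')^+_{\tau,0}$ acts on functions $\phi:X_\tau(0)\to\mathbb{R}$ by $$(M')^+_{\tau,0}\phi(v)=\sum_{u:\{u,v\}\in X_\tau(1)}\frac{m_\tau(\{u,v\})}{m_\tau(\{v\})}\phi(u).$$ Overlap: $$\mathrm{overlap}(X)=\min_{f:X(0)\to\mathbb{R}^n}\max_{x\in\mathbb{R}^n}\frac{|\{\{v_0,\dots,v_n\}\in X(n):x\in\mathrm{conv}\{f(v_0),\dots,f(v_n)\}\}|}{|X(n)|},$$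 the minimum being over all maps $f$, and $\mathrm{conv}$ denoting convex hull. Pach's theorem (known): for every $n$ there is a constant $\mathcal{P}_n>0$ such that for any finite sets $S_0,\dots,S_n$ of points in $\mathbb{R}^n$ there are subsets $U_0\subseteq S_0,\dots,U_n\subseteq S_n$ with $|U_i|\ge\mathcal{P}_n|S_i|$ for every $0\le i\le n$ and $\bigcap_{x_0\in U_0,\dots,x_n\in U_n}\mathrm{conv}\{x_0,\dots,x_n\}\ne\emptyset$. $\mathcal{P}_n$ denotes such a constant. -}

module Defs where

open import Algebra.Bundles using (CommutativeRing; Semiring)
open import Axiom.ExcludedMiddle using (ExcludedMiddle)
open import Data.Bool.Base using (if_then_else_)
open import Data.Fin.Base using (Fin; toℕ)
open import Data.Fin.Subset using (Subset; inside; outside; _∈_; _⊆_; _∪_; _∩_; ⁅_⁆; ∣_∣; Empty; ⊤) renaming (⊥ to ∅)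
open import Data.Fin.Subset.Properties using (_⊆?_)
open import Data.List.Base using (List; []; _∷_; _++_; map; filter; length)
open import Data.Nat.Base as ℕ using (ℕ; zero; suc; _∸_; _!)
import Data.Nat.Properties as ℕ
open import Data.Product.Base using (∃; ∃-syntax; _×_; _,_)
open import Data.Sum.Base using (_⊎_)
open import Data.Vec.Base using ([]; _∷_)
open import Data.Vec.Functional using (Vector)
open import Level using (0ℓ)
open import Relation.Binary.Construct.Closure.ReflexiveTransitive using (Star)
open import Relation.Binary.Core using (Rel)
import Relation.Binary.Construct.NonStrictToStrict as Strict
open import Relation.Binary.PropositionalEquality.Core using (_≡_; _≢_)
open import Relation.Binary.Structures using (IsTotalOrder)
open import Relation.Nullary using (Dec; does; ¬_)
open import Relation.Nullary.Decidable using (_×-dec_)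
open import Relation.Unary using (Pred; Decidable)

-- The library has no real numbers.  ℝ is taken to be an arbitrary
-- Dedekind-complete totally ordered field, which determines it up to
-- unique isomorphism.  Equality is the setoid equality _≈_, since real
-- numbers are not available as a quotient type.

record Reals : Set₁ where
  field
    commutativeRing : CommutativeRing 0ℓ 0ℓ

  open CommutativeRing commutativeRing public
    renaming (Carrier to ℝ)
    using (_≈_; _+_; _*_; -_; _-_; 0#; 1#; semiring)

  infix  4 _≤_
  infix  8 _⁻¹

  field
    _≤_          : Rel ℝ 0ℓ
    isTotalOrder : IsTotalOrder _≈_ _≤_
    +-monoˡ-≤    : ∀ z {x y} → x ≤ y → x + z ≤ y + z
    *-nonNeg     : ∀ {x y} → 0# ≤ x → 0# ≤ y → 0# ≤ x * y
    0≉1          : ¬ 0# ≈ 1#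

    -- Total for convenience; nothing is assumed about the value at 0.
    _⁻¹          : ℝ → ℝ
    *-inverseʳ   : ∀ {x} → ¬ x ≈ 0# → x * x ⁻¹ ≈ 1#

    supremum     : (S : Pred ℝ 0ℓ) → ∃ S → (∃[ b ] ∀ x → S x → x ≤ b) →
                   ∃[ s ] (∀ x → S x → x ≤ s) ×
                          (∀ b → (∀ x → S x → x ≤ b) → s ≤ b)

  open Strict _≈_ _≤_ public using (_<_)

-- Finite simplicial complexes on the vertex set Fin N, the empty
-- simplex included.

record Complex (N : ℕ) : Set₁ where
  field
    Face        : Pred (Subset N) 0ℓ
    face?       : Decidable Face
    face-∅      : Face ∅
    face-vertex : ∀ v → Face ⁅ v ⁆
    face-⊆      : ∀ {σ τ} → τ ⊆ σ → Face σ → Face τ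

  -- Indexed by the number of vertices, to avoid the dimension -1:
  -- Simplex (suc k) is X(k), and Simplex 0 is X(-1).
  Simplex : ℕ → Pred (Subset N) 0ℓ
  Simplex j σ = Face σ × ∣ σ ∣ ≡ j

  simplex? : ∀ j → Decidable (Simplex j)
  simplex? j σ = face? σ ×-dec (∣ σ ∣ ℕ.≟ j)

  -- Link τ j η : η is a simplex with j vertices of the link of τ.
  -- The size of τ ∪ η forces τ and η to be disjoint.
  Link : Subset N → ℕ → Pred (Subset N) 0ℓ
  Link τ j η = Simplex j η × Simplex (∣ τ ∣ ℕ.+ j) (τ ∪ η)

  link? : ∀ τ j → Decidable (Link τ j)
  link? τ j η = simplex? j η ×-dec simplex? (∣ τ ∣ ℕ.+ j) (τ ∪ η)

  LinkVertex : Subset N → Pred (Fin N) 0ℓ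
  LinkVertex τ v = Link τ 1 ⁅ v ⁆

  LinkEdge : Subset N → Rel (Fin N) 0ℓ
  LinkEdge τ u v = Link τ 2 (⁅ u ⁆ ∪ ⁅ v ⁆)

  linkEdge? : ∀ τ u v → Dec (LinkEdge τ u v)
  linkEdge? τ u v = link? τ 2 (⁅ u ⁆ ∪ ⁅ v ⁆)

subsets : ∀ N → List (Subset N)
subsets zero    = [] ∷ []
subsets (suc N) = map (outside ∷_) (subsets N) ++ map (inside ∷_) (subsets N)

#subsets : ∀ {N} {P : Pred (Subset N) 0ℓ} → Decidable P → ℕ
#subsets {N} P? = length (filter P? (subsets N))

module _ {N : ℕ} (n : ℕ) (X : Complex N) where
  open Complex X

  Pure : Set
  Pure = ∀ τ → Face τ → ∃[ σ ] Simplex (suc n) σ × τ ⊆ σ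

  ConnectedLinks : Set
  ConnectedLinks = ∀ τ → Face τ → ∣ τ ∣ ℕ.< n →
    ∀ u v → LinkVertex τ u → LinkVertex τ v → Star (LinkEdge τ) u v

  record Partite (S : Fin (suc n) → Subset N) : Set where
    field
      disjoint    : ∀ i j → i ≢ j → Empty (S i ∩ S j)
      cover       : ∀ v → ∃[ i ] v ∈ S i
      transversal : ∀ σ → Simplex (suc n) σ → ∀ i → ∣ σ ∩ S i ∣ ≡ 1

  #top : ℕ
  #top = #subsets (simplex? (suc n))

  degree : Subset N → ℕ
  degree τ = #subsets (λ σ → simplex? (suc n) σ ×-dec (τ ⊆? σ))

  -- Homogeneous weight: (n - k)! = (n + 1 - |τ|)! for τ ∈ X(k).
  weight : Subset N → ℕ
  weight τ = (suc n ∸ ∣ τ ∣) ! ℕ.* degree τ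

  linkWeight : Subset N → Subset N → ℕ
  linkWeight τ η = weight (τ ∪ η)

  PartiteRegular : (Fin (suc n) → Subset N) → Set
  PartiteRegular S = ∀ i → ∃[ K ] ∀ v → v ∈ S i → degree ⁅ v ⁆ ≡ K

module Real (R : Reals) where
  open Reals R
  open import Algebra.Definitions.RawSemiring (Semiring.rawSemiring semiring) using (sum; _^_) renaming (_×_ to _·_)

  infix  4 _≋_
  infixl 7 _÷_

  fromℕ : ℕ → ℝ
  fromℕ k = k · 1#

  _÷_ : ℝ → ℝ → ℝ
  x ÷ y = x * y ⁻¹

  IsMaximum : Pred ℝ 0ℓ → Pred ℝ 0ℓ
  IsMaximum A r = A r × (∀ s → A s → s ≤ r)

  IsMinimum : Pred ℝ 0ℓ → Pred ℝ 0ℓ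
  IsMinimum A r = A r × (∀ s → A s → r ≤ s)

  Point : ℕ → Set
  Point n = Vector ℝ n

  _≋_ : ∀ {n} → Rel (Point n) 0ℓ
  x ≋ y = ∀ j → x j ≈ y j

  Image : ∀ {k n} → (Fin k → Point n) → Subset k → Pred (Point n) 0ℓ
  Image f σ y = ∃[ v ] v ∈ σ × y ≋ f v

  Conv : ∀ {n} → Pred (Point n) 0ℓ → Pred (Point n) 0ℓ
  Conv {n} A x = ∃[ k ] ∃ λ (t : Vector ℝ k) → ∃ λ (p : Vector (Point n) k) →
    (∀ i → 0# ≤ t i) × sum t ≈ 1# × (∀ i → A (p i)) ×
    (λ j → sum (λ i → t i * p i j)) ≋ x

  -- P is a constant for which Pach's theorem holds in ℝⁿ.  The finite
  -- set Sᵢ is an injective enumeration p i of s i points, and Uᵢ is given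
  -- by a subset of the indices.
  IsPachConstant : ℕ → Pred ℝ 0ℓ
  IsPachConstant n P = 0# < P ×
    (∀ (s : Fin (suc n) → ℕ) (p : ∀ i → Fin (s i) → Point n) →
     (∀ i a b → p i a ≋ p i b → a ≡ b) →
     ∃ λ (U : ∀ i → Subset (s i)) →
       (∀ i → P * fromℕ (s i) ≤ fromℕ ∣ U i ∣) ×
       (∃[ x ] ∀ (c : ∀ i → Fin (s i)) → (∀ i → c i ∈ U i) →
          Conv (Image (λ i → p i (c i)) ⊤) x))

  module _ {N : ℕ} (n : ℕ) (X : Complex N) where
    open Complex X

    -- The operator (M')⁺_{τ,0}.  A function on the vertices of the link
    -- of τ is represented by any extension of it to Fin N; the sum only
    -- involves values at vertices of the link.
    walk : Subset N → (Fin N → ℝ) → (Fin N → ℝ)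
    walk τ φ v = sum λ u →
      if does (linkEdge? τ u v)
      then fromℕ (linkWeight n X τ (⁅ u ⁆ ∪ ⁅ v ⁆)) ÷ fromℕ (linkWeight n X τ ⁅ v ⁆) * φ u
      else 0#

    -- The set of eigenvalues of walk τ.  It is self-adjoint for the inner
    -- product weighted by linkWeight τ, so all eigenvalues are real.
    Spec : Subset N → Pred ℝ 0ℓ
    Spec τ μ = ∃ λ (φ : Fin N → ℝ) →
      (∃[ v ] LinkVertex τ v × ¬ φ v ≈ 0#) ×
      (∀ v → LinkVertex τ v → walk τ φ v ≈ μ * φ v)

    SpectralGap : ℝ → Set
    SpectralGap lam = ∀ τ → Face τ → ∣ τ ∣ ℕ.< n →
      ∀ μ → Spec τ μ → (- 1# ≤ μ × μ ≤ lam) ⊎ μ ≈ 1#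

    module _ (em : ExcludedMiddle 0ℓ) where

      covered : (Fin N → Point n) → Point n → ℕ
      covered f x = #subsets {P = λ σ → Simplex (suc n) σ × Conv (Image f σ) x} (λ _ → em)

      -- r = min over f of max over x of the fraction of top simplices
      -- whose image under f has x in its convex hull.
      IsOverlap : Pred ℝ 0ℓ
      IsOverlap = IsMinimum λ s → ∃[ f ]
        IsMaximum (λ t → ∃[ x ] t ≈ fromℕ (covered f x) ÷ fromℕ (#top n X)) s

  C : ℕ → ℝ
  C n = sum {n} λ i → let k = toℕ i in
    fromℕ (n !)
    * (fromℕ ((n ℕ.+ 1 ∸ k) ℕ.^ (n ∸ k)) ÷ fromℕ ((n ∸ k ∸ 1) !))
    * (fromℕ ((k ℕ.+ 1) ℕ.* (k ℕ.+ 2) ℕ.^ (n ∸ k)) - fromℕ ((k ℕ.+ 1) ℕ.^ (n ∸ k ℕ.+ 1)))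

  overlapBound : ℕ → ℝ → ℝ → ℝ
  overlapBound n P lam = P * (P ^ n - C n * lam)

module Submission where

open import Defs
open import Axiom.ExcludedMiddle using (ExcludedMiddle)
open import Data.Fin.Base using (Fin)
open import Data.Fin.Subset using (Subset)
open import Data.Nat.Base as ℕ using (ℕ; suc)
open import Data.Product.Base using (∃-syntax; _×_)
open import Level using (0ℓ)

open import Algebra.Bundles using (CommutativeRing; RawRing; Semiring)
import Algebra.Properties.CommutativeMonoid.Sum
open import Algebra.Solver.Ring.AlmostCommutativeRing using (AlmostCommutativeRing; fromCommutativeRing; _-Raw-AlmostCommutative⟶_; Induced-equivalence)
open import Data.Bool.Base using (if_then_else_; true; false)
open import Data.Empty using (⊥-elim)
open import Data.Fin.Base using (zero; suc; toℕ)
import Data.Fin.Properties as Fin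
open import Data.Fin.Subset using (inside; outside; _∈_; _∉_; _⊆_; _∪_; _∩_; ⁅_⁆; ⊤; ∣_∣; Empty) renaming (⊥ to ∅)
open import Data.Fin.Subset.Properties using (_⊆?_; drop-there; x∈p∩q⁺; x∈p∩q⁻; x∈p∪q⁺; x∈p∪q⁻; x∈⁅x⁆; x∈⁅y⁆⇒x≡y; p⊆p∪q; q⊆p∪q; ∪-identityˡ; ∪-identityʳ; ∪-assoc; ∪-comm; ∪-idem; ⊥⊆; ∉⊥; ∣⊥∣≡0; ∣⁅x⁆∣≡1; ⊆-antisym)
open import Data.Integer.Base as ℤ using (ℤ; +_; -[1+_])
import Data.Integer.Properties as ℤ
open import Data.List.Base as List using (List; []; _∷_; length; filter)
import Data.List.Membership.Propositional as List
open import Data.List.Membership.Propositional.Properties using (∈-++⁺ˡ; ∈-++⁺ʳ; ∈-map⁺)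
import Data.List.Properties as List
import Data.List.Relation.Unary.Any as Any
open import Data.List.Relation.Unary.Any.Properties using (lookup-index)
open import Data.Maybe.Base using (map)
open import Data.Nat.Base using (zero; z≤n; s≤s; _!; _∸_)
open import Data.Nat.Induction using (<-rec)
import Data.Nat.Properties as ℕ
open import Data.Product.Base using (∃; _,_; proj₁; proj₂)
open import Data.Sum.Base using (_⊎_; inj₁; inj₂)
open import Data.Vec.Base using ([]; _∷_; here; there; tabulate)
open import Data.Vec.Functional using (removeAt)
open import Data.Vec.Properties using (lookup∘tabulate; []=⇒lookup; lookup⇒[]=)
open import Function.Base using (_∘_; id)
open import Relation.Binary.Bundles using (Poset)
open import Relation.Binary.Construct.Closure.ReflexiveTransitive using (Star; _◅_) renaming (ε to stop)
open import Relation.Binary.Definitions using (WeaklyDecidable)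
open import Relation.Binary.PropositionalEquality as ≡ using (_≡_; _≢_)
open import Relation.Binary.Structures using (IsTotalOrder)
open import Relation.Nullary using (Dec; does; yes; no; ¬_)
open import Relation.Nullary.Decidable using (dec⇒maybe; _×-dec_)
open import Relation.Unary using (Decidable)

-- Pach's theorem, applied to the images of the sides under f, yields a subset V
-- of the vertices meeting every side S i in proportion at least P, and a point
-- contained in the image of every top simplex with all its vertices in V.  (If f
-- is not injective, perturb it and pass to a limit.)  It remains to bound from
-- below the number of those simplices.
--
-- Let μ i τ be the proportion, among the top simplices containing τ, of those
-- whose vertex in S i lies in V.  By the spectral gap in the link of τ, for
-- i ≠ j the vertices of a random such simplex in S i and S j are almost
-- uncorrelated.  Conditioning on the vertex v in S i, one therefore may replace
-- μ j (τ ∪ {v}) by μ j τ at the cost of an error n λ max (μ i τ, μ j τ), and by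
-- induction on the number of colours the proportion of simplices inside V is at
-- least ∏ μ i - n³ λ max μ i.  Since P ≤ μ i, this is at least P (Pⁿ - n³ λ)
-- when the latter is nonnegative, and the k = 0 term of C n is at least n³.

-- The spectral hypothesis speaks of eigenvectors only, so it must first become an inequality
-- between quadratic forms: by compactness the supremum of the Rayleigh quotients is attained, and
-- it is attained at an eigenvector. The constant functions, whose eigenvalue is 1, are removed by
-- subtracting a rank-one form; connectedness of the link leaves no other eigenvector for 1.
--
-- The factor P in front of the bound requires every error to be proportional to the largest density
-- M. Hence variances are estimated by means, using ψ² ≤ ψ for values in [0, 1], and M can be
-- factored out: in ∏ μ i one factor is M and the other n are at least P.
--
-- Pach's theorem counts vertices, whereas μ counts top simplices; partite-regularity makes the two
-- proportions agree on each side. In the limit over perturbations of f a single V survives because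
-- there are only finitely many sets of vertices.

module OverlapBound (em : ExcludedMiddle 0ℓ) (R : Reals) where

  -- Ordered fields

  open Reals R public
  open Real R public
  open CommutativeRing commutativeRing public
    using (setoid; ring; +-cong; +-congˡ; +-congʳ; *-cong; *-congˡ; *-congʳ; -‿cong;
           +-identityˡ; +-identityʳ; *-identityˡ; *-identityʳ; zeroˡ; zeroʳ;
           +-comm; *-comm; +-assoc; *-assoc; *-commutativeMonoid; +-abelianGroup; -‿inverseʳ)
    renaming (refl to ≈-refl; sym to ≈-sym; trans to ≈-trans; reflexive to ≈-reflexive)
  open IsTotalOrder isTotalOrder public
    using () renaming (refl to ≤-refl; trans to ≤-trans; antisym to ≤-antisym; total to ≤-total; reflexive to ≤-reflexive; isPartialOrder to ≤-isPartialOrder)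
  open import Algebra.Definitions.RawSemiring (Semiring.rawSemiring semiring) public
    using (sum; product; _^_) renaming (_×_ to _·_)
  open import Algebra.Properties.Semiring.Mult semiring using (×-homo-+; ×1-homo-*)
  open import Algebra.Properties.Ring ring using (-‿distribˡ-*; -‿distribʳ-*)
  open import Algebra.Properties.AbelianGroup +-abelianGroup using (⁻¹-involutive; ⁻¹-∙-comm; ε⁻¹≈ε)

  fromℕ-+ : ∀ a b → fromℕ (a ℕ.+ b) ≈ fromℕ a + fromℕ b
  fromℕ-+ = ×-homo-+ 1#

  fromℕ-* : ∀ a b → fromℕ (a ℕ.* b) ≈ fromℕ a * fromℕ b
  fromℕ-* = ×1-homo-*

  -- Integer coefficients for the ring solver

  private
    ℤ-rawRing : RawRing 0ℓ 0ℓ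
    ℤ-rawRing = CommutativeRing.rawRing ℤ.+-*-commutativeRing

    ℝ-ring : AlmostCommutativeRing 0ℓ 0ℓ
    ℝ-ring = fromCommutativeRing commutativeRing

    fromℤ : ℤ → ℝ
    fromℤ (+ k)      = fromℕ k
    fromℤ (-[1+ k ]) = - fromℕ (suc k)

    fromℤ-⊖ : ∀ a b → fromℤ (a ℤ.⊖ b) ≈ fromℕ a - fromℕ b
    fromℤ-⊖ a zero = ≈-sym (≈-trans (+-congˡ ε⁻¹≈ε) (+-identityʳ _))
    fromℤ-⊖ zero (suc b) = ≈-sym (+-identityˡ _)
    fromℤ-⊖ (suc a) (suc b) = begin
      fromℤ (suc a ℤ.⊖ suc b)                      ≡⟨ ≡.cong fromℤ (ℤ.[1+m]⊖[1+n]≡m⊖n a b) ⟩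
      fromℤ (a ℤ.⊖ b)                              ≈⟨ fromℤ-⊖ a b ⟩
      fromℕ a - fromℕ b                            ≈⟨ +-congʳ (+-identityˡ _) ⟨
      0# + fromℕ a - fromℕ b                       ≈⟨ +-congʳ (+-congʳ (-‿inverseʳ 1#)) ⟨
      1# - 1# + fromℕ a - fromℕ b                  ≈⟨ +-congʳ (≈-trans (+-assoc _ _ _) (≈-trans (+-congˡ (+-comm _ _)) (≈-sym (+-assoc _ _ _)))) ⟩
      (1# + fromℕ a) - 1# - fromℕ b                ≈⟨ +-assoc _ _ _ ⟩
      (1# + fromℕ a) + (- 1# - fromℕ b)            ≈⟨ +-congˡ (⁻¹-∙-comm _ _) ⟩
      (1# + fromℕ a) - (1# + fromℕ b)              ∎
      where open import Relation.Binary.Reasoning.Setoid setoid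

    fromℤ-- : ∀ a → fromℤ (ℤ.- a) ≈ - fromℤ a
    fromℤ-- (+ zero)   = ≈-sym ε⁻¹≈ε
    fromℤ-- (+ suc k)  = ≈-refl
    fromℤ-- (-[1+ k ]) = ≈-sym (⁻¹-involutive _)

    fromℤ-+ : ∀ a b → fromℤ (a ℤ.+ b) ≈ fromℤ a + fromℤ b
    fromℤ-+ (+ a)    (+ b)    = fromℕ-+ a b
    fromℤ-+ (+ a)    -[1+ b ] = fromℤ-⊖ a (suc b)
    fromℤ-+ -[1+ a ] (+ b)    = ≈-trans (fromℤ-⊖ b (suc a)) (+-comm _ _)
    fromℤ-+ -[1+ a ] -[1+ b ] =
      ≈-trans (-‿cong (≈-trans (≈-reflexive (≡.cong (λ k → fromℕ (suc k)) (≡.sym (ℕ.+-suc a b)))) (fromℕ-+ (suc a) (suc b))))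
              (≈-sym (⁻¹-∙-comm _ _))

    fromℤ-*⁺ : ∀ a b → fromℤ (+ a ℤ.* b) ≈ fromℕ a * fromℤ b
    fromℤ-*⁺ a (+ b) = ≈-trans (≈-reflexive (≡.cong fromℤ (≡.sym (ℤ.pos-* a b)))) (fromℕ-* a b)
    fromℤ-*⁺ a -[1+ b ] = begin
      fromℤ (+ a ℤ.* ℤ.- + suc b)      ≡⟨ ≡.cong fromℤ (≡.sym (ℤ.neg-distribʳ-* (+ a) (+ suc b))) ⟩
      fromℤ (ℤ.- (+ a ℤ.* + suc b))    ≈⟨ fromℤ-- (+ a ℤ.* + suc b) ⟩
      - fromℤ (+ a ℤ.* + suc b)        ≈⟨ -‿cong (fromℤ-*⁺ a (+ suc b)) ⟩
      - (fromℕ a * fromℕ (suc b))      ≈⟨ -‿distribʳ-* _ _ ⟩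
      fromℕ a * - fromℕ (suc b)        ∎
      where open import Relation.Binary.Reasoning.Setoid setoid

    fromℤ-* : ∀ a b → fromℤ (a ℤ.* b) ≈ fromℤ a * fromℤ b
    fromℤ-* (+ a) b = fromℤ-*⁺ a b
    fromℤ-* -[1+ a ] b = begin
      fromℤ (ℤ.- + suc a ℤ.* b)      ≡⟨ ≡.cong fromℤ (≡.sym (ℤ.neg-distribˡ-* (+ suc a) b)) ⟩
      fromℤ (ℤ.- (+ suc a ℤ.* b))    ≈⟨ fromℤ-- (+ suc a ℤ.* b) ⟩
      - fromℤ (+ suc a ℤ.* b)        ≈⟨ -‿cong (fromℤ-*⁺ (suc a) b) ⟩
      - (fromℕ (suc a) * fromℤ b)    ≈⟨ -‿distribˡ-* _ _ ⟩
      - fromℕ (suc a) * fromℤ b      ∎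
      where open import Relation.Binary.Reasoning.Setoid setoid

    -- Agrees with fromℤ, but sends 1 to 1# on the nose, so that the solver's constant 1 matches 1#.
    coefficient : ℤ → ℝ
    coefficient (+ 1) = 1#
    coefficient a     = fromℤ a

    coefficient≈fromℤ : ∀ a → coefficient a ≈ fromℤ a
    coefficient≈fromℤ (+ 0)           = ≈-refl
    coefficient≈fromℤ (+ 1)           = ≈-sym (+-identityʳ 1#)
    coefficient≈fromℤ (+ suc (suc _)) = ≈-refl
    coefficient≈fromℤ -[1+ _ ]        = ≈-refl

    ℤ⟶ℝ : ℤ-rawRing -Raw-AlmostCommutative⟶ ℝ-ring
    ℤ⟶ℝ = record
      { ⟦_⟧    = coefficient
      ; +-homo = λ a b → via (a ℤ.+ b) (fromℤ-+ a b) (+-cong (coefficient≈fromℤ a) (coefficient≈fromℤ b))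
      ; *-homo = λ a b → via (a ℤ.* b) (fromℤ-* a b) (*-cong (coefficient≈fromℤ a) (coefficient≈fromℤ b))
      ; -‿homo = λ a → via (ℤ.- a) (fromℤ-- a) (-‿cong (coefficient≈fromℤ a))
      ; 0-homo = ≈-refl
      ; 1-homo = ≈-refl
      }
      where
      via : ∀ a {x y} → fromℤ a ≈ x → y ≈ x → coefficient a ≈ y
      via a p q = ≈-trans (coefficient≈fromℤ a) (≈-trans p (≈-sym q))

    _≟ᶜ_ : WeaklyDecidable (Induced-equivalence ℤ⟶ℝ)
    a ≟ᶜ b = map (λ e → ≈-reflexive (≡.cong coefficient e)) (dec⇒maybe (a ℤ.≟ b))

  open import Algebra.Solver.Ring ℤ-rawRing ℝ-ring ℤ⟶ℝ _≟ᶜ_ public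
    using (Polynomial; solve; _:=_; _:+_; _:*_; _:-_; :-_) renaming (con to :con)

  :0 :1 : ∀ {k} → Polynomial k
  :0 = :con (+ 0)
  :1 = :con (+ 1)

  ≤-poset : Poset 0ℓ 0ℓ 0ℓ
  ≤-poset = record { isPartialOrder = ≤-isPartialOrder }

  module ≤-Reasoning where
    open import Relation.Binary.Reasoning.PartialOrder ≤-poset public
  module ≈-Reasoning where
    open import Relation.Binary.Reasoning.Setoid setoid public

  ≤-resp₂ : ∀ {a b c d} → a ≈ c → b ≈ d → a ≤ b → c ≤ d
  ≤-resp₂ p q a≤b = ≤-trans (≤-reflexive (≈-sym p)) (≤-trans a≤b (≤-reflexive q))

  ≤⇒0≤- : ∀ {a b} → a ≤ b → 0# ≤ b - a
  ≤⇒0≤- {a} {b} a≤b = ≤-resp₂ (-‿inverseʳ a) ≈-refl (+-monoˡ-≤ (- a) a≤b)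

  -- The shape in which inequalities reach the ring solver: `e` is assembled from products of
  -- differences known to be nonnegative, and the solver verifies that it equals `b - a`.
  ≤-by : ∀ {a b e} → 0# ≤ e → b - a ≈ e → a ≤ b
  ≤-by {a} {b} {e} 0≤e p = ≤-resp₂ (+-identityˡ a)
    (≈-trans (+-congʳ (≈-sym p)) (solve 2 (λ a b → (b :- a) :+ a := b) ≈-refl _ _)) (+-monoˡ-≤ a 0≤e)

  ≤-by0 : ∀ {a e} → 0# ≤ e → a ≈ e → 0# ≤ a
  ≤-by0 0≤e p = ≤-resp₂ ≈-refl (≈-sym p) 0≤e

  0≤+ : ∀ {a b} → 0# ≤ a → 0# ≤ b → 0# ≤ a + b
  0≤+ {a} {b} p q = ≤-trans q (≤-resp₂ (+-identityˡ b) ≈-refl (+-monoˡ-≤ b p))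

  0≤* : ∀ {a b} → 0# ≤ a → 0# ≤ b → 0# ≤ a * b
  0≤* = *-nonNeg

  0≤-⇒≤ : ∀ {a b} → 0# ≤ b - a → a ≤ b
  0≤-⇒≤ p = ≤-by p ≈-refl

  +-mono-≤ : ∀ {a b c d} → a ≤ b → c ≤ d → a + c ≤ b + d
  +-mono-≤ p q = ≤-by (0≤+ (≤⇒0≤- p) (≤⇒0≤- q))
    (solve 4 (λ a b c d → (b :+ d) :- (a :+ c) := (b :- a) :+ (d :- c)) ≈-refl _ _ _ _)

  *-monoˡ : ∀ {c a b} → 0# ≤ c → a ≤ b → c * a ≤ c * b
  *-monoˡ p q = ≤-by (0≤* p (≤⇒0≤- q)) (solve 3 (λ a b c → c :* b :- c :* a := c :* (b :- a)) ≈-refl _ _ _)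

  *-monoʳ : ∀ {c a b} → 0# ≤ c → a ≤ b → a * c ≤ b * c
  *-monoʳ p q = ≤-by (0≤* p (≤⇒0≤- q)) (solve 3 (λ a b c → b :* c :- a :* c := c :* (b :- a)) ≈-refl _ _ _)

  *-mono-≤ : ∀ {a b c d} → 0# ≤ a → 0# ≤ d → a ≤ b → c ≤ d → a * c ≤ b * d
  *-mono-≤ 0≤a 0≤d p q = ≤-trans (*-monoˡ 0≤a q) (*-monoʳ 0≤d p)

  neg-mono : ∀ {a b} → a ≤ b → - b ≤ - a
  neg-mono p = ≤-by (≤⇒0≤- p) (solve 2 (λ a b → :- a :- (:- b) := b :- a) ≈-refl _ _)

  0≤neg : ∀ {a} → a ≤ 0# → 0# ≤ - a
  0≤neg p = ≤-by0 (≤⇒0≤- p) (≈-sym (+-identityˡ _))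

  0≤sq : ∀ a → 0# ≤ a * a
  0≤sq a with ≤-total 0# a
  ... | inj₁ p = 0≤* p p
  ... | inj₂ p = ≤-by0 (0≤* (0≤neg p) (0≤neg p)) (solve 1 (λ a → a :* a := :- a :* :- a) ≈-refl _)

  0≤1 : 0# ≤ 1#
  0≤1 = ≤-resp₂ ≈-refl (*-identityˡ 1#) (0≤sq 1#)

  0<1 : 0# < 1#
  0<1 = 0≤1 , 0≉1

  <⇒≤ : ∀ {a b} → a < b → a ≤ b
  <⇒≤ = proj₁

  <⇒≱ : ∀ {a b} → a < b → ¬ b ≤ a
  <⇒≱ (p , q) r = q (≤-antisym p r)

  ≤∧≱⇒< : ∀ {a b} → a ≤ b → ¬ b ≤ a → a < b
  ≤∧≱⇒< p q = p , λ e → q (≤-reflexive (≈-sym e))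

  ≰⇒> : ∀ {a b} → ¬ a ≤ b → b < a
  ≰⇒> {a} {b} q with ≤-total a b
  ... | inj₁ p = ⊥-elim (q p)
  ... | inj₂ p = ≤∧≱⇒< p q

  ≮⇒≥ : ∀ {a b} → ¬ a < b → b ≤ a
  ≮⇒≥ {a} {b} q with em {b ≤ a}
  ... | yes p = p
  ... | no p  = ⊥-elim (q (≰⇒> p))

  <-≤-trans : ∀ {a b c} → a < b → b ≤ c → a < c
  <-≤-trans p q = ≤∧≱⇒< (≤-trans (<⇒≤ p) q) λ r → <⇒≱ p (≤-trans q r)

  ≤-<-trans : ∀ {a b c} → a ≤ b → b < c → a < c
  ≤-<-trans p q = ≤∧≱⇒< (≤-trans p (<⇒≤ q)) λ r → <⇒≱ q (≤-trans r p)

  <⇒0<- : ∀ {a b} → a < b → 0# < b - a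
  <⇒0<- p = ≤∧≱⇒< (≤⇒0≤- (<⇒≤ p)) λ r → <⇒≱ p (≤-by (0≤neg r)
    (solve 2 (λ a b → a :- b := :- (b :- a)) ≈-refl _ _))

  0<-⇒< : ∀ {a b} → 0# < b - a → a < b
  0<-⇒< p = ≤∧≱⇒< (0≤-⇒≤ (<⇒≤ p)) λ r → <⇒≱ p (≤-by (≤⇒0≤- r)
    (solve 2 (λ a b → :0 :- (b :- a) := a :- b) ≈-refl _ _))

  >⇒≉0 : ∀ {a} → 0# < a → ¬ a ≈ 0#
  >⇒≉0 (p , q) r = q (≈-sym r)

  0≤∧≉0⇒0< : ∀ {a} → 0# ≤ a → ¬ a ≈ 0# → 0# < a
  0≤∧≉0⇒0< p q = p , λ r → q (≈-sym r)

  *-cancel-≈0 : ∀ {a b} → ¬ a ≈ 0# → a * b ≈ 0# → b ≈ 0#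
  *-cancel-≈0 {a} {b} a≉0 p = begin
    b                 ≈⟨ *-identityˡ b ⟨
    1# * b            ≈⟨ *-congʳ (*-inverseʳ a≉0) ⟨
    a * a ⁻¹ * b      ≈⟨ solve 3 (λ a b c → a :* c :* b := c :* (a :* b)) ≈-refl _ _ _ ⟩
    a ⁻¹ * (a * b)    ≈⟨ *-congˡ p ⟩
    a ⁻¹ * 0#         ≈⟨ zeroʳ _ ⟩
    0#                ∎
    where open ≈-Reasoning

  0<* : ∀ {a b} → 0# < a → 0# < b → 0# < a * b
  0<* p q = 0≤∧≉0⇒0< (0≤* (<⇒≤ p) (<⇒≤ q)) λ r → >⇒≉0 q (*-cancel-≈0 (>⇒≉0 p) r)

  0<+ : ∀ {a b} → 0# < a → 0# ≤ b → 0# < a + b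
  0<+ {a} {b} p q = <-≤-trans p (≤-by q (solve 2 (λ a b → (a :+ b) :- a := b) ≈-refl _ _))

  *-cancelˡ-≤ : ∀ {c a b} → 0# < c → c * a ≤ c * b → a ≤ b
  *-cancelˡ-≤ {c} {a} {b} 0<c p = ≮⇒≥ λ b<a → <⇒≱ (0<* 0<c (<⇒0<- b<a))
    (≤-by (≤⇒0≤- p) (solve 3 (λ a b c → :0 :- c :* (a :- b) := c :* b :- c :* a) ≈-refl _ _ _))

  sq≈0⇒≈0 : ∀ {a} → a * a ≈ 0# → a ≈ 0#
  sq≈0⇒≈0 {a} p with em {a ≈ 0#}
  ... | yes q = q
  ... | no q  = *-cancel-≈0 q p

  0<⁻¹ : ∀ {a} → 0# < a → 0# < a ⁻¹
  0<⁻¹ {a} p = ≰⇒> λ q → <⇒≱ 0<1 (≤-by (0≤* (<⇒≤ p) (0≤neg q))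
    (≈-trans (+-congˡ (-‿cong (≈-sym (*-inverseʳ (>⇒≉0 p))))) (solve 2 (λ a b → :0 :- a :* b := a :* (:- b)) ≈-refl _ _)))

  *-÷ : ∀ {a} b → 0# < a → a * (b ÷ a) ≈ b
  *-÷ {a} b p = begin
    a * (b * a ⁻¹)  ≈⟨ solve 3 (λ a b c → a :* (b :* c) := b :* (a :* c)) ≈-refl _ _ _ ⟩
    b * (a * a ⁻¹)  ≈⟨ *-congˡ (*-inverseʳ (>⇒≉0 p)) ⟩
    b * 1#          ≈⟨ *-comm _ _ ⟩
    1# * b          ≈⟨ *-identityˡ b ⟩
    b               ∎
    where open ≈-Reasoning

  0≤÷ : ∀ {a b} → 0# ≤ a → 0# < b → 0# ≤ a ÷ b
  0≤÷ p q = 0≤* p (<⇒≤ (0<⁻¹ q))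

  0<÷ : ∀ {a b} → 0# < a → 0# < b → 0# < a ÷ b
  0<÷ p q = 0<* p (0<⁻¹ q)

  ≤-÷ : ∀ {a b c} → 0# < c → c * a ≤ b → a ≤ b ÷ c
  ≤-÷ p q = *-cancelˡ-≤ p (≤-trans q (≤-reflexive (≈-sym (*-÷ _ p))))

  ÷-≤ : ∀ {a b c} → 0# < c → a ≤ c * b → a ÷ c ≤ b
  ÷-≤ p q = *-cancelˡ-≤ p (≤-trans (≤-reflexive (*-÷ _ p)) q)

  ≈-÷ : ∀ {a b c} → 0# < c → c * a ≈ b → a ≈ b ÷ c
  ≈-÷ p q = ≤-antisym (≤-÷ p (≤-reflexive q)) (÷-≤ p (≤-reflexive (≈-sym q)))

  minimum : ∀ {a b} → 0# < a → 0# < b → ∃[ c ] 0# < c × c ≤ a × c ≤ b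
  minimum {a} {b} p q with ≤-total a b
  ... | inj₁ r = a , p , ≤-refl , r
  ... | inj₂ r = b , q , r , ≤-refl

  -- If `b < a`, then ε = (a - b) / (1 + K) satisfies K ε = (a - b) - ε, and the hypothesis would
  -- make this ε at most 0. Estimates pass to the limit ε → 0 through this lemma.
  ≤-ε : ∀ {a b K} → 0# ≤ K → (∀ ε → 0# < ε → a ≤ b + K * ε) → a ≤ b
  ≤-ε {a} {b} {K} 0≤K h = ≮⇒≥ λ b<a →
    let 0<K+1 = 0<+ 0<1 0≤K
        δ = a - b
        ε = δ ÷ (1# + K)
        0<ε : 0# < ε
        0<ε = 0<÷ (<⇒0<- b<a) 0<K+1
        e : (1# + K) * ε ≈ δ
        e = *-÷ δ 0<K+1
    in <⇒≱ 0<ε (≤-by (≤⇒0≤- (h ε 0<ε)) (begin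
         0# - ε                          ≈⟨ solve 2 (λ K e → :0 :- e := K :* e :- (:1 :+ K) :* e) ≈-refl K ε ⟩
         K * ε - (1# + K) * ε            ≈⟨ +-congˡ (-‿cong e) ⟩
         K * ε - (a - b)                 ≈⟨ solve 3 (λ a b k → k :- (a :- b) := (b :+ k) :- a) ≈-refl _ _ _ ⟩
         (b + K * ε) - a                 ∎))
    where open ≈-Reasoning

  0≤fromℕ : ∀ k → 0# ≤ fromℕ k
  0≤fromℕ zero    = ≤-refl
  0≤fromℕ (suc k) = 0≤+ 0≤1 (0≤fromℕ k)

  0<fromℕ : ∀ {k} → 0 ℕ.< k → 0# < fromℕ k
  0<fromℕ {suc k} _ = 0<+ 0<1 (0≤fromℕ k)

  fromℕ-mono : ∀ {a b} → a ℕ.≤ b → fromℕ a ≤ fromℕ b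
  fromℕ-mono {b = b} z≤n = 0≤fromℕ b
  fromℕ-mono (s≤s p)     = +-mono-≤ ≤-refl (fromℕ-mono p)

  fromℕ-1 : fromℕ 1 ≈ 1#
  fromℕ-1 = +-identityʳ 1#

  -- Absolute value

  abs : ℝ → ℝ
  abs x with ≤-total 0# x
  ... | inj₁ _ = x
  ... | inj₂ _ = - x

  0≤abs : ∀ x → 0# ≤ abs x
  0≤abs x with ≤-total 0# x
  ... | inj₁ p = p
  ... | inj₂ p = 0≤neg p

  x≤abs : ∀ x → x ≤ abs x
  x≤abs x with ≤-total 0# x
  ... | inj₁ p = ≤-refl
  ... | inj₂ p = ≤-trans p (0≤neg p)

  -x≤abs : ∀ x → - x ≤ abs x
  -x≤abs x with ≤-total 0# x
  ... | inj₁ p = ≤-trans (≤-by p (solve 1 (λ a → :0 :- (:- a) := a) ≈-refl _)) p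
  ... | inj₂ p = ≤-refl

  abs-≤ : ∀ {x b} → x ≤ b → - x ≤ b → abs x ≤ b
  abs-≤ {x} p q with ≤-total 0# x
  ... | inj₁ _ = p
  ... | inj₂ _ = q

  abs-* : ∀ {c} x → 0# ≤ c → abs (c * x) ≈ c * abs x
  abs-* {c} x 0≤c = ≤-antisym
    (abs-≤ (*-monoˡ 0≤c (x≤abs x)) (≤-resp₂ (solve 2 (λ c x → c :* (:- x) := :- (c :* x)) ≈-refl _ _) ≈-refl (*-monoˡ 0≤c (-x≤abs x))))
    lower
    where
    lower : c * abs x ≤ abs (c * x)
    lower with ≤-total 0# x
    ... | inj₁ _ = x≤abs (c * x)
    ... | inj₂ _ = ≤-trans (≤-reflexive (solve 2 (λ c x → c :* (:- x) := :- (c :* x)) ≈-refl _ _)) (-x≤abs (c * x))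

  abs-0⇒0 : ∀ {x} → abs x ≈ 0# → x ≈ 0#
  abs-0⇒0 {x} p = ≤-antisym (≤-trans (x≤abs x) (≤-reflexive p))
    (≤-by (≤⇒0≤- (≤-trans (-x≤abs x) (≤-reflexive p))) (solve 1 (λ a → a :- :0 := :0 :- (:- a)) ≈-refl _))

  abs-triangle : ∀ x y → abs (x + y) ≤ abs x + abs y
  abs-triangle x y = abs-≤ (+-mono-≤ (x≤abs x) (x≤abs y))
    (≤-trans (≤-reflexive (solve 2 (λ x y → :- (x :+ y) := :- x :+ :- y) ≈-refl _ _)) (+-mono-≤ (-x≤abs x) (-x≤abs y)))

  abs-prod : ∀ x y → x * y ≤ abs x * abs y
  abs-prod x y with ≤-total 0# x
  ... | inj₁ p = *-monoˡ p (x≤abs y)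
  ... | inj₂ p = ≤-trans (≤-reflexive (solve 2 (λ x y → x :* y := :- x :* :- y) ≈-refl _ _)) (*-monoˡ (0≤neg p) (-x≤abs y))

  abs-sym : ∀ x y → abs (x - y) ≈ abs (y - x)
  abs-sym x y = ≤-antisym (flip x y) (flip y x)
    where
    flip : ∀ x y → abs (x - y) ≤ abs (y - x)
    flip x y = abs-≤
      (≤-trans (≤-reflexive (solve 2 (λ x y → x :- y := :- (y :- x)) ≈-refl _ _)) (-x≤abs _))
      (≤-trans (≤-reflexive (solve 2 (λ x y → :- (x :- y) := y :- x) ≈-refl _ _)) (x≤abs _))

  -- Indicators and finite sums

  ind : Set → ℝ
  ind P = if does (em {P}) then 1# else 0#

  module _ {P : Set} where

    ind-yes : P → ind P ≈ 1#
    ind-yes p with em {P}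
    ... | yes _ = ≈-refl
    ... | no q  = ⊥-elim (q p)

    ind-no : ¬ P → ind P ≈ 0#
    ind-no p with em {P}
    ... | yes q = ⊥-elim (p q)
    ... | no _  = ≈-refl

    0≤ind : 0# ≤ ind P
    0≤ind with em {P}
    ... | yes _ = 0≤1
    ... | no _  = ≤-refl

    ind≤1 : ind P ≤ 1#
    ind≤1 with em {P}
    ... | yes _ = ≤-refl
    ... | no _  = 0≤1

  ind-cong : ∀ {P Q : Set} → (P → Q) → (Q → P) → ind P ≈ ind Q
  ind-cong {P} {Q} f g with em {P}
  ... | yes p = ≈-sym (ind-yes (f p))
  ... | no p  = ≈-sym (ind-no (p ∘ g))

  ind-× : ∀ {P Q : Set} → ind (P × Q) ≈ ind P * ind Q
  ind-× {P} {Q} with em {P}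
  ... | yes p = ≈-trans (ind-cong proj₂ (p ,_)) (≈-sym (*-identityˡ _))
  ... | no p  = ≈-trans (ind-no (p ∘ proj₁)) (≈-sym (zeroˡ _))

  ind-idem : ∀ {P : Set} → ind P * ind P ≈ ind P
  ind-idem {P} = ≈-trans (≈-sym ind-×) (ind-cong proj₁ (λ p → p , p))

  open import Algebra.Properties.Semiring.Sum semiring public
    using (∑-distrib-+; ∑-comm; *-distribˡ-sum; *-distribʳ-sum; sum-replicate-zero)
  import Algebra.Properties.Semiring.Sum semiring as Sum

  sum-cong : ∀ {k} {f g : Fin k → ℝ} → (∀ i → f i ≈ g i) → sum f ≈ sum g
  sum-cong = Sum.sum-cong-≋

  sum-zero : ∀ {k} {f : Fin k → ℝ} → (∀ i → f i ≈ 0#) → sum f ≈ 0#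
  sum-zero {k} p = ≈-trans (sum-cong p) (sum-replicate-zero k)

  sum-mono : ∀ {k} {f g : Fin k → ℝ} → (∀ i → f i ≤ g i) → sum f ≤ sum g
  sum-mono {zero}  p = ≤-refl
  sum-mono {suc k} p = +-mono-≤ (p zero) (sum-mono (p ∘ suc))

  0≤sum : ∀ {k} {f : Fin k → ℝ} → (∀ i → 0# ≤ f i) → 0# ≤ sum f
  0≤sum {k} p = ≤-resp₂ (sum-replicate-zero k) ≈-refl (sum-mono p)

  term≤sum : ∀ {k} {f : Fin k → ℝ} → (∀ i → 0# ≤ f i) → ∀ i → f i ≤ sum f
  term≤sum {f = f} p zero = ≤-by (0≤sum (p ∘ suc)) (solve 2 (λ a b → (a :+ b) :- a := b) ≈-refl _ _)
  term≤sum {f = f} p (suc i) = ≤-trans (term≤sum (p ∘ suc) i) (≤-by (p zero) (solve 2 (λ a b → (a :+ b) :- b := a) ≈-refl _ _))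

  sum≈0⇒term≈0 : ∀ {k} {f : Fin k → ℝ} → (∀ i → 0# ≤ f i) → sum f ≈ 0# → ∀ i → f i ≈ 0#
  sum≈0⇒term≈0 p q i = ≤-antisym (≤-trans (term≤sum p i) (≤-reflexive q)) (p i)

  sum-*ˡ : ∀ {k} c (f : Fin k → ℝ) → sum (λ i → c * f i) ≈ c * sum f
  sum-*ˡ c f = ≈-sym (*-distribˡ-sum c f)

  sum-*ʳ : ∀ {k} c (f : Fin k → ℝ) → sum (λ i → f i * c) ≈ sum f * c
  sum-*ʳ c f = ≈-sym (*-distribʳ-sum c f)

  sum-+ : ∀ {k} (f g : Fin k → ℝ) → sum (λ i → f i + g i) ≈ sum f + sum g
  sum-+ = ∑-distrib-+

  sum-neg : ∀ {k} (f : Fin k → ℝ) → sum (λ i → - f i) ≈ - sum f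
  sum-neg f = ≈-trans (sum-cong λ i → solve 1 (λ a → :- a := (:- :1) :* a) ≈-refl (f i))
    (≈-trans (sum-*ˡ (- 1#) f) (solve 1 (λ a → (:- :1) :* a := :- a) ≈-refl (sum f)))

  sum-- : ∀ {k} (f g : Fin k → ℝ) → sum (λ i → f i - g i) ≈ sum f - sum g
  sum-- f g = ≈-trans (sum-+ f _) (+-congˡ (sum-neg g))

  sum-pick : ∀ {k} (u : Fin k) (f : Fin k → ℝ) → sum (λ v → ind (v ≡ u) * f v) ≈ f u
  sum-pick {suc k} zero f = ≈-trans (+-cong (≈-trans (*-congʳ (ind-yes ≡.refl)) (*-identityˡ _))
    (sum-zero {k} λ i → ≈-trans (*-congʳ (ind-no λ ())) (zeroˡ _))) (+-identityʳ _)
  sum-pick {suc k} (suc u) f = ≈-trans (+-cong (≈-trans (*-congʳ (ind-no λ ())) (zeroˡ _))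
    (≈-trans (sum-cong {k} λ i → *-congʳ (ind-cong (λ { ≡.refl → ≡.refl }) (≡.cong (λ j → suc j)))) (sum-pick u (f ∘ suc)))) (+-identityˡ _)

  -- Compactness and Rayleigh quotients

  ¬∀ε⇒∃ε¬ : {Q : ℝ → Set} → ¬ (∀ ε → 0# < ε → Q ε) → ∃[ ε ] 0# < ε × ¬ Q ε
  ¬∀ε⇒∃ε¬ {Q} p with em {∃[ ε ] 0# < ε × ¬ Q ε}
  ... | yes q = q
  ... | no q  = ⊥-elim (p λ ε 0<ε → case ε 0<ε (em {Q ε}))
    where
    case : ∀ ε → 0# < ε → Dec (Q ε) → Q ε
    case ε 0<ε (yes r) = r
    case ε 0<ε (no r)  = ⊥-elim (q (ε , 0<ε , r))

  approach-supremum : (T : ℝ → Set) → ∀ {s ε} → (∀ b → (∀ t → T t → t ≤ b) → s ≤ b) → 0# < ε → ∃[ t ] T t × s - ε < t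
  approach-supremum T {s} {ε} least 0<ε with em {∃[ t ] T t × s - ε < t}
  ... | yes r = r
  ... | no r  = ⊥-elim (<⇒≱ 0<ε (≤-by (≤⇒0≤- (least (s - ε) λ t h → ≮⇒≥ λ lt → r (t , h , lt)))
    (solve 2 (λ s e → :0 :- e := (s :- e) :- s) ≈-refl _ _)))

  Monotone : {A : Set} → (ℝ → A → Set) → Set
  Monotone P = ∀ {ε ε′ x} → ε ≤ ε′ → P ε x → P ε′ x

  -- P ε x is read as "x is an ε-approximate solution".
  Approximable : {A : Set} → (ℝ → A → Set) → Set
  Approximable P = ∀ ε → 0# < ε → ∃ (P ε)

  -- `s` is the limit superior of the first coordinates as the tolerance shrinks. Since `s + ε` is
  -- not in `T`, approximate solutions of small enough tolerance have first coordinate below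
  -- `s + ε`; an element `t` of `T` above `s - ε` supplies one of that tolerance with first
  -- coordinate at least `t`.
  cluster-head : ∀ {k} (P : ℝ → (Fin (suc k) → ℝ) → Set) (B : ℝ) → Monotone P →
    (∀ {ε x} → P ε x → ∀ i → abs (x i) ≤ B) → Approximable P →
    ∃[ s ] Approximable (λ ε x → P ε x × abs (x zero - s) ≤ ε)
  cluster-head P B mono bounded approx = s , near
    where
    T : ℝ → Set
    T t = ∀ ε → 0# < ε → ∃[ x ] P ε x × t ≤ x zero

    T-inhabited : T (- B)
    T-inhabited ε 0<ε = let x , p = approx ε 0<ε in
      x , p , ≤-trans (neg-mono (≤-trans (-x≤abs (x zero)) (bounded p zero))) (≤-reflexive (solve 1 (λ a → :- (:- a) := a) ≈-refl _))

    T-bounded : ∀ t → T t → t ≤ B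
    T-bounded t h = let x , p , q = h 1# 0<1 in ≤-trans q (≤-trans (x≤abs (x zero)) (bounded p zero))

    sup = supremum T (- B , T-inhabited) (B , T-bounded)
    s = proj₁ sup

    near : ∀ ε → 0# < ε → ∃[ x ] P ε x × abs (x zero - s) ≤ ε
    near ε 0<ε = x , mono ε₂≤ε p ,
      abs-≤ (≤-by (≤⇒0≤- (<⇒≤ (≰⇒> λ r → above x (mono ε₂≤ε₁ p) r)))
               (solve 3 (λ a s e → e :- (a :- s) := (s :+ e) :- a) ≈-refl _ _ _))
            (≤-by (≤⇒0≤- (≤-trans (<⇒≤ s-ε<t) q))
               (solve 3 (λ a s e → e :- (:- (a :- s)) := a :- (s :- e)) ≈-refl _ _ _))
      where
      outside-T : ¬ T (s + ε)
      outside-T h = <⇒≱ 0<ε (≤-by (≤⇒0≤- (proj₁ (proj₂ sup) _ h)) (solve 2 (λ s e → :0 :- e := s :- (s :+ e)) ≈-refl _ _))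
      eventually = ¬∀ε⇒∃ε¬ outside-T
      ε₁ = proj₁ eventually
      above : ∀ x → P ε₁ x → ¬ s + ε ≤ x zero
      above x p q = proj₂ (proj₂ eventually) (x , p , q)
      below : ∃[ t ] T t × s - ε < t
      below = approach-supremum T (proj₂ (proj₂ sup)) 0<ε
      s-ε<t = proj₂ (proj₂ below)
      both = minimum 0<ε (proj₁ (proj₂ eventually))
      ε₂≤ε = proj₁ (proj₂ (proj₂ both))
      ε₂≤ε₁ = proj₂ (proj₂ (proj₂ both))
      point = proj₁ (proj₂ below) (proj₁ both) (proj₁ (proj₂ both))
      x = proj₁ point
      p = proj₁ (proj₂ point)
      q = proj₂ (proj₂ point)

  ClusterPoint : ∀ {k} → (ℝ → (Fin k → ℝ) → Set) → (Fin k → ℝ) → Set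
  ClusterPoint P y = Approximable λ ε x → P ε x × (∀ i → abs (x i - y i) ≤ ε)

  -- Bolzano–Weierstrass
  cluster : ∀ k (P : ℝ → (Fin k → ℝ) → Set) (B : ℝ) → Monotone P →
    (∀ {ε x} → P ε x → ∀ i → abs (x i) ≤ B) → Approximable P →
    ∃ (ClusterPoint P)
  cluster zero P B mono bounded approx = (λ ()) , λ ε 0<ε → let x , p = approx ε 0<ε in x , p , λ ()
  cluster (suc k) P B mono bounded approx = extend (cluster-head P B mono bounded approx)
    where
    module _ (s : ℝ) where
      Tail : ℝ → (Fin k → ℝ) → Set
      Tail ε x′ = ∃[ x ] P ε x × abs (x zero - s) ≤ ε × (∀ i → x′ i ≡ x (suc i))

      Tail-mono : Monotone Tail
      Tail-mono le (x , p , q , e) = x , mono le p , ≤-trans q le , e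

      Tail-bounded : ∀ {ε x′} → Tail ε x′ → ∀ i → abs (x′ i) ≤ B
      Tail-bounded (x , p , q , e) i = ≡.subst (λ a → abs a ≤ B) (≡.sym (e i)) (bounded p (suc i))

      snoc : (Fin k → ℝ) → Fin (suc k) → ℝ
      snoc y zero    = s
      snoc y (suc i) = y i

    extend : ∃[ s ] Approximable (λ ε x → P ε x × abs (x zero - s) ≤ ε) →
      ∃ (ClusterPoint P)
    extend (s , near) = join (cluster k (Tail s) B (Tail-mono s) (λ {ε} {x′} → Tail-bounded s {ε} {x′})
        λ ε 0<ε → let x , p , q = near ε 0<ε in x ∘ suc , x , p , q , λ _ → ≡.refl)
      where
      join : ∃ (ClusterPoint (Tail s)) →
        ∃ (ClusterPoint P)
      join (y , h) = snoc s y , λ ε 0<ε → let x′ , (x , p , p₀ , e) , close = h ε 0<ε in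
        x , p , λ { zero → p₀ ; (suc i) → ≡.subst (λ a → abs (a - y i) ≤ ε) (e i) (close i) }

  abs-close : ∀ {x y ε} → abs (x - y) ≤ ε → abs x ≤ abs y + ε
  abs-close {x} {y} {ε} p = abs-≤
    (≤-trans (≤-reflexive (solve 2 (λ x y → x := y :+ (x :- y)) ≈-refl _ _)) (+-mono-≤ (x≤abs y) (≤-trans (x≤abs _) p)))
    (≤-trans (≤-reflexive (solve 2 (λ x y → :- x := :- y :+ :- (x :- y)) ≈-refl _ _)) (+-mono-≤ (-x≤abs y) (≤-trans (-x≤abs _) p)))

  abs-*-≤ : ∀ x y → abs (x * y) ≤ abs x * abs y
  abs-*-≤ x y = abs-≤ (abs-prod x y) (≤-trans (≤-reflexive (solve 2 (λ x y → :- (x :* y) := x :* (:- y)) ≈-refl _ _))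
    (≤-trans (abs-prod x (- y)) (*-monoˡ (0≤abs x) (abs-≤ (-x≤abs y) (≤-trans (≤-reflexive (solve 1 (λ y → :- (:- y) := y) ≈-refl _)) (x≤abs y))))))

  -- Quadratic forms and generalised eigenvalues

  module QuadraticForms {k : ℕ} where

    Vec Matrix : Set
    Vec    = Fin k → ℝ
    Matrix = Fin k → Fin k → ℝ

    bil : Matrix → Vec → Vec → ℝ
    bil A x y = sum λ u → sum λ v → A u v * (x u * y v)

    quad : Matrix → Vec → ℝ
    quad A x = bil A x x

    norm₁ : Matrix → ℝ
    norm₁ A = sum λ u → sum λ v → abs (A u v)

    Symmetric : Matrix → Set
    Symmetric A = ∀ u v → A u v ≈ A v u

    sum₂-cong : {F G : Matrix} → (∀ u v → F u v ≈ G u v) → sum (λ u → sum (F u)) ≈ sum (λ u → sum (G u))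
    sum₂-cong p = sum-cong λ u → sum-cong (p u)

    sum₂-mono : {F G : Matrix} → (∀ u v → F u v ≤ G u v) → sum (λ u → sum (F u)) ≤ sum (λ u → sum (G u))
    sum₂-mono p = sum-mono λ u → sum-mono (p u)

    sum₂-+ : (F G : Matrix) → sum (λ u → sum (λ v → F u v + G u v)) ≈ sum (λ u → sum (F u)) + sum (λ u → sum (G u))
    sum₂-+ F G = ≈-trans (sum-cong λ u → sum-+ (F u) (G u)) (sum-+ (λ u → sum (F u)) (λ u → sum (G u)))

    sum₂-*ˡ : ∀ c (F : Matrix) → sum (λ u → sum (λ v → c * F u v)) ≈ c * sum (λ u → sum (F u))
    sum₂-*ˡ c F = ≈-trans (sum-cong λ u → sum-*ˡ c (F u)) (sum-*ˡ c (λ u → sum (F u)))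

    sum₂-*ʳ : ∀ c (F : Matrix) → sum (λ u → sum (λ v → F u v * c)) ≈ sum (λ u → sum (F u)) * c
    sum₂-*ʳ c F = ≈-trans (sum-cong λ u → sum-*ʳ c (F u)) (sum-*ʳ c (λ u → sum (F u)))

    bil-sym : ∀ {A} → Symmetric A → ∀ x y → bil A x y ≈ bil A y x
    bil-sym {A} A-sym x y = ≈-trans (∑-comm (λ u v → A u v * (x u * y v)))
      (sum₂-cong λ v u → *-cong (A-sym u v) (*-comm _ _))

    quad-scale : ∀ A c x → quad A (λ u → c * x u) ≈ c * c * quad A x
    quad-scale A c x = ≈-trans
      (sum₂-cong λ u v → solve 4 (λ a c x y → a :* ((c :* x) :* (c :* y)) := c :* c :* (a :* (x :* y))) ≈-refl (A u v) c (x u) (x v))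
      (sum₂-*ˡ (c * c) (λ u v → A u v * (x u * x v)))

    quad-step : ∀ {A} → Symmetric A → ∀ s y z →
      quad A (λ u → y u + s * z u) ≈ quad A y + (s * (bil A z y + bil A z y) + s * s * quad A z)
    quad-step {A} A-sym s y z = begin
      quad A (λ u → y u + s * z u)
        ≈⟨ sum₂-cong (λ u v → solve 6 (λ a s x y z t → a :* ((x :+ s :* z) :* (y :+ s :* t)) := (a :* (x :* y)) :+ (s :* ((a :* (z :* y)) :+ (a :* (x :* t))) :+ (s :* s) :* (a :* (z :* t)))) ≈-refl (A u v) s (y u) (y v) (z u) (z v)) ⟩
      sum (λ u → sum (λ v → F u v + (s * (G u v + G′ u v) + s * s * H u v)))
        ≈⟨ sum₂-+ F (λ u v → s * (G u v + G′ u v) + s * s * H u v) ⟩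
      quad A y + sum (λ u → sum (λ v → s * (G u v + G′ u v) + s * s * H u v))
        ≈⟨ +-congˡ (sum₂-+ (λ u v → s * (G u v + G′ u v)) (λ u v → s * s * H u v)) ⟩
      quad A y + (sum (λ u → sum (λ v → s * (G u v + G′ u v))) + sum (λ u → sum (λ v → s * s * H u v)))
        ≈⟨ +-congˡ (+-cong (≈-trans (sum₂-*ˡ s (λ u v → G u v + G′ u v)) (*-congˡ (sum₂-+ G G′))) (sum₂-*ˡ (s * s) H)) ⟩
      quad A y + (s * (bil A z y + bil A y z) + s * s * quad A z)
        ≈⟨ +-congˡ (+-congʳ (*-congˡ (+-congˡ (bil-sym A-sym y z)))) ⟩
      quad A y + (s * (bil A z y + bil A z y) + s * s * quad A z) ∎
      where
      open ≈-Reasoning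
      F G G′ H : Matrix
      F u v  = A u v * (y u * y v)
      G u v  = A u v * (z u * y v)
      G′ u v = A u v * (y u * z v)
      H u v  = A u v * (z u * z v)

    PSD : Matrix → Set
    PSD A = ∀ x → 0# ≤ quad A x

    -- A null vector of a positive semidefinite form is in its kernel: move y slightly in the direction z.
    PSD-kernel : ∀ {A} → Symmetric A → PSD A → ∀ y → quad A y ≈ 0# → ∀ z → bil A z y ≈ 0#
    PSD-kernel {A} A-sym psd y qy≈0 z = sq≈0⇒≈0 (≤-antisym (≤-trans b²≤2b² (≤-ε (0≤* (0≤sq b) (psd z)) bound)) (0≤sq b))
      where
      b = bil A z y
      b²≤2b² : b * b ≤ b * b + b * b
      b²≤2b² = ≤-by (0≤sq b) (solve 1 (λ a → (a :+ a) :- a := a) ≈-refl _)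
      -- The coefficient `- (b * ε)` of `z` makes the linear term -2 b² ε, while the quadratic one
      -- is b² ε² times `quad A z`. Nonnegativity, divided by ε, leaves 2 b² below a multiple of ε.
      bound : ∀ ε → 0# < ε → b * b + b * b ≤ 0# + b * b * quad A z * ε
      bound ε 0<ε = *-cancelˡ-≤ 0<ε (≤-by (psd (λ u → y u + - (b * ε) * z u)) (≈-sym (begin
        quad A (λ u → y u + - (b * ε) * z u)
          ≈⟨ quad-step A-sym (- (b * ε)) y z ⟩
        quad A y + (- (b * ε) * (b + b) + - (b * ε) * - (b * ε) * quad A z)
          ≈⟨ +-congʳ qy≈0 ⟩
        0# + (- (b * ε) * (b + b) + - (b * ε) * - (b * ε) * quad A z)
          ≈⟨ solve 3 (λ b e q → :0 :+ (:- (b :* e) :* (b :+ b) :+ (:- (b :* e)) :* (:- (b :* e)) :* q)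
               := e :* (:0 :+ b :* b :* q :* e) :- e :* (b :* b :+ b :* b)) ≈-refl b ε (quad A z) ⟩
        ε * (0# + b * b * quad A z * ε) - ε * (b * b + b * b) ∎)))
        where open ≈-Reasoning

    quad-lipschitz : ∀ A {x y ε} → (∀ u → abs (x u) ≤ 1#) → (∀ u → abs (y u) ≤ 1#) →
      (∀ u → abs (y u - x u) ≤ ε) → quad A y ≤ quad A x + norm₁ A * (ε + ε)
    quad-lipschitz A {x} {y} {ε} bx by close = begin
      quad A y
        ≈⟨ sum₂-cong (λ u v → solve 5 (λ a x y z t → a :* (y :* t) := a :* (x :* z) :+ a :* (y :* (t :- z) :+ z :* (y :- x))) ≈-refl (A u v) (x u) (y u) (x v) (y v)) ⟩
      sum (λ u → sum (λ v → A u v * (x u * x v) + A u v * d u v))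
        ≈⟨ sum₂-+ (λ u v → A u v * (x u * x v)) (λ u v → A u v * d u v) ⟩
      quad A x + sum (λ u → sum (λ v → A u v * d u v))
        ≤⟨ +-mono-≤ ≤-refl (sum₂-mono λ u v → ≤-trans (abs-prod (A u v) (d u v)) (*-monoˡ (0≤abs _) (d≤ u v))) ⟩
      quad A x + sum (λ u → sum (λ v → abs (A u v) * (ε + ε)))
        ≈⟨ +-congˡ (sum₂-*ʳ (ε + ε) (λ u v → abs (A u v))) ⟩
      quad A x + norm₁ A * (ε + ε) ∎
      where
      open ≤-Reasoning
      d : Matrix
      d u v = y u * (y v - x v) + x v * (y u - x u)
      piece : ∀ a {b} → abs a ≤ 1# → abs b ≤ ε → abs (a * b) ≤ ε
      piece a {b} p q = ≤-trans (abs-*-≤ a b) (≤-trans (*-monoʳ (0≤abs b) p) (≤-trans (≤-reflexive (*-identityˡ _)) q))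
      d≤ : ∀ u v → abs (d u v) ≤ ε + ε
      d≤ u v = ≤-trans (abs-triangle _ _) (+-mono-≤ (piece (y u) (by u) (close v)) (piece (x v) (bx v) (close u)))

    -- With `c = quad W x` this bounds the Rayleigh quotients; with `c = 1` it bounds `quad W` on
    -- normalised vectors.
    quad-≤-norm₁ : ∀ A x {c} → (∀ u → x u * x u ≤ c) → quad A x ≤ norm₁ A * (c + c)
    quad-≤-norm₁ A x {c} h = begin
      quad A x                                              ≤⟨ sum₂-mono (λ u v → ≤-trans (abs-prod _ _) (*-monoˡ (0≤abs (A u v)) (product≤ u v))) ⟩
      sum (λ u → sum (λ v → abs (A u v) * (c + c)))          ≈⟨ sum₂-*ʳ (c + c) (λ u v → abs (A u v)) ⟩
      norm₁ A * (c + c)                                     ∎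
      where
      open ≤-Reasoning
      2ab≤a²+b² : ∀ a b → a * b + a * b ≤ a * a + b * b
      2ab≤a²+b² a b = ≤-by (0≤sq (a - b)) (solve 2 (λ a b → (a :* a :+ b :* b) :- (a :* b :+ a :* b) := (a :- b) :* (a :- b)) ≈-refl a b)
      -2ab≤a²+b² : ∀ a b → - (a * b) + - (a * b) ≤ a * a + b * b
      -2ab≤a²+b² a b = ≤-by (0≤sq (a + b)) (solve 2 (λ a b → (a :* a :+ b :* b) :- (:- (a :* b) :+ :- (a :* b)) := (a :+ b) :* (a :+ b)) ≈-refl a b)
      halve : ∀ {a b} → 0# ≤ b → a + a ≤ b → a ≤ b
      halve {a} {b} 0≤b p with ≤-total 0# a
      ... | inj₁ 0≤a = ≤-trans (≤-by 0≤a (solve 1 (λ a → (a :+ a) :- a := a) ≈-refl a)) p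
      ... | inj₂ a≤0 = ≤-trans a≤0 0≤b
      product≤ : ∀ u v → abs (x u * x v) ≤ c + c
      product≤ u v = ≤-trans (abs-≤ (halve nn (2ab≤a²+b² _ _)) (halve nn (-2ab≤a²+b² _ _))) (+-mono-≤ (h u) (h v))
        where nn = 0≤+ (0≤sq (x u)) (0≤sq (x v))

    quad-0 : ∀ A {x} → (∀ u → x u ≈ 0#) → quad A x ≈ 0#
    quad-0 A {x} p = sum-zero {k} λ u → sum-zero {k} λ v → ≈-trans (*-congˡ (≈-trans (*-congʳ (p u)) (zeroˡ _))) (zeroʳ _)

    quad-- : ∀ A B c x → quad (λ u v → c * B u v - A u v) x ≈ c * quad B x - quad A x
    quad-- A B c x = begin
      quad (λ u v → c * B u v - A u v) x
        ≈⟨ sum₂-cong (λ u v → solve 4 (λ a b c z → (c :* b :- a) :* z := c :* (b :* z) :+ (:- :1) :* (a :* z)) ≈-refl (A u v) (B u v) c (x u * x v)) ⟩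
      sum (λ u → sum (λ v → c * (B u v * (x u * x v)) + - 1# * (A u v * (x u * x v))))
        ≈⟨ sum₂-+ (λ u v → c * (B u v * (x u * x v))) (λ u v → - 1# * (A u v * (x u * x v))) ⟩
      sum (λ u → sum (λ v → c * (B u v * (x u * x v)))) + sum (λ u → sum (λ v → - 1# * (A u v * (x u * x v))))
        ≈⟨ +-cong (sum₂-*ˡ c _) (sum₂-*ˡ (- 1#) _) ⟩
      c * quad B x + - 1# * quad A x
        ≈⟨ solve 2 (λ a b → b :+ (:- :1) :* a := b :- a) ≈-refl _ _ ⟩
      c * quad B x - quad A x ∎
      where open ≈-Reasoning

    δ : Fin k → Vec
    δ v u = ind (u ≡ v)

    bil-δ : ∀ A v y → bil A (δ v) y ≈ sum (λ u → A v u * y u)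
    bil-δ A v y = begin
      sum (λ w → sum (λ u → A w u * (ind (w ≡ v) * y u)))
        ≈⟨ sum₂-cong (λ w u → solve 3 (λ a i y → a :* (i :* y) := i :* (a :* y)) ≈-refl (A w u) (ind (w ≡ v)) (y u)) ⟩
      sum (λ w → sum (λ u → ind (w ≡ v) * (A w u * y u)))
        ≈⟨ sum-cong (λ w → sum-*ˡ (ind (w ≡ v)) (λ u → A w u * y u)) ⟩
      sum (λ w → ind (w ≡ v) * sum (λ u → A w u * y u))
        ≈⟨ sum-pick v (λ w → sum (λ u → A w u * y u)) ⟩
      sum (λ u → A v u * y u) ∎
      where open ≈-Reasoning

    -- The problem A y = μ W y. If μ is the supremum of the quotients `quad A x ÷ quad W x`, then μ
    -- W - A is positive semidefinite, and a maximiser is a null vector of it, hence by `PSD-kernel`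
    -- lies in its kernel. `W-pos` makes W positive definite with an explicit constant.
    module Rayleigh (A W : Matrix) (A-sym : Symmetric A) (W-sym : Symmetric W)
      (W-pos : ∀ x u → x u * x u ≤ quad W x) where

      private
        T : ℝ → Set
        T t = ∃[ x ] (∃[ u ] ¬ x u ≈ 0#) × t * quad W x ≤ quad A x

        0<W : ∀ {x} → (∃[ u ] ¬ x u ≈ 0#) → 0# < quad W x
        0<W {x} (u , xu≉0) = <-≤-trans (0≤∧≉0⇒0< (0≤sq (x u)) (λ p → xu≉0 (sq≈0⇒≈0 p))) (W-pos x u)

        nonzero⊎zero : ∀ (x : Vec) → (∃[ u ] ¬ x u ≈ 0#) ⊎ (∀ u → x u ≈ 0#)
        nonzero⊎zero x with em {∃[ u ] ¬ x u ≈ 0#}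
        ... | yes p = inj₁ p
        ... | no p  = inj₂ λ u → stable u em
          where
          stable : ∀ u → Dec (x u ≈ 0#) → x u ≈ 0#
          stable u (yes q) = q
          stable u (no q)  = ⊥-elim (p (u , q))

        K = norm₁ A + norm₁ A

        T-bounded : ∀ t → T t → t ≤ K
        T-bounded t (x , x≉0 , p) = *-cancelˡ-≤ (0<W x≉0) (≤-trans (≤-reflexive (*-comm _ _)) (≤-trans p
          (≤-trans (quad-≤-norm₁ A x (W-pos x)) (≤-reflexive (solve 2 (λ a w → a :* (w :+ w) := w :* (a :+ a)) ≈-refl _ _)))))

        quotient∈T : ∀ x → (∃[ u ] ¬ x u ≈ 0#) → T (quad A x ÷ quad W x)
        quotient∈T x x≉0 = x , x≉0 , ≤-reflexive (≈-trans (*-comm _ _) (*-÷ _ (0<W x≉0)))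

      private
        module Supremum (μ : ℝ) (upper : ∀ t → T t → t ≤ μ) (least : ∀ b → (∀ t → T t → t ≤ b) → μ ≤ b) where

          G : Matrix
          G u v = μ * W u v - A u v

          G-sym : Symmetric G
          G-sym u v = +-cong (*-congˡ (W-sym u v)) (-‿cong (A-sym u v))

          G-PSD : PSD G
          G-PSD x with nonzero⊎zero x
          ... | inj₂ p = ≤-reflexive (≈-sym (quad-0 G p))
          ... | inj₁ p = ≤-by0 (≤⇒0≤- (≤-trans (≤-reflexive (≈-sym (*-÷ _ (0<W p))))
                  (≤-trans (*-monoˡ (<⇒≤ (0<W p)) (upper _ (quotient∈T x p))) (≤-reflexive (*-comm _ _)))))
                (quad-- A W μ x)

          -- Normalised in the ℓ¹ norm, which needs no square roots: the entries are then at most 1,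
          -- so that `cluster` applies, and a limit of such vectors cannot be zero.
          Approx : ℝ → Vec → Set
          Approx ε x = sum (λ u → abs (x u)) ≈ 1# × quad G x ≤ ε * quad W x

          0≤W : ∀ x → 0# ≤ quad W x
          0≤W x with nonzero⊎zero x
          ... | inj₁ p = <⇒≤ (0<W p)
          ... | inj₂ p = ≤-reflexive (≈-sym (quad-0 W p))

          approx : Approximable Approx
          approx ε 0<ε = (λ u → l ⁻¹ * x u) ,
              ≈-trans (sum-cong λ u → abs-* (x u) (<⇒≤ (0<⁻¹ 0<l))) (≈-trans (sum-*ˡ (l ⁻¹) (λ u → abs (x u))) (≈-trans (*-comm _ _) (*-inverseʳ (>⇒≉0 0<l)))) ,
              ≤-resp₂ (≈-sym (quad-scale G (l ⁻¹) x))
                (≈-trans (solve 3 (λ l e w → l :* l :* (e :* w) := e :* (l :* l :* w)) ≈-refl _ _ _) (*-congˡ (≈-sym (quad-scale W (l ⁻¹) x))))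
                (*-monoˡ (0≤sq (l ⁻¹)) G≤)
            where
            near = approach-supremum T least 0<ε
            t = proj₁ near
            x = proj₁ (proj₁ (proj₂ near))
            x≉0 = proj₁ (proj₂ (proj₁ (proj₂ near)))
            p = proj₂ (proj₂ (proj₁ (proj₂ near)))
            lt = proj₂ (proj₂ near)
            l = sum (λ u → abs (x u))
            0<l : 0# < l
            0<l = <-≤-trans (0≤∧≉0⇒0< (0≤abs _) (λ q → proj₂ x≉0 (abs-0⇒0 q))) (term≤sum (λ u → 0≤abs (x u)) (proj₁ x≉0))
            G≤ : quad G x ≤ ε * quad W x
            G≤ = ≤-trans (≤-reflexive (quad-- A W μ x)) (≤-by
              (0≤+ (≤⇒0≤- p) (0≤* (≤⇒0≤- (<⇒≤ lt)) (0≤W x)))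
              (solve 5 (λ e m t w a → e :* w :- (m :* w :- a) := (a :- t :* w) :+ (t :- (m :- e)) :* w) ≈-refl ε μ t (quad W x) (quad A x)))

          sum≈1⇒≤1 : ∀ {x : Vec} → sum (λ u → abs (x u)) ≈ 1# → ∀ u → abs (x u) ≤ 1#
          sum≈1⇒≤1 p u = ≤-trans (term≤sum (λ u → 0≤abs _) u) (≤-reflexive p)

          limit : ∃ (ClusterPoint Approx)
          limit = cluster k Approx 1#
            (λ { {x = x} le (p , q) → p , ≤-trans q (*-monoʳ (0≤W x) le) })
            (λ { (p , _) → sum≈1⇒≤1 p }) approx

          module Limit (y : Vec) (h : ClusterPoint Approx y) where

            y≤1 : ∀ u → abs (y u) ≤ 1#
            y≤1 u = ≤-ε 0≤1 λ ε 0<ε → let x , (p , _) , close = h ε 0<ε in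
              ≤-trans (abs-close (≤-trans (≤-reflexive (abs-sym _ _)) (close u)))
                (+-mono-≤ (sum≈1⇒≤1 p u) (≤-reflexive (≈-sym (*-identityˡ ε))))

            y≉0 : ∃[ u ] ¬ y u ≈ 0#
            y≉0 with nonzero⊎zero y
            ... | inj₁ p = p
            -- If y vanished, each of the k entries of the nearby x would be at most ε, and their
            -- sum 1 at most k ε.
            ... | inj₂ p = ⊥-elim (<⇒≱ 0<1 (≤-ε (0≤sum {k} {λ _ → 1#} λ _ → 0≤1) λ ε 0<ε →
              let x , (q , _) , close = h ε 0<ε in
              begin
                1#                                ≈⟨ q ⟨
                sum (λ u → abs (x u))             ≤⟨ sum-mono (λ u → ≤-trans (abs-close (close u)) (+-mono-≤ (abs-≤ (≤-reflexive (p u)) (≤-reflexive (≈-trans (-‿cong (p u)) (solve 0 (:- :0 := :0) ≈-refl)))) (≤-reflexive (≈-sym (*-identityˡ ε))))) ⟩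
                sum {k} (λ u → 0# + 1# * ε)       ≈⟨ sum-cong {k} (λ u → +-identityˡ _) ⟩
                sum {k} (λ u → 1# * ε)            ≈⟨ sum-*ʳ {k} ε (λ _ → 1#) ⟩
                sum {k} (λ _ → 1#) * ε            ≈⟨ +-identityˡ _ ⟨
                0# + sum {k} (λ _ → 1#) * ε       ∎))
              where open ≤-Reasoning

            Gy≈0 : quad G y ≈ 0#
            Gy≈0 = ≤-antisym (≤-ε {K = K₁} 0≤K₁ λ ε 0<ε →
              let x , (p , q) , close = h ε 0<ε
                  sq≤1 : ∀ u → x u * x u ≤ 1#
                  sq≤1 u = ≤-trans (abs-prod _ _) (≤-trans (*-mono-≤ (0≤abs _) 0≤1 (sum≈1⇒≤1 p u) (sum≈1⇒≤1 p u)) (≤-reflexive (*-identityˡ 1#)))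
              in begin
                quad G y                                              ≤⟨ quad-lipschitz G (sum≈1⇒≤1 p) y≤1 (λ u → ≤-trans (≤-reflexive (abs-sym _ _)) (close u)) ⟩
                quad G x + norm₁ G * (ε + ε)                          ≤⟨ +-mono-≤ (≤-trans q (*-monoˡ (<⇒≤ 0<ε) (quad-≤-norm₁ W x sq≤1))) ≤-refl ⟩
                ε * (norm₁ W * (1# + 1#)) + norm₁ G * (ε + ε)         ≈⟨ solve 3 (λ e w g → e :* (w :* (:1 :+ :1)) :+ g :* (e :+ e) := :0 :+ (w :+ w :+ (g :+ g)) :* e) ≈-refl ε (norm₁ W) (norm₁ G) ⟩
                0# + K₁ * ε                                           ∎) (G-PSD y)
              where
              open ≤-Reasoning
              K₁ = norm₁ W + norm₁ W + (norm₁ G + norm₁ G)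
              0≤norm₁ : ∀ M → 0# ≤ norm₁ M
              0≤norm₁ M = 0≤sum λ u → 0≤sum λ v → 0≤abs (M u v)
              0≤K₁ : 0# ≤ K₁
              0≤K₁ = 0≤+ (0≤+ (0≤norm₁ W) (0≤norm₁ W)) (0≤+ (0≤norm₁ G) (0≤norm₁ G))

          null-vector : ∃[ y ] (∃[ u ] ¬ y u ≈ 0#) × quad G y ≈ 0#
          null-vector = proj₁ limit , Limit.y≉0 (proj₁ limit) (proj₂ limit) , Limit.Gy≈0 (proj₁ limit) (proj₂ limit)

          eigen : ∀ y → quad G y ≈ 0# → ∀ v → sum (λ u → A v u * y u) ≈ μ * sum (λ u → W v u * y u)
          eigen y Gy≈0 v = ≤-antisym
            (≤-by (≤-reflexive (≈-sym null)) ≈-refl)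
            (≤-by (≤-reflexive (≈-sym (≈-trans (-‿cong null) (solve 0 (:- :0 := :0) ≈-refl)))) (solve 2 (λ a b → a :- b := :- (b :- a)) ≈-refl _ _))
            where
            null : μ * sum (λ u → W v u * y u) - sum (λ u → A v u * y u) ≈ 0#
            null = begin
              μ * sum (λ u → W v u * y u) - sum (λ u → A v u * y u)            ≈⟨ +-congʳ (sum-*ˡ μ (λ u → W v u * y u)) ⟨
              sum (λ u → μ * (W v u * y u)) - sum (λ u → A v u * y u)          ≈⟨ sum-- (λ u → μ * (W v u * y u)) (λ u → A v u * y u) ⟨
              sum (λ u → μ * (W v u * y u) - A v u * y u)                      ≈⟨ sum-cong (λ u → solve 4 (λ m w y a → m :* (w :* y) :- a :* y := (m :* w :- a) :* y) ≈-refl μ (W v u) (y u) (A v u)) ⟩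
              sum (λ u → G v u * y u)                                          ≈⟨ bil-δ G v y ⟨
              bil G (δ v) y                                                    ≈⟨ PSD-kernel G-sym G-PSD y Gy≈0 (δ v) ⟩
              0#                                                               ∎
              where open ≈-Reasoning

      Eigenvector : ℝ → Vec → Set
      Eigenvector μ y = (∃[ u ] ¬ y u ≈ 0#) × (∀ v → sum (λ u → A v u * y u) ≈ μ * sum (λ u → W v u * y u))

      -- Strictness excludes `x₀` = 0, for which both sides vanish; so the quotient of `x₀` exceeds
      -- `c`, and the supremum is at least that quotient.
      eigenvector : ∀ c x₀ → c * quad W x₀ < quad A x₀ → ∃[ μ ] c < μ × ∃ (Eigenvector μ)
      eigenvector c x₀ c<q = conclude (supremum T (_ , quotient∈T x₀ x₀≉0) (K , T-bounded))
        where
        x₀≉0 : ∃[ u ] ¬ x₀ u ≈ 0#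
        x₀≉0 with nonzero⊎zero x₀
        ... | inj₁ p = p
        ... | inj₂ p = ⊥-elim (proj₂ c<q (≈-trans (≈-trans (*-congˡ (quad-0 W p)) (zeroʳ c)) (≈-sym (quad-0 A p))))

        c<quotient : c < quad A x₀ ÷ quad W x₀
        c<quotient = ≰⇒> λ q → <⇒≱ c<q (≤-trans (≤-reflexive (≈-sym (*-÷ _ (0<W x₀≉0))))
          (≤-trans (*-monoˡ (<⇒≤ (0<W x₀≉0)) q) (≤-reflexive (*-comm _ _))))

        conclude : (∃[ μ ] (∀ t → T t → t ≤ μ) × (∀ b → (∀ t → T t → t ≤ b) → μ ≤ b)) →
          ∃[ μ ] c < μ × ∃ (Eigenvector μ)
        conclude (μ , upper , least) = μ , <-≤-trans c<quotient (upper _ (quotient∈T x₀ x₀≉0)) , attained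
          where
          attained : ∃ (Eigenvector μ)
          attained = let y , y≉0 , p = Supremum.null-vector μ upper least in y , y≉0 , Supremum.eigen μ upper least y p

  -- Pach's theorem for maps that need not be injective

  fromℕ-injective : ∀ a b → fromℕ a ≈ fromℕ b → a ≡ b
  fromℕ-injective zero    zero    p = ≡.refl
  fromℕ-injective zero    (suc b) p = ⊥-elim (proj₂ (0<fromℕ {suc b} (s≤s z≤n)) p)
  fromℕ-injective (suc a) zero    p = ⊥-elim (proj₂ (0<fromℕ {suc a} (s≤s z≤n)) (≈-sym p))
  fromℕ-injective (suc a) (suc b) p = ≡.cong suc (fromℕ-injective a b (begin
    fromℕ a                 ≈⟨ solve 1 (λ a → a := (:1 :+ a) :- :1) ≈-refl _ ⟩
    (1# + fromℕ a) - 1#     ≈⟨ +-congʳ p ⟩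
    (1# + fromℕ b) - 1#     ≈⟨ solve 1 (λ a → (:1 :+ a) :- :1 := a) ≈-refl _ ⟩
    fromℕ b                 ∎))
    where open ≈-Reasoning

  halve : ∀ {ε} → 0# < ε → ∃[ ε′ ] 0# < ε′ × ε′ + ε′ ≈ ε
  halve {ε} 0<ε = ε ÷ (1# + 1#) , 0<÷ 0<ε 0<2 ,
    ≈-trans (solve 1 (λ a → a :+ a := (:1 :+ :1) :* a) ≈-refl _) (*-÷ ε 0<2)
    where
    0<2 : 0# < 1# + 1#
    0<2 = 0<+ 0<1 0≤1

  IsWeight : ∀ {k} → (Fin k → ℝ) → Set
  IsWeight t = (∀ i → 0# ≤ t i) × sum t ≈ 1#

  combination : ∀ {k n} → (Fin k → ℝ) → (Fin k → Point n) → Point n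
  combination t p j = sum λ i → t i * p i j

  ApproxHull : ∀ {k n} → (Fin k → Point n) → Point n → ℝ → (Fin k → ℝ) → Set
  ApproxHull p x ε t = IsWeight t × (∀ j → abs (combination t p j - x j) ≤ ε)

  ApproxHull-mono : ∀ {k n} {p : Fin k → Point n} {x} → Monotone (ApproxHull p x)
  ApproxHull-mono le (w , h) = w , λ j → ≤-trans (h j) le

  -- Unlike in `Conv`, the number of weights is fixed by the family `p`, so the weights range over a
  -- compact simplex and limits of them can be taken.
  Hull : ∀ {k n} → (Fin k → Point n) → Point n → Set
  Hull p x = ∃[ t ] IsWeight t × combination t p ≋ x

  weight≤1 : ∀ {k} {t : Fin k → ℝ} → IsWeight t → ∀ i → abs (t i) ≤ 1#
  weight≤1 (t≥0 , Σt) i = abs-≤ (≤-trans (term≤sum t≥0 i) (≤-reflexive Σt)) (≤-trans (≤-by (t≥0 i) (solve 1 (λ a → :0 :- :- a := a) ≈-refl _)) 0≤1)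

  sum-lipschitz : ∀ {k} (c t t′ : Fin k → ℝ) {ε} → (∀ i → abs (t i - t′ i) ≤ ε) →
    abs (sum (λ i → t i * c i) - sum (λ i → t′ i * c i)) ≤ sum (λ i → abs (c i)) * ε
  sum-lipschitz c t t′ {ε} close = abs-≤ (bound t t′ close)
    (≤-trans (≤-reflexive (solve 2 (λ a b → :- (a :- b) := b :- a) ≈-refl _ _))
      (bound t′ t λ i → ≤-trans (≤-reflexive (abs-sym _ _)) (close i)))
    where
    open ≤-Reasoning
    bound : ∀ t t′ → (∀ i → abs (t i - t′ i) ≤ ε) → sum (λ i → t i * c i) - sum (λ i → t′ i * c i) ≤ sum (λ i → abs (c i)) * ε
    bound t t′ close = begin
      sum (λ i → t i * c i) - sum (λ i → t′ i * c i)   ≈⟨ sum-- (λ i → t i * c i) (λ i → t′ i * c i) ⟨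
      sum (λ i → t i * c i - t′ i * c i)               ≤⟨ sum-mono (λ i → ≤-trans (≤-reflexive (solve 3 (λ t s c → t :* c :- s :* c := c :* (t :- s)) ≈-refl _ _ _)) (≤-trans (abs-prod _ _) (*-monoˡ (0≤abs (c i)) (close i)))) ⟩
      sum (λ i → abs (c i) * ε)                        ≈⟨ sum-*ʳ ε (λ i → abs (c i)) ⟩
      sum (λ i → abs (c i)) * ε                        ∎

  abs≤Kε⇒≈ : ∀ {a b K} → 0# ≤ K → (∀ ε → 0# < ε → abs (a - b) ≤ K * ε) → a ≈ b
  abs≤Kε⇒≈ {a} {b} {K} 0≤K h = ≤-antisym (≤-ε 0≤K λ ε 0<ε → shift a b (≤-trans (x≤abs _) (h ε 0<ε)))
    (≤-ε 0≤K λ ε 0<ε → shift b a (≤-trans (≤-reflexive (solve 2 (λ a b → b :- a := :- (a :- b)) ≈-refl _ _)) (≤-trans (-x≤abs _) (h ε 0<ε))))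
    where
    shift : ∀ a b {c} → a - b ≤ c → a ≤ b + c
    shift a b p = ≤-by (≤⇒0≤- p) (solve 3 (λ a b c → (b :+ c) :- a := c :- (a :- b)) ≈-refl _ _ _)

  -- A cluster point of the approximate weights is an exact solution, because the sum, the signs and
  -- the combination all depend continuously on the weights (`sum-lipschitz`).
  hull-closed : ∀ {k n} (p : Fin k → Point n) x → Approximable (ApproxHull p x) → Hull p x
  hull-closed {k} p x approx = finish (cluster k (ApproxHull p x) 1# (ApproxHull-mono {p = p} {x}) (λ h → weight≤1 (proj₁ h)) approx)
    where
    finish : ∃ (ClusterPoint (ApproxHull p x)) → Hull p x
    finish (t , limit) = t , ((λ i → t≥0 i) , Σt) , λ j → abs≤Kε⇒≈ (0≤+ (0≤sum λ i → 0≤abs (p i j)) 0≤1) λ ε 0<ε →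
        let t′ , (_ , h) , close = limit ε 0<ε in
        ≤-trans (≤-reflexive-abs j t′) (≤-trans (abs-triangle _ _) (≤-trans
          (+-mono-≤ (sum-lipschitz (λ i → p i j) t t′ (λ i → ≤-trans (≤-reflexive (abs-sym _ _)) (close i))) (h j))
          (≤-reflexive (solve 2 (λ K e → K :* e :+ e := (K :+ :1) :* e) ≈-refl _ _))))
      where
      abs-cong : ∀ {a b} → a ≈ b → abs a ≤ abs b
      abs-cong p = abs-≤ (≤-trans (≤-reflexive p) (x≤abs _)) (≤-trans (≤-reflexive (-‿cong p)) (-x≤abs _))
      ≤-reflexive-abs : ∀ j t′ → abs (combination t p j - x j) ≤ abs ((combination t p j - combination t′ p j) + (combination t′ p j - x j))
      ≤-reflexive-abs j t′ = abs-cong (solve 3 (λ a b c → a :- c := (a :- b) :+ (b :- c)) ≈-refl _ _ _)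
      t≥0 : ∀ i → 0# ≤ t i
      t≥0 i = ≤-ε 0≤1 λ ε 0<ε → let t′ , ((t′≥0 , _) , _) , close = limit ε 0<ε in
        ≤-by (0≤+ (t′≥0 i) (≤⇒0≤- (≤-trans (x≤abs _) (close i)))) (solve 3 (λ t s e → (t :+ :1 :* e) :- :0 := s :+ (e :- (s :- t))) ≈-refl _ _ _)
      Σt : sum t ≈ 1#
      Σt = abs≤Kε⇒≈ (0≤sum {k} {λ _ → abs 1#} λ _ → 0≤abs 1#) λ ε 0<ε → let t′ , ((_ , Σt′) , _) , close = limit ε 0<ε in
        ≤-trans (abs-cong (+-cong (sum-cong λ i → ≈-sym (≈-trans (*-comm _ _) (*-identityˡ (t i)))) (-‿cong (≈-trans (≈-sym Σt′) (sum-cong λ i → ≈-sym (≈-trans (*-comm _ _) (*-identityˡ (t′ i))))))))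
          (sum-lipschitz (λ _ → 1#) t t′ (λ i → ≤-trans (≤-reflexive (abs-sym _ _)) (close i)))

  -- A combination in `Conv` may use a point repeatedly or not at all; `T v` collects the weights of
  -- all the points that were identified as `g v`.
  conv⇒hull : ∀ {k n} (g : Fin k → Point n) {x} → Conv (Image g ⊤) x → Hull g x
  conv⇒hull {k} g {x} (l , t , p , t≥0 , Σt , p∈g , Σp) = T , (T≥0 , ΣT) , λ j → ≈-trans (ΣTg j) (Σp j)
    where
    open ≈-Reasoning
    index : Fin l → Fin k
    index i = proj₁ (p∈g i)
    T : Fin k → ℝ
    T v = sum λ i → ind (v ≡ index i) * t i
    T≥0 : ∀ v → 0# ≤ T v
    T≥0 v = 0≤sum λ i → 0≤* 0≤ind (t≥0 i)
    ΣT : sum T ≈ 1#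
    ΣT = begin
      sum T                                                ≈⟨ ∑-comm (λ v i → ind (v ≡ index i) * t i) ⟩
      sum (λ i → sum (λ v → ind (v ≡ index i) * t i))      ≈⟨ sum-cong (λ i → sum-pick (index i) (λ _ → t i)) ⟩
      sum t                                                ≈⟨ Σt ⟩
      1#                                                   ∎
    ΣTg : ∀ j → combination T g j ≈ combination t p j
    ΣTg j = begin
      sum (λ v → T v * g v j)                                       ≈⟨ sum-cong (λ v → sum-*ʳ (g v j) (λ i → ind (v ≡ index i) * t i)) ⟨
      sum (λ v → sum (λ i → ind (v ≡ index i) * t i * g v j))       ≈⟨ ∑-comm (λ v i → ind (v ≡ index i) * t i * g v j) ⟩
      sum (λ i → sum (λ v → ind (v ≡ index i) * t i * g v j))       ≈⟨ sum-cong (λ i → sum-cong λ v → *-assoc (ind (v ≡ index i)) (t i) (g v j)) ⟩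
      sum (λ i → sum (λ v → ind (v ≡ index i) * (t i * g v j)))     ≈⟨ sum-cong (λ i → sum-pick (index i) (λ v → t i * g v j)) ⟩
      sum (λ i → t i * g (index i) j)                               ≈⟨ sum-cong (λ i → *-congˡ (proj₂ (proj₂ (p∈g i)) j)) ⟨
      combination t p j                                             ∎

  enum : ∀ {N} (S : Subset N) → Fin ∣ S ∣ → Fin N
  enum (true ∷ S)  zero    = zero
  enum (true ∷ S)  (suc a) = suc (enum S a)
  enum (false ∷ S) a       = suc (enum S a)

  enum-injective : ∀ {N} (S : Subset N) {a b} → enum S a ≡ enum S b → a ≡ b
  enum-injective (true ∷ S)  {zero}  {zero}  _ = ≡.refl
  enum-injective (true ∷ S)  {suc a} {suc b} p = ≡.cong suc (enum-injective S (Fin.suc-injective p))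
  enum-injective (false ∷ S) p = enum-injective S (Fin.suc-injective p)

  enum∈ : ∀ {N} (S : Subset N) a → enum S a ∈ S
  enum∈ (true ∷ S)  zero    = here
  enum∈ (true ∷ S)  (suc a) = there (enum∈ S a)
  enum∈ (false ∷ S) a       = there (enum∈ S a)

  sum-enum : ∀ {N} (S : Subset N) (g : Fin N → ℝ) → sum (λ v → ind (v ∈ S) * g v) ≈ sum (λ a → g (enum S a))
  sum-enum [] g = ≈-refl
  sum-enum {suc N} (true ∷ S) g = +-cong (≈-trans (*-congʳ (ind-yes here)) (*-identityˡ _))
    (≈-trans (sum-cong {N} λ v → *-congʳ {g (suc v)} (ind-cong drop-there there)) (sum-enum S (g ∘ suc)))
  sum-enum {suc N} (false ∷ S) g = ≈-trans (+-cong (≈-trans (*-congʳ (ind-no λ ())) (zeroˡ _))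
    (≈-trans (sum-cong {N} λ v → *-congʳ {g (suc v)} (ind-cong drop-there there)) (sum-enum S (g ∘ suc)))) (+-identityˡ _)

  sum-1 : ∀ k → sum {k} (λ _ → 1#) ≈ fromℕ k
  sum-1 zero    = ≈-refl
  sum-1 (suc k) = +-congˡ (sum-1 k)

  ∣∣-sum : ∀ {N} (S : Subset N) → sum (λ v → ind (v ∈ S)) ≈ fromℕ ∣ S ∣
  ∣∣-sum S = ≈-trans (sum-cong λ v → ≈-sym (≈-trans (*-comm (ind (v ∈ S)) 1#) (*-identityˡ _)))
    (≈-trans (sum-enum S (λ _ → 1#)) (sum-1 ∣ S ∣))

  comprehension : ∀ {N} → (Fin N → Set) → Subset N
  comprehension Q = tabulate λ v → does (em {Q v})

  ∈-comprehension⁺ : ∀ {N} (Q : Fin N → Set) {v} → Q v → v ∈ comprehension Q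
  ∈-comprehension⁺ Q {v} q = lookup⇒[]= v _ (≡.trans (lookup∘tabulate _ v) e)
    where
    e : does (em {Q v}) ≡ true
    e with em {Q v}
    ... | yes _ = ≡.refl
    ... | no r  = ⊥-elim (r q)

  ∈-comprehension⁻ : ∀ {N} (Q : Fin N → Set) {v} → v ∈ comprehension Q → Q v
  ∈-comprehension⁻ Q {v} m = e (≡.trans (≡.sym (lookup∘tabulate _ v)) ([]=⇒lookup m))
    where
    e : does (em {Q v}) ≡ true → Q v
    e p with em {Q v}
    ... | yes q = q

  ∃-uniform : ∀ {k} (Q : Fin k → ℝ → Set) → (∀ i {δ δ′} → δ ≤ δ′ → Q i δ′ → Q i δ) →
    (∀ i → ∃[ δ ] 0# < δ × Q i δ) → ∃[ δ ] 0# < δ × (∀ i → Q i δ)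
  ∃-uniform {zero}  Q anti h = 1# , 0<1 , λ ()
  ∃-uniform {suc k} Q anti h =
    let δ₁ , 0<δ₁ , q₁ = h zero
        δ₂ , 0<δ₂ , q₂ = ∃-uniform (Q ∘ suc) (λ i → anti (suc i)) (h ∘ suc)
        δ , 0<δ , le₁ , le₂ = minimum 0<δ₁ 0<δ₂
    in δ , 0<δ , λ { zero → anti zero le₁ q₁ ; (suc i) → anti (suc i) le₂ (q₂ i) }

  -- Pigeonhole principle: one of the finitely many subsets serves arbitrarily small ε, hence by
  -- monotonicity all ε. The elements are decided one at a time; if `inside` fails at some
  -- tolerance, every solution of smaller tolerance starts with `outside`.
  ∃-subset : ∀ {N} (Q : ℝ → Subset N → Set) → Monotone Q → Approximable Q → ∃[ V ] ∀ ε → 0# < ε → Q ε V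
  ∃-subset {zero} Q mono h = [] , λ ε 0<ε → at ε (h ε 0<ε)
    where
    at : ∀ ε → ∃ (Q ε) → Q ε []
    at ε ([] , q) = q
  ∃-subset {suc N} Q mono h with em {Approximable (λ ε V → Q ε (inside ∷ V))}
  ... | yes p = let V , q = ∃-subset (λ ε V → Q ε (inside ∷ V)) mono p in inside ∷ V , q
  ... | no p  = let V , q = ∃-subset (λ ε V → Q ε (outside ∷ V)) mono other in outside ∷ V , q
    where
    bad = ¬∀ε⇒∃ε¬ p
    other : Approximable (λ ε V → Q ε (outside ∷ V))
    other ε 0<ε = let δ , 0<δ , le₁ , le₂ = minimum 0<ε (proj₁ (proj₂ bad)) in pick le₁ le₂ (h δ 0<δ)
      where
      pick : ∀ {δ} → δ ≤ ε → δ ≤ proj₁ bad → ∃ (Q δ) → ∃[ V ] Q ε (outside ∷ V)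
      pick le₁ le₂ (inside  ∷ V , q) = ⊥-elim (proj₂ (proj₂ bad) (V , mono le₂ q))
      pick le₁ le₂ (outside ∷ V , q) = V , mono le₁ q

  -- Moving vertex number v by δ v in every coordinate separates coinciding images, and for small δ keeps distinct ones apart.
  perturb : ∀ {N n} (f : Fin N → Point n) (j₀ : Fin n) ε → 0# < ε →
    ∃ λ (f′ : Fin N → Point n) → (∀ u v → f′ u ≋ f′ v → u ≡ v) × (∀ v j → abs (f′ v j - f v j) ≤ ε)
  perturb {N} f j₀ ε 0<ε = construct (∃-uniform _ (λ u {δ} {δ′} le q v → sep-anti u v le (q v)) λ u → ∃-uniform (Sep u) (λ v → sep-anti u v) (separate u))
    where
    -- Exceeds every vertex number, so no point is moved by more than `δ * M`; the summand 1 keeps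
    -- it positive for N = 0.
    M = fromℕ N + 1#
    0<M : 0# < M
    0<M = <-≤-trans (0<+ 0<1 (0≤fromℕ N)) (≤-reflexive (+-comm _ _))

    Sep : Fin N → Fin N → ℝ → Set
    -- It suffices to separate the images in the coordinate `j₀`: values that agree are split by the
    -- different shifts, and values that differ do so by more than the shifts can make up for.
    Sep u v δ = δ * M ≤ ε × (f u j₀ ≈ f v j₀ ⊎ δ * M < abs (f u j₀ - f v j₀))

    sep-anti : ∀ u v {δ δ′} → δ ≤ δ′ → Sep u v δ′ → Sep u v δ
    sep-anti u v le (p , inj₁ q) = ≤-trans (*-monoʳ (<⇒≤ 0<M) le) p , inj₁ q
    sep-anti u v le (p , inj₂ q) = ≤-trans (*-monoʳ (<⇒≤ 0<M) le) p , inj₂ (≤-<-trans (*-monoʳ (<⇒≤ 0<M) le) q)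

    quotient : ∀ a → a ÷ M * M ≤ a
    quotient a = ≤-reflexive (≈-trans (*-comm _ _) (*-÷ a 0<M))

    separate : ∀ u v → ∃[ δ ] 0# < δ × Sep u v δ
    separate u v with em {f u j₀ ≈ f v j₀}
    ... | yes p = ε ÷ M , 0<÷ 0<ε 0<M , quotient ε , inj₁ p
    ... | no p  =
      let a = abs (f u j₀ - f v j₀)
          0<a : 0# < a
          0<a = 0≤∧≉0⇒0< (0≤abs _) λ q → p (≈-trans (solve 2 (λ a b → a := (a :- b) :+ b) ≈-refl _ _) (≈-trans (+-congʳ (abs-0⇒0 q)) (+-identityˡ _)))
          a′ , 0<a′ , e = halve 0<a
          a′<a : a′ < a
          a′<a = 0<-⇒< (<-≤-trans 0<a′ (≤-reflexive (≈-trans (solve 1 (λ a → a := (a :+ a) :- a) ≈-refl _) (+-congʳ e))))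
          c , 0<c , c≤ε , c≤a′ = minimum 0<ε 0<a′
      in c ÷ M , 0<÷ 0<c 0<M , ≤-trans (quotient c) c≤ε , inj₂ (≤-<-trans (≤-trans (quotient c) c≤a′) a′<a)

    construct : ∃[ δ ] 0# < δ × (∀ u v → Sep u v δ) → _
    construct (δ , 0<δ , sep) = f′ , injective , close
      where
      f′ : Fin N → Point _
      f′ v j = f v j + δ * fromℕ (toℕ v)
      0≤shift : ∀ v → 0# ≤ δ * fromℕ (toℕ v)
      0≤shift v = 0≤* (<⇒≤ 0<δ) (0≤fromℕ (toℕ v))
      shift≤ : ∀ v → δ * fromℕ (toℕ v) ≤ δ * M
      shift≤ v = *-monoˡ (<⇒≤ 0<δ) (≤-trans (fromℕ-mono (ℕ.<⇒≤ (Fin.toℕ<n v))) (≤-by 0≤1 (solve 1 (λ a → (a :+ :1) :- a := :1) ≈-refl _)))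
      close : ∀ v j → abs (f′ v j - f v j) ≤ ε
      close v j = abs-≤
        (≤-trans (≤-reflexive (solve 2 (λ a b → (a :+ b) :- a := b) ≈-refl _ _)) (≤-trans (shift≤ v) (proj₁ (sep v v))))
        (≤-trans (≤-by (0≤shift v) (solve 2 (λ a b → :0 :- :- ((a :+ b) :- a) := b) ≈-refl _ _)) (<⇒≤ 0<ε))
      injective : ∀ u v → f′ u ≋ f′ v → u ≡ v
      injective u v p with proj₂ (sep u v)
      ... | inj₁ q = Fin.toℕ-injective (fromℕ-injective _ _ (begin
            fromℕ (toℕ u)                        ≈⟨ ≈-÷ 0<δ ≈-refl ⟩
            (δ * fromℕ (toℕ u)) ÷ δ              ≈⟨ *-congʳ (begin
              δ * fromℕ (toℕ u)                    ≈⟨ solve 2 (λ a b → b := (a :+ b) :- a) ≈-refl (f u j₀) _ ⟩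
              f′ u j₀ - f u j₀                     ≈⟨ +-cong (p j₀) (-‿cong q) ⟩
              f′ v j₀ - f v j₀                     ≈⟨ solve 2 (λ a b → (a :+ b) :- a := b) ≈-refl (f v j₀) _ ⟩
              δ * fromℕ (toℕ v)                    ∎) ⟩
            (δ * fromℕ (toℕ v)) ÷ δ              ≈⟨ ≈-÷ 0<δ ≈-refl ⟨
            fromℕ (toℕ v)                        ∎))
        where open ≈-Reasoning
      ... | inj₂ q = ⊥-elim (<⇒≱ q (abs-≤ (bound u v (p j₀)) (≤-trans (≤-reflexive (solve 2 (λ a b → :- (a :- b) := b :- a) ≈-refl _ _)) (bound v u (≈-sym (p j₀))))))
        where
        bound : ∀ u v → f′ u j₀ ≈ f′ v j₀ → f u j₀ - f v j₀ ≤ δ * M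
        bound u v e = ≤-trans (≤-by (0≤shift u) (≈-trans (solve 4 (λ a b c d → d :- (a :- b) := c :+ ((b :+ d) :- (a :+ c))) ≈-refl (f u j₀) (f v j₀) _ _)
          (≈-trans (+-congˡ (≈-trans (+-congʳ (≈-sym e)) (-‿inverseʳ _))) (+-identityʳ _)))) (shift≤ v)

  module Pach {n N : ℕ} (j₀ : Fin n) (P : ℝ) (isPach : IsPachConstant n P)
    (S : Fin (suc n) → Subset N) (disjoint : ∀ i j → i ≢ j → Empty (S i ∩ S j)) (f : Fin N → Point n) where

    Dense : Subset N → Set
    Dense V = ∀ i → P * sum (λ v → ind (v ∈ S i)) ≤ sum (λ v → ind (v ∈ S i) * ind (v ∈ V))

    Choice : Subset N → (Fin (suc n) → Fin N) → Set
    Choice V c = ∀ i → c i ∈ S i × c i ∈ V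

    Pierced : Subset N → Point n → Set
    Pierced V x = ∀ c → Choice V c → Hull (f ∘ c) x

    ApproxPierced : Subset N → ℝ → Point n → Set
    ApproxPierced V ε x = ∀ c → Choice V c → ∃ (ApproxHull (f ∘ c) x ε)

    private
      -- Pach's theorem is applied to an ε-perturbation of f that is injective. The weights that
      -- express x by perturbed points are kept for the original ones; as they are nonnegative with
      -- sum 1, each coordinate changes by at most ε. `Dense` mentions vertices only and is
      -- unaffected by the perturbation.
      approximate : Approximable (λ ε V → Dense V × ∃ (ApproxPierced V ε))
      approximate ε 0<ε = apply (perturb f j₀ ε 0<ε)
        where
        apply : ∃ (λ (f′ : Fin N → Point n) → (∀ u v → f′ u ≋ f′ v → u ≡ v) × (∀ v j → abs (f′ v j - f v j) ≤ ε)) →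
          ∃[ V ] Dense V × ∃ (ApproxPierced V ε)
        apply (f′ , injective , close) = select (proj₂ isPach (λ i → ∣ S i ∣) p p-injective)
          where
          p : ∀ i → Fin ∣ S i ∣ → Point n
          p i = f′ ∘ enum (S i)
          p-injective : ∀ i a b → p i a ≋ p i b → a ≡ b
          p-injective i a b e = enum-injective (S i) (injective _ _ e)
          select : ∃ (λ (U : ∀ i → Subset ∣ S i ∣) → (∀ i → P * fromℕ ∣ S i ∣ ≤ fromℕ ∣ U i ∣) ×
              (∃[ x ] ∀ (c : ∀ i → Fin ∣ S i ∣) → (∀ i → c i ∈ U i) → Conv (Image (λ i → p i (c i)) ⊤) x)) →
            ∃[ V ] Dense V × ∃ (ApproxPierced V ε)
          select (U , dense , x , pierced) = V , V-dense , x , V-pierced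
            where
            Selected : Fin N → Set
            Selected v = ∃[ i ] ∃[ a ] a ∈ U i × enum (S i) a ≡ v
            V : Subset N
            V = comprehension Selected
            V-dense : Dense V
            V-dense i = begin
              P * sum (λ v → ind (v ∈ S i))              ≈⟨ *-congˡ (∣∣-sum (S i)) ⟩
              P * fromℕ ∣ S i ∣                          ≤⟨ dense i ⟩
              fromℕ ∣ U i ∣                              ≈⟨ ∣∣-sum (U i) ⟨
              sum (λ a → ind (a ∈ U i))                  ≤⟨ sum-mono (λ a → ind-mono λ m → ∈-comprehension⁺ Selected (i , a , m , ≡.refl)) ⟩
              sum (λ a → ind (enum (S i) a ∈ V))         ≈⟨ sum-enum (S i) (λ v → ind (v ∈ V)) ⟨
              sum (λ v → ind (v ∈ S i) * ind (v ∈ V))    ∎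
              where
              open ≤-Reasoning
              ind-mono : ∀ {A B : Set} → (A → B) → ind A ≤ ind B
              ind-mono {A} {B} h with em {A}
              ... | yes q = ≤-reflexive (≈-sym (ind-yes (h q)))
              ... | no _  = 0≤ind
            V-pierced : ApproxPierced V ε x
            V-pierced c c∈ = t , w , λ j → close-to j
              where
              -- Membership in `V` only says that `c i` was selected from some side; disjointness
              -- shows that this side is `S i`.
              preimage : ∀ i → ∃[ a ] a ∈ U i × enum (S i) a ≡ c i
              preimage i = same (∈-comprehension⁻ Selected (proj₂ (c∈ i)))
                where
                same : Selected (c i) → ∃[ a ] a ∈ U i × enum (S i) a ≡ c i
                same (i′ , a , m , e) with i Fin.≟ i′
                ... | yes ≡.refl = a , m , e
                ... | no i≢i′    = ⊥-elim (disjoint i i′ i≢i′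
                  (c i , x∈p∩q⁺ (proj₁ (c∈ i) , ≡.subst (_∈ S i′) e (enum∈ (S i′) a))))
              hull : Hull (λ i → p i (proj₁ (preimage i))) x
              hull = conv⇒hull _ (pierced (λ i → proj₁ (preimage i)) (λ i → proj₁ (proj₂ (preimage i))))
              t = proj₁ hull
              w = proj₁ (proj₂ hull)
              term : ∀ i j → abs (f (c i) j - p i (proj₁ (preimage i)) j) ≤ ε
              term i j = ≡.subst (λ v → abs (f (c i) j - f′ v j) ≤ ε) (≡.sym (proj₂ (proj₂ (preimage i))))
                (≤-trans (≤-reflexive (abs-sym _ _)) (close (c i) j))
              difference : ∀ (a b : Fin (suc n) → ℝ) {X} → sum (λ i → t i * b i) ≈ X → (∀ i → a i - b i ≤ ε) →
                sum (λ i → t i * a i) - X ≤ ε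
              difference a b {X} e h = begin
                sum (λ i → t i * a i) - X                          ≈⟨ +-congˡ (-‿cong e) ⟨
                sum (λ i → t i * a i) - sum (λ i → t i * b i)      ≈⟨ sum-- (λ i → t i * a i) (λ i → t i * b i) ⟨
                sum (λ i → t i * a i - t i * b i)                  ≤⟨ sum-mono (λ i → ≤-trans (≤-reflexive (solve 3 (λ t a b → t :* a :- t :* b := t :* (a :- b)) ≈-refl _ _ _)) (*-monoˡ (proj₁ w i) (h i))) ⟩
                sum (λ i → t i * ε)                                ≈⟨ sum-*ʳ ε t ⟩
                sum t * ε                                          ≈⟨ *-congʳ (proj₂ w) ⟩
                1# * ε                                             ≈⟨ *-identityˡ ε ⟩
                ε                                                  ∎
                where open ≤-Reasoning
              sum-t*-neg : ∀ (a : Fin (suc n) → ℝ) → sum (λ i → t i * - a i) ≈ - sum (λ i → t i * a i)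
              sum-t*-neg a = ≈-trans (sum-cong λ i → solve 2 (λ t a → t :* (:- a) := :- (t :* a)) ≈-refl (t i) (a i)) (sum-neg λ i → t i * a i)
              close-to : ∀ j → abs (combination t (f ∘ c) j - x j) ≤ ε
              close-to j = abs-≤
                (difference (λ i → f (c i) j) (λ i → p i (proj₁ (preimage i)) j) (proj₂ (proj₂ hull) j) (λ i → ≤-trans (x≤abs _) (term i j)))
                (≤-trans (≤-reflexive (≈-trans (solve 2 (λ a b → :- (a :- b) := :- a :- (:- b)) ≈-refl _ _) (+-congʳ (≈-sym (sum-t*-neg λ i → f (c i) j)))))
                  (difference (λ i → - f (c i) j) (λ i → - p i (proj₁ (preimage i)) j)
                    (≈-trans (sum-t*-neg λ i → p i (proj₁ (preimage i)) j) (-‿cong (proj₂ (proj₂ hull) j)))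
                    (λ i → ≤-trans (≤-reflexive (solve 2 (λ a b → :- a :- (:- b) := :- (a :- b)) ≈-refl _ _)) (≤-trans (-x≤abs _) (term i j)))))

      ApproxPierced-mono : ∀ V → Monotone (ApproxPierced V)
      ApproxPierced-mono V {x = x} le h c c∈ = let t , a = h c c∈ in t , ApproxHull-mono {p = f ∘ c} {x} le a

      -- If V admits no choice, any point pierces vacuously. Otherwise one choice `c₀` bounds the
      -- candidates: the second conjunct of `Q` keeps them within distance 1 of the hull of its
      -- images, whatever ε is, so they have a cluster point, and `hull-closed` makes the
      -- approximate hulls exact.
      limit : ∀ V → Approximable (ApproxPierced V) → ∃ (Pierced V)
      limit V approx with em {∃ (Choice V)}
      ... | no q = (λ _ → 0#) , λ c c∈ → ⊥-elim (q (c , c∈))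
      ... | yes (c₀ , c₀∈) = finish (cluster n Q B Q-mono Q-bounded Q-approx)
        where
        Q : ℝ → Point n → Set
        Q ε x = ApproxPierced V ε x × ∃ (ApproxHull (f ∘ c₀) x 1#)
        total : Point n
        total j = sum λ i → abs (f (c₀ i) j)
        B = sum total + 1#
        Q-mono : Monotone Q
        Q-mono {x = x} le (p , q) = ApproxPierced-mono V {x = x} le p , q
        Q-approx : Approximable Q
        Q-approx ε 0<ε =
          let δ , 0<δ , δ≤ε , δ≤1 = minimum 0<ε 0<1
              x , p = approx δ 0<δ
          in x , ApproxPierced-mono V {x = x} δ≤ε p , ApproxPierced-mono V {x = x} δ≤1 p c₀ c₀∈
        Q-bounded : ∀ {ε x} → Q ε x → ∀ j → abs (x j) ≤ B
        Q-bounded {x = x} (_ , t , w , h) j = ≤-trans (abs-close (≤-trans (≤-reflexive (abs-sym _ _)) (h j)))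
          (+-mono-≤ (≤-trans combination≤ (term≤sum {f = total} (λ j → 0≤sum λ i → 0≤abs (f (c₀ i) j)) j)) ≤-refl)
          where
          term≤ : ∀ i → abs (t i * f (c₀ i) j) ≤ abs (f (c₀ i) j)
          term≤ i = ≤-trans (abs-*-≤ _ _) (≤-trans (*-monoʳ (0≤abs _) (weight≤1 w i)) (≤-reflexive (*-identityˡ _)))
          combination≤ : abs (combination t (f ∘ c₀) j) ≤ total j
          combination≤ = abs-≤ (sum-mono λ i → ≤-trans (x≤abs _) (term≤ i))
            (≤-trans (≤-reflexive (≈-sym (sum-neg (λ i → t i * f (c₀ i) j)))) (sum-mono λ i → ≤-trans (-x≤abs _) (term≤ i)))
        finish : ∃ (ClusterPoint Q) → ∃ (Pierced V)
        finish (x , near) = x , λ c c∈ → hull-closed (f ∘ c) x λ ε 0<ε →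
          let δ , 0<δ , δ+δ≈ε = halve 0<ε
              x′ , (p , _) , close = near δ 0<δ
              t , w , h = p c c∈
          in t , w , λ j → ≤-trans (abs-≤
               (≤-trans (≤-reflexive (solve 3 (λ a b c → a :- c := (a :- b) :+ (b :- c)) ≈-refl _ (x′ j) _)) (+-mono-≤ (≤-trans (x≤abs _) (h j)) (≤-trans (x≤abs _) (close j))))
               (≤-trans (≤-reflexive (solve 3 (λ a b c → :- (a :- c) := :- (a :- b) :+ :- (b :- c)) ≈-refl _ (x′ j) _)) (+-mono-≤ (≤-trans (-x≤abs _) (h j)) (≤-trans (-x≤abs _) (close j)))))
               (≤-reflexive δ+δ≈ε)

    pierce : ∃[ V ] Dense V × ∃ (Pierced V)
    pierce = conclude (∃-subset _ (λ {ε} {ε′} {V} le (d , x , p) → d , x , ApproxPierced-mono V {x = x} le p) approximate)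
      where
      conclude : ∃[ V ] (∀ ε → 0# < ε → Dense V × ∃ (ApproxPierced V ε)) → ∃[ V ] Dense V × ∃ (Pierced V)
      conclude (V , h) = V , proj₁ (h 1# 0<1) , limit V λ ε 0<ε → proj₂ (h ε 0<ε)

  -- Sums over the top simplices

  *-cancelˡ-≈ : ∀ {c a b} → 0# < c → c * a ≈ c * b → a ≈ b
  *-cancelˡ-≈ p q = ≤-antisym (*-cancelˡ-≤ p (≤-reflexive q)) (*-cancelˡ-≤ p (≤-reflexive (≈-sym q)))

  length-filter : ∀ {A : Set} {P : A → Set} (P? : Decidable P) (xs : List A) →
    fromℕ (length (filter P? xs)) ≈ sum (λ k → ind (P (List.lookup xs k)))
  length-filter P? [] = ≈-refl
  length-filter P? (x ∷ xs) with P? x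
  ... | yes p = +-cong (≈-sym (ind-yes p)) (length-filter P? xs)
  ... | no p  = ≈-trans (length-filter P? xs) (≈-trans (≈-sym (+-identityˡ _)) (+-congʳ (≈-sym (ind-no p))))

  subsets-complete : ∀ {N} (σ : Subset N) → σ List.∈ subsets N
  subsets-complete []          = Any.here ≡.refl
  subsets-complete {suc N} (true ∷ σ)  = ∈-++⁺ʳ (List.map (outside ∷_) (subsets N)) (∈-map⁺ _ (subsets-complete σ))
  subsets-complete (false ∷ σ) = ∈-++⁺ˡ (∈-map⁺ _ (subsets-complete σ))

  -- Adding vertices to a simplex, and links

  ∣p∪⁅v⁆∣ : ∀ {N} (p : Subset N) v → v ∉ p → ∣ p ∪ ⁅ v ⁆ ∣ ≡ suc ∣ p ∣
  ∣p∪⁅v⁆∣ (true ∷ p)  zero    v∉p = ⊥-elim (v∉p here)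
  ∣p∪⁅v⁆∣ (false ∷ p) zero    v∉p = ≡.cong (λ q → suc ∣ q ∣) (∪-identityʳ p)
  ∣p∪⁅v⁆∣ (true ∷ p)  (suc v) v∉p = ≡.cong suc (∣p∪⁅v⁆∣ p v (v∉p ∘ there))
  ∣p∪⁅v⁆∣ (false ∷ p) (suc v) v∉p = ∣p∪⁅v⁆∣ p v (v∉p ∘ there)

  p∪⁅v⁆≡p : ∀ {N} {p : Subset N} {v} → v ∈ p → p ∪ ⁅ v ⁆ ≡ p
  p∪⁅v⁆≡p {p = p} {v} v∈p = ⊆-antisym sub (p⊆p∪q ⁅ v ⁆)
    where
    sub : p ∪ ⁅ v ⁆ ⊆ p
    sub m with x∈p∪q⁻ p ⁅ v ⁆ m
    ... | inj₁ q = q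
    ... | inj₂ q = ≡.subst (_∈ p) (≡.sym (x∈⁅y⁆⇒x≡y v q)) v∈p

  ∪-⊆ : ∀ {N} {p q : Subset N} {v} → p ⊆ q → v ∈ q → p ∪ ⁅ v ⁆ ⊆ q
  ∪-⊆ {p = p} {q} {v} h v∈q m with x∈p∪q⁻ p ⁅ v ⁆ m
  ... | inj₁ r = h r
  ... | inj₂ r = ≡.subst (_∈ q) (≡.sym (x∈⁅y⁆⇒x≡y v r)) v∈q

  v∈p∪⁅v⁆ : ∀ {N} (p : Subset N) v → v ∈ p ∪ ⁅ v ⁆
  v∈p∪⁅v⁆ p v = x∈p∪q⁺ (inj₂ (x∈⁅x⁆ v))

  ∣p∣≡0⇒p≡∅ : ∀ {N} (p : Subset N) → ∣ p ∣ ≡ 0 → p ≡ ∅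
  ∣p∣≡0⇒p≡∅ [] _ = ≡.refl
  ∣p∣≡0⇒p≡∅ (false ∷ p) e = ≡.cong (false ∷_) (∣p∣≡0⇒p≡∅ p e)

  ∣p∣≡1⇒singleton : ∀ {N} (p : Subset N) → ∣ p ∣ ≡ 1 → ∃[ v ] p ≡ ⁅ v ⁆
  ∣p∣≡1⇒singleton (true ∷ p)  e = zero , ≡.cong (true ∷_) (∣p∣≡0⇒p≡∅ p (ℕ.suc-injective e))
  ∣p∣≡1⇒singleton (false ∷ p) e = let v , q = ∣p∣≡1⇒singleton p e in suc v , ≡.cong (false ∷_) q

  module Links {N : ℕ} (X : Complex N) where
    open Complex X

    linkVertex⁺ : ∀ {τ v} → v ∉ τ → Face (τ ∪ ⁅ v ⁆) → LinkVertex τ v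
    linkVertex⁺ {τ} {v} v∉τ f = (face-vertex v , ∣⁅x⁆∣≡1 v) , f , ≡.trans (∣p∪⁅v⁆∣ τ v v∉τ) (ℕ.+-comm 1 _)

    linkVertex⁻ : ∀ {τ v} → LinkVertex τ v → v ∉ τ × Face (τ ∪ ⁅ v ⁆)
    linkVertex⁻ {τ} {v} (_ , f , e) = (λ v∈τ → ℕ.m≢1+m+n ∣ τ ∣ {0} (≡.trans (≡.cong ∣_∣ (≡.sym (p∪⁅v⁆≡p v∈τ))) (≡.trans e (ℕ.+-suc ∣ τ ∣ 0)))) , f

    linkEdge⁺ : ∀ {τ u v} → u ≢ v → u ∉ τ → v ∉ τ → Face (τ ∪ (⁅ u ⁆ ∪ ⁅ v ⁆)) → LinkEdge τ u v
    linkEdge⁺ {τ} {u} {v} u≢v u∉τ v∉τ f =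
      (face-⊆ (q⊆p∪q τ (⁅ u ⁆ ∪ ⁅ v ⁆)) f , ≡.trans (∣p∪⁅v⁆∣ ⁅ u ⁆ v (λ m → u≢v (≡.sym (x∈⁅y⁆⇒x≡y u m)))) (≡.cong suc (∣⁅x⁆∣≡1 u))) ,
      f , (begin
        ∣ τ ∪ (⁅ u ⁆ ∪ ⁅ v ⁆) ∣    ≡⟨ ≡.cong ∣_∣ (∪-assoc τ ⁅ u ⁆ ⁅ v ⁆) ⟨
        ∣ (τ ∪ ⁅ u ⁆) ∪ ⁅ v ⁆ ∣    ≡⟨ ∣p∪⁅v⁆∣ (τ ∪ ⁅ u ⁆) v v∉τ∪u ⟩
        suc ∣ τ ∪ ⁅ u ⁆ ∣          ≡⟨ ≡.cong suc (∣p∪⁅v⁆∣ τ u u∉τ) ⟩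
        2 ℕ.+ ∣ τ ∣                ≡⟨ ℕ.+-comm 2 _ ⟩
        ∣ τ ∣ ℕ.+ 2                ∎)
      where
      open ≡.≡-Reasoning
      v∉τ∪u : v ∉ τ ∪ ⁅ u ⁆
      v∉τ∪u m with x∈p∪q⁻ τ ⁅ u ⁆ m
      ... | inj₁ q = v∉τ q
      ... | inj₂ q = u≢v (≡.sym (x∈⁅y⁆⇒x≡y u q))

    linkEdge-sym : ∀ {τ u v} → LinkEdge τ u v → LinkEdge τ v u
    linkEdge-sym {τ} {u} {v} = ≡.subst (Link τ 2) (∪-comm ⁅ u ⁆ ⁅ v ⁆)

    linkEdge⇒≢ : ∀ {τ u v} → LinkEdge τ u v → u ≢ v
    linkEdge⇒≢ {τ} {u} ((_ , e) , _) ≡.refl with ≡.trans (≡.sym (∣⁅x⁆∣≡1 u)) (≡.trans (≡.cong ∣_∣ (≡.sym (∪-idem ⁅ u ⁆))) e)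
    ... | ()

    -- If u were in τ, the union of τ with the edge would have at most ∣ τ ∣ + 1 elements instead of
    -- ∣ τ ∣ + 2.
    linkEdge⇒linkVertex : ∀ {τ u v} → LinkEdge τ u v → LinkVertex τ u
    linkEdge⇒linkVertex {τ} {u} {v} (_ , f , e) = linkVertex⁺ u∉τ
        (face-⊆ (∪-⊆ (p⊆p∪q (⁅ u ⁆ ∪ ⁅ v ⁆)) (x∈p∪q⁺ (inj₂ (x∈p∪q⁺ (inj₁ (x∈⁅x⁆ u)))))) f)
      where
      u∉τ : u ∉ τ
      u∉τ u∈τ with em {v ∈ τ}
      ... | yes v∈τ = ℕ.m≢1+m+n ∣ τ ∣ {1} (≡.trans (≡.cong ∣_∣ (≡.sym absorb)) (≡.trans e (ℕ.+-suc ∣ τ ∣ 1)))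
        where
        absorb : τ ∪ (⁅ u ⁆ ∪ ⁅ v ⁆) ≡ τ
        absorb = ≡.trans (≡.sym (∪-assoc τ ⁅ u ⁆ ⁅ v ⁆)) (≡.trans (≡.cong (_∪ ⁅ v ⁆) (p∪⁅v⁆≡p u∈τ)) (p∪⁅v⁆≡p v∈τ))
      ... | no v∉τ = ℕ.m≢1+m+n (suc ∣ τ ∣) {0} (≡.trans (≡.sym size) (≡.trans e (≡.trans (ℕ.+-suc ∣ τ ∣ 1) (≡.cong suc (ℕ.+-suc ∣ τ ∣ 0)))))
        where
        size : ∣ τ ∪ (⁅ u ⁆ ∪ ⁅ v ⁆) ∣ ≡ suc ∣ τ ∣
        size = ≡.trans (≡.cong ∣_∣ (≡.sym (∪-assoc τ ⁅ u ⁆ ⁅ v ⁆))) (≡.trans (≡.cong (λ p → ∣ p ∪ ⁅ v ⁆ ∣) (p∪⁅v⁆≡p u∈τ)) (∣p∪⁅v⁆∣ τ v v∉τ))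

  -- ⟪ τ ⟫ F is the sum of F over the top simplices containing τ; thus ⟪ τ ⟫ x_v counts those containing τ ∪ {v}.
  module Integral {N : ℕ} (n : ℕ) (X : Complex N) where
    open Complex X
    open Links X public

    Top : Subset N → Set
    Top σ = Simplex (suc n) σ

    private
      nth : Fin (length (subsets N)) → Subset N
      nth = List.lookup (subsets N)

    ⟪_⟫ : Subset N → (Subset N → ℝ) → ℝ
    ⟪ τ ⟫ F = sum λ k → ind (Top (nth k) × τ ⊆ nth k) * F (nth k)

    D : Subset N → ℝ
    D τ = ⟪ τ ⟫ λ _ → 1#

    x : Fin N → Subset N → ℝ
    x v σ = ind (v ∈ σ)

    private
      guard : ∀ {A : Set} {a b} → (A → a ≈ b) → ind A * a ≈ ind A * b
      guard {A} h with em {A}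
      ... | yes p = *-congˡ (h p)
      ... | no p  = ≈-trans (zeroˡ _) (≈-sym (zeroˡ _))

      guard-≤ : ∀ {A : Set} {a b} → (A → a ≤ b) → ind A * a ≤ ind A * b
      guard-≤ {A} h with em {A}
      ... | yes p = *-monoˡ 0≤1 (h p)
      ... | no p  = ≤-reflexive (≈-trans (zeroˡ _) (≈-sym (zeroˡ _)))

    ⟪⟫-cong : ∀ {τ F G} → (∀ σ → Top σ → τ ⊆ σ → F σ ≈ G σ) → ⟪ τ ⟫ F ≈ ⟪ τ ⟫ G
    ⟪⟫-cong {τ} {F} {G} h = sum-cong λ k → guard {Top (nth k) × τ ⊆ nth k} {F (nth k)} {G (nth k)} λ { (p , q) → h _ p q }

    ⟪⟫-mono : ∀ {τ F G} → (∀ σ → Top σ → τ ⊆ σ → F σ ≤ G σ) → ⟪ τ ⟫ F ≤ ⟪ τ ⟫ G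
    ⟪⟫-mono {τ} {F} {G} h = sum-mono λ k → guard-≤ {Top (nth k) × τ ⊆ nth k} {F (nth k)} {G (nth k)} λ { (p , q) → h _ p q }

    ⟪⟫-+ : ∀ τ F G → ⟪ τ ⟫ (λ σ → F σ + G σ) ≈ ⟪ τ ⟫ F + ⟪ τ ⟫ G
    ⟪⟫-+ τ F G = ≈-trans
      (sum-cong λ k → solve 3 (λ i f g → i :* (f :+ g) := i :* f :+ i :* g) ≈-refl (ind (Top (nth k) × τ ⊆ nth k)) (F (nth k)) (G (nth k)))
      (sum-+ (λ k → ind (Top (nth k) × τ ⊆ nth k) * F (nth k)) (λ k → ind (Top (nth k) × τ ⊆ nth k) * G (nth k)))

    ⟪⟫-*ˡ : ∀ τ c F → ⟪ τ ⟫ (λ σ → c * F σ) ≈ c * ⟪ τ ⟫ F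
    ⟪⟫-*ˡ τ c F = ≈-trans
      (sum-cong λ k → solve 3 (λ i f c → i :* (c :* f) := c :* (i :* f)) ≈-refl (ind (Top (nth k) × τ ⊆ nth k)) (F (nth k)) c)
      (sum-*ˡ c (λ k → ind (Top (nth k) × τ ⊆ nth k) * F (nth k)))

    ⟪⟫-const : ∀ τ c → ⟪ τ ⟫ (λ _ → c) ≈ c * D τ
    ⟪⟫-const τ c = ≈-trans (⟪⟫-cong {τ} λ _ _ _ → ≈-trans (≈-sym (*-identityˡ c)) (*-comm _ _)) (⟪⟫-*ˡ τ c (λ _ → 1#))

    ⟪⟫-- : ∀ τ F G → ⟪ τ ⟫ (λ σ → F σ - G σ) ≈ ⟪ τ ⟫ F - ⟪ τ ⟫ G
    ⟪⟫-- τ F G = ≈-trans (⟪⟫-+ τ F (λ σ → - G σ)) (+-congˡ (≈-trans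
      (⟪⟫-cong {τ} λ σ _ _ → solve 1 (λ a → :- a := (:- :1) :* a) ≈-refl (G σ))
      (≈-trans (⟪⟫-*ˡ τ (- 1#) G) (solve 1 (λ a → (:- :1) :* a := :- a) ≈-refl _))))

    ⟪⟫-zero : ∀ τ → ⟪ τ ⟫ (λ _ → 0#) ≈ 0#
    ⟪⟫-zero τ = ≈-trans (⟪⟫-const τ 0#) (zeroˡ _)

    0≤⟪⟫ : ∀ {τ F} → (∀ σ → Top σ → τ ⊆ σ → 0# ≤ F σ) → 0# ≤ ⟪ τ ⟫ F
    0≤⟪⟫ {τ} h = ≤-resp₂ (⟪⟫-zero τ) ≈-refl (⟪⟫-mono {τ} h)

    ⟪⟫-sum : ∀ τ {k} (F : Fin k → Subset N → ℝ) → ⟪ τ ⟫ (λ σ → sum λ v → F v σ) ≈ sum (λ v → ⟪ τ ⟫ (F v))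
    ⟪⟫-sum τ F = ≈-trans
      (sum-cong λ j → ≈-sym (sum-*ˡ (ind (Top (nth j) × τ ⊆ nth j)) (λ v → F v (nth j))))
      (∑-comm λ j v → ind (Top (nth j) × τ ⊆ nth j) * F v (nth j))

    -- Conditioning on a further vertex is multiplication by its indicator; iterated integrals over
    -- links thereby become integrals of products over one link.
    ⟪⟫-∪ : ∀ τ v F → ⟪ τ ∪ ⁅ v ⁆ ⟫ F ≈ ⟪ τ ⟫ (λ σ → x v σ * F σ)
    ⟪⟫-∪ τ v F = sum-cong λ k → ≈-trans
      (*-congʳ {F (nth k)} (≈-trans
        (ind-cong {Top (nth k) × τ ∪ ⁅ v ⁆ ⊆ nth k} {(Top (nth k) × τ ⊆ nth k) × v ∈ nth k}
          (λ { (p , q) → (p , λ m → q (p⊆p∪q ⁅ v ⁆ m)) , q (v∈p∪⁅v⁆ τ v) }) (λ { ((p , q) , m) → p , ∪-⊆ q m }))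
        (ind-× {Top (nth k) × τ ⊆ nth k} {v ∈ nth k})))
      (*-assoc _ _ _)

    ⟪⟫-nonface : ∀ τ F → ¬ Face τ → ⟪ τ ⟫ F ≈ 0#
    ⟪⟫-nonface τ F ¬f = sum-zero λ k → ≈-trans (*-congʳ {F (nth k)} (ind-no λ { ((f , _) , q) → ¬f (face-⊆ q f) })) (zeroˡ _)

    degree≈D : ∀ τ → fromℕ (degree n X τ) ≈ D τ
    degree≈D τ = ≈-trans (length-filter (λ σ → simplex? (suc n) σ ×-dec (τ ⊆? σ)) (subsets N))
      (sum-cong λ k → ≈-sym (≈-trans (*-comm (ind (Top (nth k) × τ ⊆ nth k)) 1#) (*-identityˡ _)))

    #top≈D∅ : fromℕ (#top n X) ≈ D ∅
    #top≈D∅ = ≈-trans (length-filter (simplex? (suc n)) (subsets N))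
      (sum-cong λ k → ≈-trans (ind-cong {Top (nth k)} {Top (nth k) × ∅ ⊆ nth k} (λ p → p , ⊥⊆) proj₁) (≈-sym (≈-trans (*-comm (ind (Top (nth k) × ∅ ⊆ nth k)) 1#) (*-identityˡ _))))

    ⟪∅⟫-ind : ∀ {Q : Subset N → Set} (Q? : Decidable (λ σ → Top σ × Q σ)) →
      ⟪ ∅ ⟫ (λ σ → ind (Q σ)) ≈ fromℕ (#subsets Q?)
    ⟪∅⟫-ind {Q} Q? = ≈-sym (≈-trans (length-filter Q? (subsets N)) (sum-cong λ k →
      ≈-trans (ind-cong {Top (nth k) × Q (nth k)} {(Top (nth k) × ∅ ⊆ nth k) × Q (nth k)} (λ { (p , q) → (p , ⊥⊆) , q }) (λ { ((p , _) , q) → p , q })) (ind-× {Top (nth k) × ∅ ⊆ nth k} {Q (nth k)})))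

    -- Purity supplies a top simplex above τ. Divisions by `D τ` and by link weights rest on this
    -- bound.
    1≤D : Pure n X → ∀ {τ} → Face τ → 1# ≤ D τ
    1≤D pure {τ} f = at (pure τ f)
      where
      at : ∃[ σ ] Simplex (suc n) σ × τ ⊆ σ → 1# ≤ D τ
      at (σ , p , q) = ≤-trans (≤-reflexive (≈-sym (≈-trans (*-congʳ (ind-yes occurs)) (*-identityˡ 1#))))
        (term≤sum {f = λ k → ind (Top (nth k) × τ ⊆ nth k) * 1#} (λ k → 0≤* 0≤ind 0≤1) (Any.index (subsets-complete σ)))
        where
        occurs : Top (nth (Any.index (subsets-complete σ))) × τ ⊆ nth (Any.index (subsets-complete σ))
        occurs = ≡.subst (λ σ → Top σ × τ ⊆ σ) (lookup-index (subsets-complete σ)) (p , q)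

    D-∪ : ∀ τ v → D (τ ∪ ⁅ v ⁆) ≈ ⟪ τ ⟫ (x v)
    D-∪ τ v = ≈-trans (⟪⟫-∪ τ v (λ _ → 1#)) (⟪⟫-cong {τ} λ σ _ _ → ≈-trans (*-comm _ _) (*-identityˡ (x v σ)))

    D-∪₂ : ∀ τ u v → D (τ ∪ (⁅ u ⁆ ∪ ⁅ v ⁆)) ≈ ⟪ τ ⟫ (λ σ → x u σ * x v σ)
    D-∪₂ τ u v = ≈-trans (≈-reflexive (≡.cong D (≡.sym (∪-assoc τ ⁅ u ⁆ ⁅ v ⁆))))
      (≈-trans (D-∪ (τ ∪ ⁅ u ⁆) v) (⟪⟫-∪ τ u (x v)))

  -- Spectral bounds in links

  -- A weighted graph on the vertices satisfying Link: b u v is the weight of the edge uv for u ≠ v, and b v v = w v.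
  module WeightedGraph {N : ℕ} (Link : Fin N → Set) (Edge : Fin N → Fin N → Set)
    (b : Fin N → Fin N → ℝ) (w : Fin N → ℝ) (d D lam : ℝ) (0<d : 0# < d) (0<D : 0# < D) (0<lam : 0# < lam)
    (b-sym : ∀ (u v : Fin N) → b u v ≈ b v u)
    (b-row : ∀ v → sum (λ u → b u v) ≈ (1# + d) * w v)
    (0≤b : ∀ (u v : Fin N) → 0# ≤ b u v)
    (b-edge : ∀ {u v} → Edge u v → 0# < b u v)
    (b-nonlink : ∀ u {v} → ¬ Link v → b u v ≈ 0#)
    (w-link : ∀ {v} → Link v → 1# ≤ w v)
    (w-nonlink : ∀ {v} → ¬ Link v → w v ≈ 0#)
    (w-total : sum w ≈ (1# + d) * D)
    (connected : ∀ {u v} → Link u → Link v → Star Edge u v)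
    (gap : ∀ (μ : ℝ) (y : Fin N → ℝ) → (∃[ v ] Link v × ¬ y v ≈ 0#) →
      (∀ {v} → Link v → sum (λ u → b u v * y u) - w v * y v ≈ d * μ * (w v * y v)) → μ ≤ lam ⊎ μ ≈ 1#)
    where

    open QuadraticForms {N}

    private
      0<1+d : 0# < 1# + d
      0<1+d = 0<+ 0<1 (<⇒≤ 0<d)

      κ = D ⁻¹

      κD : κ * D ≈ 1#
      κD = ≈-trans (*-comm _ _) (*-inverseʳ (>⇒≉0 0<D))

      ρ : Fin N → ℝ
      ρ v = ind (Link v)

      -- Weight 1 off the link, where `w` vanishes, so that the form `W` is definite on functions on
      -- all of Fin N.
      w′ : Fin N → ℝ
      w′ v = w v + (1# - ρ v)

      w*ρ : ∀ v → w v * ρ v ≈ w v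
      w*ρ v with em {Link v}
      ... | yes p = ≈-trans (*-comm _ _) (*-identityˡ _)
      ... | no p  = ≈-trans (zeroʳ _) (≈-sym (w-nonlink p))

      b*ρ : ∀ u v → b u v * ρ v ≈ b u v
      b*ρ u v with em {Link v}
      ... | yes p = ≈-trans (*-comm _ _) (*-identityˡ _)
      ... | no p  = ≈-trans (zeroʳ _) (≈-sym (b-nonlink u p))

      0≤w : ∀ v → 0# ≤ w v
      0≤w v with em {Link v}
      ... | yes p = ≤-trans 0≤1 (w-link p)
      ... | no p  = ≤-reflexive (≈-sym (w-nonlink p))

      1≤w′ : ∀ v → 1# ≤ w′ v
      1≤w′ v with em {Link v}
      ... | yes p = ≤-trans (w-link p) (≤-reflexive (solve 1 (λ w → w := w :+ (:1 :- :1)) ≈-refl (w v)))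
      ... | no p  = ≤-by (0≤w v) (solve 1 (λ w → (w :+ (:1 :- :0)) :- :1 := w) ≈-refl (w v))

      -- An eigenvalue ν in the sense of `gap` is the eigenvalue 1 + d ν of `b` relative to `w`;
      -- constants have ν = 1. Subtracting κ w wᵀ sends constants to 0 (`A-column`, by `b-row` and
      -- `w-total`) and does not change the form on functions of w-mean zero.
      A W : Matrix
      A u v = b u v - κ * (w u * w v)
      W u v = ind (u ≡ v) * w′ v

      A-sym : Symmetric A
      A-sym u v = +-cong (b-sym u v) (-‿cong (*-congˡ (*-comm _ _)))

      W-sym : Symmetric W
      W-sym u v with em {u ≡ v}
      ... | yes ≡.refl = *-congʳ (≈-sym (ind-yes ≡.refl))
      ... | no u≢v     = ≈-trans (zeroˡ _) (≈-sym (≈-trans (*-congʳ (ind-no (u≢v ∘ ≡.sym))) (zeroˡ _)))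

      W-row : ∀ v (y : Vec) → sum (λ u → W v u * y u) ≈ w′ v * y v
      W-row v y = ≈-trans
        (sum-cong λ u → ≈-trans (*-congʳ {y u} (W-sym v u)) (*-assoc (ind (u ≡ v)) (w′ v) (y u)))
        (sum-pick v λ u → w′ v * y u)

      quad-W : ∀ x → quad W x ≈ sum (λ v → w′ v * (x v * x v))
      quad-W x = sum-cong λ u → ≈-trans
        (sum-cong λ v → solve 3 (λ a y z → a :* (y :* z) := y :* (a :* z)) ≈-refl (W u v) (x u) (x v))
        (≈-trans (sum-*ˡ (x u) (λ v → W u v * x v)) (≈-trans (*-congˡ (W-row u x))
          (solve 2 (λ y w → y :* (w :* y) := w :* (y :* y)) ≈-refl (x u) (w′ u))))

      W-pos : ∀ x u → x u * x u ≤ quad W x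
      W-pos x u = ≤-trans
        (≤-trans (≤-reflexive (≈-sym (*-identityˡ _))) (*-monoʳ (0≤sq (x u)) (1≤w′ u)))
        (≤-trans (term≤sum {f = λ v → w′ v * (x v * x v)} (λ v → 0≤* (≤-trans 0≤1 (1≤w′ v)) (0≤sq (x v))) u)
          (≤-reflexive (≈-sym (quad-W x))))

      quad-A : ∀ x → quad A x ≈ quad b x - κ * (sum (λ v → w v * x v) * sum (λ v → w v * x v))
      quad-A x = begin
        quad A x
          ≈⟨ sum₂-cong (λ u v → solve 6 (λ b k w t x y → (b :- k :* (w :* t)) :* (x :* y) := b :* (x :* y) :+ (:- k) :* ((w :* x) :* (t :* y))) ≈-refl (b u v) κ (w u) (w v) (x u) (x v)) ⟩
        sum (λ u → sum (λ v → b u v * (x u * x v) + - κ * ((w u * x u) * (w v * x v))))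
          ≈⟨ sum₂-+ (λ u v → b u v * (x u * x v)) (λ u v → - κ * ((w u * x u) * (w v * x v))) ⟩
        quad b x + sum (λ u → sum (λ v → - κ * ((w u * x u) * (w v * x v))))
          ≈⟨ +-congˡ (sum₂-*ˡ (- κ) (λ u v → (w u * x u) * (w v * x v))) ⟩
        quad b x + - κ * sum (λ u → sum (λ v → (w u * x u) * (w v * x v)))
          ≈⟨ +-congˡ (*-congˡ (≈-trans (sum-cong λ u → sum-*ˡ (w u * x u) (λ v → w v * x v)) (sum-*ʳ s (λ u → w u * x u)))) ⟩
        quad b x + - κ * (s * s)
          ≈⟨ solve 3 (λ q k s → q :+ (:- k) :* (s :* s) := q :- k :* (s :* s)) ≈-refl (quad b x) κ s ⟩
        quad b x - κ * (s * s) ∎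
        where
        open ≈-Reasoning
        s = sum (λ v → w v * x v)

      A-column : ∀ u → sum (λ v → A v u) ≈ 0#
      A-column u = begin
        sum (λ v → b v u - κ * (w v * w u))                        ≈⟨ sum-- (λ v → b v u) (λ v → κ * (w v * w u)) ⟩
        sum (λ v → b v u) - sum (λ v → κ * (w v * w u))            ≈⟨ +-cong (b-row u) (-‿cong (≈-trans (sum-*ˡ κ (λ v → w v * w u)) (*-congˡ (≈-trans (sum-*ʳ (w u) w) (*-congʳ w-total))))) ⟩
        (1# + d) * w u - κ * ((1# + d) * D * w u)                  ≈⟨ solve 4 (λ d w k D → (:1 :+ d) :* w :- k :* ((:1 :+ d) :* D :* w) := (:1 :+ d) :* w :- (k :* D) :* ((:1 :+ d) :* w)) ≈-refl d (w u) κ D ⟩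
        (1# + d) * w u - κ * D * ((1# + d) * w u)                  ≈⟨ +-congˡ (-‿cong (*-congʳ κD)) ⟩
        (1# + d) * w u - 1# * ((1# + d) * w u)                     ≈⟨ solve 1 (λ a → a :- :1 :* a := :0) ≈-refl ((1# + d) * w u) ⟩
        0#                                                         ∎
        where open ≈-Reasoning

      -- An eigenfunction for the eigenvalue 1 has vanishing Dirichlet form, so it is constant on the link.
      module Harmonic (y : Vec) (harmonic : ∀ v → sum (λ u → b u v * y u) ≈ (1# + d) * (w v * y v)) where

        dirichlet : sum (λ u → sum (λ v → b u v * ((y u - y v) * (y u - y v)))) ≈ 0#
        dirichlet = begin
          sum (λ u → sum (λ v → b u v * ((y u - y v) * (y u - y v))))
            ≈⟨ sum₂-cong (λ u v → solve 3 (λ b y z → b :* ((y :- z) :* (y :- z)) := (b :* (y :* y) :+ b :* (z :* z)) :+ ((:- (:1 :+ :1)) :* (b :* (y :* z)))) ≈-refl (b u v) (y u) (y v)) ⟩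
          sum (λ u → sum (λ v → (F u v + G u v) + - (1# + 1#) * H u v))
            ≈⟨ ≈-trans (sum₂-+ (λ u v → F u v + G u v) (λ u v → - (1# + 1#) * H u v)) (+-cong (sum₂-+ F G) (sum₂-*ˡ (- (1# + 1#)) H)) ⟩
          (sum (λ u → sum (F u)) + sum (λ u → sum (G u))) + - (1# + 1#) * sum (λ u → sum (H u))
            ≈⟨ +-cong (+-cong (≈-trans (∑-comm F) (≈-trans (sum₂-cong λ v u → *-congʳ (b-sym u v)) ΣG′)) (≈-trans (∑-comm G) ΣG)) (*-congˡ (≈-trans (∑-comm H) ΣH)) ⟩
          (s + s) + - (1# + 1#) * s
            ≈⟨ solve 1 (λ s → (s :+ s) :+ (:- (:1 :+ :1)) :* s := :0) ≈-refl s ⟩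
          0# ∎
          where
          open ≈-Reasoning
          F G H : Matrix
          F u v = b u v * (y u * y u)
          G u v = b u v * (y v * y v)
          H u v = b u v * (y u * y v)
          s = sum λ v → (1# + d) * (w v * (y v * y v))
          row : ∀ v → sum (λ u → b u v * (y v * y v)) ≈ (1# + d) * (w v * (y v * y v))
          row v = ≈-trans (sum-*ʳ (y v * y v) (λ u → b u v)) (≈-trans (*-congʳ (b-row v)) (*-assoc _ _ _))
          ΣG : sum (λ v → sum (λ u → G u v)) ≈ s
          ΣG = sum-cong row
          ΣG′ : sum (λ v → sum (λ u → b v u * (y u * y u))) ≈ s
          ΣG′ = ≈-trans (∑-comm λ v u → b v u * (y u * y u)) (sum-cong row)
          ΣH : sum (λ v → sum (λ u → H u v)) ≈ s
          ΣH = sum-cong λ v → ≈-trans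
            (sum-cong λ u → ≈-sym (*-assoc (b u v) (y u) (y v)))
            (≈-trans (sum-*ʳ (y v) (λ u → b u v * y u)) (≈-trans (*-congʳ (harmonic v))
              (solve 3 (λ d w y → (:1 :+ d) :* (w :* y) :* y := (:1 :+ d) :* (w :* (y :* y))) ≈-refl d (w v) (y v))))

        edge-constant : ∀ {u v} → Edge u v → y u ≈ y v
        edge-constant {u} {v} e = ≈-trans (solve 2 (λ a c → a := (a :- c) :+ c) ≈-refl (y u) (y v))
          (≈-trans (+-congʳ (sq≈0⇒≈0 (*-cancel-≈0 (>⇒≉0 (b-edge e)) term≈0))) (+-identityˡ _))
          where
          0≤term : ∀ u v → 0# ≤ b u v * ((y u - y v) * (y u - y v))
          0≤term u v = 0≤* (0≤b u v) (0≤sq _)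
          term≈0 : b u v * ((y u - y v) * (y u - y v)) ≈ 0#
          term≈0 = sum≈0⇒term≈0 (0≤term u) (sum≈0⇒term≈0 (λ u → 0≤sum (0≤term u)) dirichlet u) v

        constant : ∀ {u v} → Link u → Link v → y u ≈ y v
        constant p q = along (connected p q)
          where
          along : ∀ {u v} → Star Edge u v → y u ≈ y v
          along stop     = ≈-refl
          along (e ◅ es) = ≈-trans (edge-constant e) (along es)

        mean-zero⇒zero : sum (λ v → w v * y v) ≈ 0# → ∀ {v} → Link v → y v ≈ 0#
        mean-zero⇒zero p {v} l = *-cancel-≈0 (>⇒≉0 (0<* 0<1+d 0<D)) (begin
          (1# + d) * D * y v             ≈⟨ *-congʳ w-total ⟨
          sum w * y v                    ≈⟨ sum-*ʳ (y v) w ⟨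
          sum (λ u → w u * y v)          ≈⟨ sum-cong same ⟩
          sum (λ u → w u * y u)          ≈⟨ p ⟩
          0#                             ∎)
          where
          open ≈-Reasoning
          same : ∀ u → w u * y v ≈ w u * y u
          same u with em {Link u}
          ... | yes m = *-congˡ (constant l m)
          ... | no m  = ≈-trans (*-congʳ (w-nonlink m)) (≈-trans (zeroˡ _) (≈-sym (≈-trans (*-congʳ (w-nonlink m)) (zeroˡ _))))

      -- An eigenvalue above 1 + d λ has no nonzero eigenvector: y vanishes off the link, where the
      -- rows of A are zero, and has mean zero because A kills constants. So y is an eigenvector of
      -- `b`, with ν = (μ - 1) / d above λ. The gap leaves ν = 1, and then y is constant on the link
      -- with mean zero.
      module Eigen (μ : ℝ) (c<μ : 1# + d * lam < μ) (y : Vec)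
        (eigen : ∀ v → sum (λ u → A v u * y u) ≈ μ * sum (λ u → W v u * y u)) where

        0<μ : 0# < μ
        0<μ = ≤-<-trans (0≤+ 0≤1 (0≤* (<⇒≤ 0<d) (<⇒≤ 0<lam))) c<μ

        eigen′ : ∀ v → sum (λ u → A v u * y u) ≈ μ * (w′ v * y v)
        eigen′ v = ≈-trans (eigen v) (*-congˡ (W-row v y))

        y-nonlink : ∀ {v} → ¬ Link v → y v ≈ 0#
        y-nonlink {v} ¬l = *-cancel-≈0 (>⇒≉0 (<-≤-trans 0<1 (1≤w′ v))) (*-cancel-≈0 (>⇒≉0 0<μ) (≈-trans (≈-sym (eigen′ v))
          (sum-zero λ u → ≈-trans (*-congʳ {y u} (begin
            b v u - κ * (w v * w u)    ≈⟨ +-cong (≈-trans (b-sym v u) (b-nonlink u ¬l)) (-‿cong (*-congˡ (*-congʳ (w-nonlink ¬l)))) ⟩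
            0# - κ * (0# * w u)        ≈⟨ solve 2 (λ k w → :0 :- k :* (:0 :* w) := :0) ≈-refl κ (w u) ⟩
            0#                         ∎)) (zeroˡ (y u)))))
          where open ≈-Reasoning

        w′y : ∀ v → w′ v * y v ≈ w v * y v
        w′y v with em {Link v}
        ... | yes p = *-congʳ (solve 1 (λ w → w :+ (:1 :- :1) := w) ≈-refl (w v))
        ... | no p  = ≈-trans (*-congˡ (y-nonlink p)) (≈-trans (zeroʳ _) (≈-sym (≈-trans (*-congˡ (y-nonlink p)) (zeroʳ _))))

        mean-zero : sum (λ v → w v * y v) ≈ 0#
        mean-zero = *-cancel-≈0 (>⇒≉0 0<μ) (begin
          μ * sum (λ v → w v * y v)               ≈⟨ sum-*ˡ μ (λ v → w v * y v) ⟨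
          sum (λ v → μ * (w v * y v))             ≈⟨ sum-cong (λ v → ≈-trans (eigen′ v) (*-congˡ (w′y v))) ⟨
          sum (λ v → sum (λ u → A v u * y u))     ≈⟨ ∑-comm (λ v u → A v u * y u) ⟩
          sum (λ u → sum (λ v → A v u * y u))     ≈⟨ sum-zero (λ u → ≈-trans (sum-*ʳ (y u) (λ v → A v u)) (≈-trans (*-congʳ (A-column u)) (zeroˡ _))) ⟩
          0#                                      ∎)
          where open ≈-Reasoning

        b-eigen : ∀ v → sum (λ u → b u v * y u) ≈ μ * (w v * y v)
        b-eigen v = begin
          sum (λ u → b u v * y u)
            ≈⟨ sum-cong (λ u → ≈-trans (*-congʳ (b-sym u v)) (solve 5 (λ b k w t y → b :* y := (b :- k :* (w :* t)) :* y :+ k :* w :* (t :* y)) ≈-refl (b v u) κ (w v) (w u) (y u))) ⟩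
          sum (λ u → A v u * y u + κ * w v * (w u * y u))
            ≈⟨ sum-+ (λ u → A v u * y u) (λ u → κ * w v * (w u * y u)) ⟩
          sum (λ u → A v u * y u) + sum (λ u → κ * w v * (w u * y u))
            ≈⟨ +-cong (≈-trans (eigen′ v) (*-congˡ (w′y v))) (≈-trans (sum-*ˡ (κ * w v) (λ u → w u * y u)) (≈-trans (*-congˡ mean-zero) (zeroʳ _))) ⟩
          μ * (w v * y v) + 0#
            ≈⟨ +-identityʳ _ ⟩
          μ * (w v * y v) ∎
          where open ≈-Reasoning

        ν = (μ - 1#) ÷ d

        dν : d * ν ≈ μ - 1#
        dν = *-÷ (μ - 1#) 0<d

        zero-on-link : ∀ {v} → Link v → y v ≈ 0#
        zero-on-link {v} l with em {∃[ v ] Link v × ¬ y v ≈ 0#}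
        ... | no q  = stable em
          where
          stable : Dec (y v ≈ 0#) → y v ≈ 0#
          stable (yes r) = r
          stable (no r)  = ⊥-elim (q (v , l , r))
        ... | yes q with gap ν y q (λ {v} _ → ≈-trans (+-congʳ (b-eigen v)) (≈-trans
              (solve 2 (λ m a → m :* a :- a := (m :- :1) :* a) ≈-refl μ (w v * y v)) (*-congʳ (≈-sym dν))))
        ...   | inj₁ ν≤λ = ⊥-elim (<⇒≱ c<μ (≤-by (≤⇒0≤- (*-monoˡ (<⇒≤ 0<d) ν≤λ)) (≈-trans
                (solve 2 (λ m e → (:1 :+ e) :- m := e :- (m :- :1)) ≈-refl μ (d * lam)) (+-congˡ (-‿cong (≈-sym dν))))))
        ...   | inj₂ ν≈1 = Harmonic.mean-zero⇒zero y
                (λ v → ≈-trans (b-eigen v) (*-congʳ (≈-trans (solve 1 (λ m → m := :1 :+ (m :- :1)) ≈-refl μ)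
                  (+-congˡ (≈-trans (≈-sym dν) (≈-trans (*-congˡ ν≈1) (≈-trans (*-comm _ _) (*-identityˡ d))))))))
                mean-zero l

        y≈0 : ∀ v → y v ≈ 0#
        y≈0 v with em {Link v}
        ... | yes p = zero-on-link p
        ... | no p  = y-nonlink p

    -- A violation would be a Rayleigh quotient above 1 + d λ and would yield an eigenvector
    -- excluded by `Eigen`. To compare the forms, φ is cut off outside the link, which `b` and `w`
    -- do not see; mean zero removes the rank-one correction.
    spectral-bound : ∀ φ → sum (λ v → w v * φ v) ≈ 0# →
      quad b φ ≤ (1# + d * lam) * sum (λ v → w v * (φ v * φ v))
    spectral-bound φ mean-zero = ≤-resp₂ quad-A-φ̂ (*-congˡ quad-W-φ̂) bound
      where
      open ≈-Reasoning
      φ̂ : Vec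
      φ̂ v = ρ v * φ v
      bound : quad A φ̂ ≤ (1# + d * lam) * quad W φ̂
      bound = ≮⇒≥ λ lt → refute (Rayleigh.eigenvector A W A-sym W-sym W-pos (1# + d * lam) φ̂ lt)
        where
        refute : ¬ (∃[ μ ] 1# + d * lam < μ × ∃ (Rayleigh.Eigenvector A W A-sym W-sym W-pos μ))
        refute (μ , c<μ , y , (u , y≉0) , eigen) = y≉0 (Eigen.y≈0 μ c<μ y eigen u)
      Σwφ̂ : sum (λ v → w v * φ̂ v) ≈ 0#
      Σwφ̂ = ≈-trans (sum-cong λ v → ≈-trans (≈-sym (*-assoc (w v) (ρ v) (φ v))) (*-congʳ (w*ρ v))) mean-zero
      quad-A-φ̂ : quad A φ̂ ≈ quad b φ
      quad-A-φ̂ = begin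
        quad A φ̂                                                                       ≈⟨ quad-A φ̂ ⟩
        quad b φ̂ - κ * (sum (λ v → w v * φ̂ v) * sum (λ v → w v * φ̂ v))                 ≈⟨ +-cong (sum₂-cong bφ̂) (-‿cong (*-congˡ (*-cong Σwφ̂ Σwφ̂))) ⟩
        quad b φ - κ * (0# * 0#)                                                       ≈⟨ solve 2 (λ q k → q :- k :* (:0 :* :0) := q) ≈-refl (quad b φ) κ ⟩
        quad b φ                                                                       ∎
        where
        bφ̂ : ∀ u v → b u v * (φ̂ u * φ̂ v) ≈ b u v * (φ u * φ v)
        bφ̂ u v = ≈-trans (solve 5 (λ b r s x y → b :* ((r :* x) :* (s :* y)) := ((b :* s) :* r) :* (x :* y)) ≈-refl (b u v) (ρ u) (ρ v) (φ u) (φ v))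
          (*-congʳ (≈-trans (*-congʳ (≈-trans (b*ρ u v) (b-sym u v))) (≈-trans (b*ρ v u) (b-sym v u))))
      quad-W-φ̂ : quad W φ̂ ≈ sum (λ v → w v * (φ v * φ v))
      quad-W-φ̂ = ≈-trans (quad-W φ̂) (sum-cong λ v → begin
        (w v + (1# - ρ v)) * ((ρ v * φ v) * (ρ v * φ v))
          ≈⟨ solve 3 (λ w r x → (w :+ (:1 :- r)) :* ((r :* x) :* (r :* x)) := ((w :* r) :* r :+ (r :- r :* r) :* r) :* (x :* x)) ≈-refl (w v) (ρ v) (φ v) ⟩
        ((w v * ρ v) * ρ v + (ρ v - ρ v * ρ v) * ρ v) * (φ v * φ v)
          ≈⟨ *-congʳ (+-cong (≈-trans (*-congʳ (w*ρ v)) (w*ρ v)) (*-congʳ (+-congˡ (-‿cong (ind-idem {Link v}))))) ⟩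
        (w v + (ρ v - ρ v) * ρ v) * (φ v * φ v)
          ≈⟨ solve 3 (λ w r x → (w :+ (r :- r) :* r) :* x := w :* x) ≈-refl (w v) (ρ v) (φ v * φ v) ⟩
        w v * (φ v * φ v) ∎)

  module LinkSpectrum {N : ℕ} (n : ℕ) (X : Complex N) (pure : Pure n X) (connected : ConnectedLinks n X)
    (lam : ℝ) (0<lam : 0# < lam) (gap : SpectralGap n X lam)
    (τ : Subset N) (face : Complex.Face X τ) (d′ : ℕ) (size : suc (d′ ℕ.+ ∣ τ ∣) ≡ n) where

    open Complex X
    open Integral n X

    d : ℝ
    d = fromℕ (suc d′)

    private
      0<d : 0# < d
      0<d = 0<fromℕ {suc d′} (s≤s z≤n)

      ∣τ∣<n : ∣ τ ∣ ℕ.< n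
      ∣τ∣<n = ≡.subst (∣ τ ∣ ℕ.<_) size (s≤s (ℕ.m≤n+m ∣ τ ∣ d′))

      0<D : 0# < D τ
      0<D = <-≤-trans 0<1 (1≤D pure face)

      ρ : Fin N → ℝ
      ρ v = ind (LinkVertex τ v)

      x̂ : Fin N → Subset N → ℝ
      x̂ v σ = ρ v * x v σ

      w : Fin N → ℝ
      w v = ⟪ τ ⟫ (x̂ v)

      b : Fin N → Fin N → ℝ
      b u v = ⟪ τ ⟫ (λ σ → x̂ u σ * x̂ v σ)

      0≤x̂ : ∀ v σ → 0# ≤ x̂ v σ
      0≤x̂ v σ = 0≤* 0≤ind 0≤ind

    -- A vertex of a top simplex above τ lies either in τ or in the link. So restricting to link
    -- vertices only deletes τ, which leaves d + 1 vertices (`Σx̂`).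
    x̂-removes-τ : ∀ {σ} → Top σ → τ ⊆ σ → ∀ v → x̂ v σ ≈ x v σ - ind (v ∈ τ)
    x̂-removes-τ {σ} top τ⊆σ v = by-cases em em
      where
      by-cases : Dec (v ∈ τ) → Dec (v ∈ σ) → x̂ v σ ≈ x v σ - ind (v ∈ τ)
      by-cases (yes p) _ = ≈-trans (*-congʳ (ind-no λ l → proj₁ (linkVertex⁻ l) p))
        (≈-trans (zeroˡ _) (≈-sym (≈-trans (+-cong (ind-yes (τ⊆σ p)) (-‿cong (ind-yes p))) (-‿inverseʳ 1#))))
      by-cases (no p) (yes q) = ≈-trans
        (*-cong (ind-yes (linkVertex⁺ p (face-⊆ (∪-⊆ τ⊆σ q) (proj₁ top)))) (ind-yes q))
        (≈-trans (solve 0 (:1 :* :1 := :1 :- :0) ≈-refl) (≈-sym (+-cong (ind-yes q) (-‿cong (ind-no p)))))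
      by-cases (no p) (no q) = ≈-trans (*-congˡ (ind-no q))
        (≈-trans (solve 1 (λ r → r :* :0 := :0 :- :0) ≈-refl (ρ v)) (≈-sym (+-cong (ind-no q) (-‿cong (ind-no p)))))

    private
      Σx̂ : ∀ {σ} → Top σ → τ ⊆ σ → sum (λ v → x̂ v σ) ≈ 1# + d
      Σx̂ {σ} top τ⊆σ = begin
        sum (λ v → x̂ v σ)                               ≈⟨ sum-cong (x̂-removes-τ top τ⊆σ) ⟩
        sum (λ v → x v σ - ind (v ∈ τ))                 ≈⟨ sum-- (λ v → x v σ) (λ v → ind (v ∈ τ)) ⟩
        sum (λ v → x v σ) - sum (λ v → ind (v ∈ τ))     ≈⟨ +-cong (∣∣-sum σ) (-‿cong (∣∣-sum τ)) ⟩
        fromℕ (∣ σ ∣) - fromℕ (∣ τ ∣)                       ≈⟨ +-congʳ (≈-reflexive (≡.cong fromℕ (≡.trans (proj₂ top) (≡.cong suc (≡.sym size))))) ⟩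
        (1# + fromℕ (suc d′ ℕ.+ ∣ τ ∣)) - fromℕ (∣ τ ∣)   ≈⟨ +-congʳ (+-congˡ (fromℕ-+ (suc d′) ∣ τ ∣)) ⟩
        (1# + (d + fromℕ (∣ τ ∣))) - fromℕ (∣ τ ∣)          ≈⟨ solve 2 (λ d t → (:1 :+ (d :+ t)) :- t := :1 :+ d) ≈-refl d (fromℕ ∣ τ ∣) ⟩
        1# + d                                          ∎
        where open ≈-Reasoning

      x̂-idem : ∀ v σ → x̂ v σ * x̂ v σ ≈ x̂ v σ
      x̂-idem v σ = ≈-trans (solve 2 (λ r x → (r :* x) :* (r :* x) := (r :* r) :* (x :* x)) ≈-refl (ρ v) (x v σ))
        (*-cong (ind-idem {LinkVertex τ v}) (ind-idem {v ∈ σ}))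

      b-diagonal : ∀ v → b v v ≈ w v
      b-diagonal v = ⟪⟫-cong {τ} λ σ _ _ → x̂-idem v σ

      b-sym : ∀ u v → b u v ≈ b v u
      b-sym u v = ⟪⟫-cong {τ} λ σ _ _ → *-comm (x̂ u σ) (x̂ v σ)

      b-row : ∀ v → sum (λ u → b u v) ≈ (1# + d) * w v
      b-row v = ≈-trans (≈-sym (⟪⟫-sum τ (λ u σ → x̂ u σ * x̂ v σ))) (≈-trans
        (⟪⟫-cong {τ} λ σ p q → ≈-trans (sum-*ʳ (x̂ v σ) (λ u → x̂ u σ)) (*-congʳ (Σx̂ p q)))
        (⟪⟫-*ˡ τ (1# + d) (x̂ v)))

      w-total : sum w ≈ (1# + d) * D τ
      w-total = ≈-trans (≈-sym (⟪⟫-sum τ x̂)) (≈-trans (⟪⟫-cong {τ} λ σ p q → Σx̂ p q) (⟪⟫-const τ (1# + d)))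

      0≤b : ∀ u v → 0# ≤ b u v
      0≤b u v = 0≤⟪⟫ {τ} λ σ _ _ → 0≤* (0≤x̂ u σ) (0≤x̂ v σ)

      x̂-nonlink : ∀ {v} → ¬ LinkVertex τ v → ∀ σ → x̂ v σ ≈ 0#
      x̂-nonlink p σ = ≈-trans (*-congʳ (ind-no p)) (zeroˡ _)

      x̂-link : ∀ {v} → LinkVertex τ v → ∀ σ → x̂ v σ ≈ x v σ
      x̂-link p σ = ≈-trans (*-congʳ (ind-yes p)) (*-identityˡ _)

      b-nonlink : ∀ u {v} → ¬ LinkVertex τ v → b u v ≈ 0#
      b-nonlink u p = ≈-trans (⟪⟫-cong {τ} λ σ _ _ → ≈-trans (*-congˡ {x̂ u σ} (x̂-nonlink p σ)) (zeroʳ _)) (⟪⟫-zero τ)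

      w-nonlink : ∀ {v} → ¬ LinkVertex τ v → w v ≈ 0#
      w-nonlink p = ≈-trans (⟪⟫-cong {τ} λ σ _ _ → x̂-nonlink p σ) (⟪⟫-zero τ)

      w≈D : ∀ {v} → LinkVertex τ v → w v ≈ D (τ ∪ ⁅ v ⁆)
      w≈D {v} p = ≈-trans (⟪⟫-cong {τ} λ σ _ _ → x̂-link p σ) (≈-sym (D-∪ τ v))

      b≈D : ∀ {u v} → LinkVertex τ u → LinkVertex τ v → b u v ≈ D (τ ∪ (⁅ u ⁆ ∪ ⁅ v ⁆))
      b≈D {u} {v} p q = ≈-trans (⟪⟫-cong {τ} λ σ _ _ → *-cong (x̂-link p σ) (x̂-link q σ)) (≈-sym (D-∪₂ τ u v))

      w-link : ∀ {v} → LinkVertex τ v → 1# ≤ w v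
      w-link p = ≤-trans (1≤D pure (proj₂ (linkVertex⁻ p))) (≤-reflexive (≈-sym (w≈D p)))

      b-edge≈D : ∀ {u v} → LinkEdge τ u v → b u v ≈ D (τ ∪ (⁅ u ⁆ ∪ ⁅ v ⁆))
      b-edge≈D e = b≈D (linkEdge⇒linkVertex e) (linkEdge⇒linkVertex (linkEdge-sym e))

      b-edge : ∀ {u v} → LinkEdge τ u v → 0# < b u v
      b-edge e = <-≤-trans 0<1 (≤-trans (1≤D pure (proj₁ (proj₂ e))) (≤-reflexive (≈-sym (b-edge≈D e))))

      b-nonedge : ∀ {u v} → u ≢ v → ¬ LinkEdge τ u v → b u v ≈ 0#
      b-nonedge {u} {v} u≢v ¬e = by-cases em em
        where
        by-cases : Dec (LinkVertex τ u) → Dec (LinkVertex τ v) → b u v ≈ 0#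
        by-cases (no p) _ = ≈-trans (b-sym u v) (b-nonlink v p)
        by-cases _ (no q) = b-nonlink u q
        by-cases (yes p) (yes q) = ≈-trans (b≈D p q) (⟪⟫-nonface _ _ λ f →
          ¬e (linkEdge⁺ u≢v (proj₁ (linkVertex⁻ p)) (proj₁ (linkVertex⁻ q)) f))

      f : ℝ
      f = fromℕ (d′ !)

      0<f : 0# < f
      0<f = 0<fromℕ (ℕ.1≤n! d′)

      -- The factorial is (suc d′)! = d · d′!, against d′! for an edge in `weight-edge`. The walk
      -- therefore goes from v to u with probability b u v / (d w v): it picks a top simplex at v
      -- and then one of its d other link vertices.
      weight-vertex : ∀ {v} → LinkVertex τ v → fromℕ (linkWeight n X τ ⁅ v ⁆) ≈ d * f * w v
      weight-vertex {v} l = ≈-trans (fromℕ-* ((suc n ∸ ∣ τ ∪ ⁅ v ⁆ ∣) !) (degree n X (τ ∪ ⁅ v ⁆))) (*-cong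
        (≈-trans (≈-reflexive (≡.cong (λ k → fromℕ (k !)) codimension)) (fromℕ-* (suc d′) (d′ !)))
        (≈-trans (degree≈D (τ ∪ ⁅ v ⁆)) (≈-sym (w≈D l))))
        where
        codimension : suc n ∸ ∣ τ ∪ ⁅ v ⁆ ∣ ≡ suc d′
        codimension = ≡.trans (≡.cong₂ _∸_ (≡.cong suc (≡.sym size)) (≡.trans (proj₂ (proj₂ l)) (ℕ.+-comm ∣ τ ∣ 1))) (ℕ.m+n∸n≡m (suc d′) ∣ τ ∣)

      weight-edge : ∀ {u v} → LinkEdge τ u v → fromℕ (linkWeight n X τ (⁅ u ⁆ ∪ ⁅ v ⁆)) ≈ f * b u v
      weight-edge {u} {v} e = ≈-trans (fromℕ-* ((suc n ∸ ∣ τ ∪ (⁅ u ⁆ ∪ ⁅ v ⁆) ∣) !) (degree n X (τ ∪ (⁅ u ⁆ ∪ ⁅ v ⁆)))) (*-cong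
        (≈-reflexive (≡.cong (λ k → fromℕ (k !)) codimension))
        (≈-trans (degree≈D (τ ∪ (⁅ u ⁆ ∪ ⁅ v ⁆))) (≈-sym (b-edge≈D e))))
        where
        codimension : suc n ∸ ∣ τ ∪ (⁅ u ⁆ ∪ ⁅ v ⁆) ∣ ≡ d′
        codimension = ≡.trans (≡.cong₂ _∸_ (≡.cong suc (≡.sym size)) (≡.trans (proj₂ (proj₂ e)) (ℕ.+-comm ∣ τ ∣ 2))) (ℕ.m+n∸n≡m d′ ∣ τ ∣)

      -- Multiplying by `d * w v` turns the quotient of weights into `b u v`. The walk has no loops,
      -- whereas b v v = w v, whence the subtracted diagonal term; at the remaining non-edges b is
      -- zero.
      walk-term : ∀ (y : Fin N → ℝ) {v} → LinkVertex τ v → ∀ u (e? : Dec (LinkEdge τ u v)) →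
        d * w v * (if does e? then fromℕ (linkWeight n X τ (⁅ u ⁆ ∪ ⁅ v ⁆)) ÷ fromℕ (linkWeight n X τ ⁅ v ⁆) * y u else 0#)
          ≈ b u v * y u - ind (u ≡ v) * (w v * y u)
      walk-term y {v} l u (yes e) = begin
        d * w v * (E ÷ V * y u)                          ≈⟨ *-cancelˡ-≈ 0<f (begin
          f * (d * w v * (E ÷ V * y u))                    ≈⟨ solve 5 (λ f d w q y → f :* (d :* w :* (q :* y)) := (d :* f :* w) :* q :* y) ≈-refl f d (w v) (E ÷ V) (y u) ⟩
          d * f * w v * (E ÷ V) * y u                      ≈⟨ *-congʳ (*-congʳ (≈-sym (weight-vertex l))) ⟩
          V * (E ÷ V) * y u                                ≈⟨ *-congʳ (*-÷ E 0<V) ⟩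
          E * y u                                          ≈⟨ *-congʳ (weight-edge e) ⟩
          f * b u v * y u                                  ≈⟨ *-assoc f (b u v) (y u) ⟩
          f * (b u v * y u)                                ∎) ⟩
        b u v * y u                                      ≈⟨ solve 2 (λ a c → a := a :- :0 :* c) ≈-refl (b u v * y u) (w v * y u) ⟩
        b u v * y u - 0# * (w v * y u)                   ≈⟨ +-congˡ (-‿cong (*-congʳ (≈-sym (ind-no (linkEdge⇒≢ e))))) ⟩
        b u v * y u - ind (u ≡ v) * (w v * y u)          ∎
        where
        open ≈-Reasoning
        E = fromℕ (linkWeight n X τ (⁅ u ⁆ ∪ ⁅ v ⁆))
        V = fromℕ (linkWeight n X τ ⁅ v ⁆)
        0<V : 0# < V
        0<V = <-≤-trans (0<* (0<* 0<d 0<f) (<-≤-trans 0<1 (w-link l))) (≤-reflexive (≈-sym (weight-vertex l)))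
      walk-term y {v} l u (no ¬e) = ≈-trans (zeroʳ _) (≈-sym (by-cases em))
        where
        by-cases : Dec (u ≡ v) → b u v * y u - ind (u ≡ v) * (w v * y u) ≈ 0#
        by-cases (yes ≡.refl) = ≈-trans (+-cong (*-congʳ (b-diagonal v)) (-‿cong (≈-trans (*-congʳ (ind-yes ≡.refl)) (*-identityˡ _)))) (-‿inverseʳ _)
        by-cases (no u≢v) = ≈-trans (+-cong (*-congʳ (b-nonedge u≢v ¬e)) (-‿cong (*-congʳ (ind-no u≢v))))
          (solve 2 (λ a c → :0 :* a :- :0 :* c := :0) ≈-refl (y u) (w v * y u))

      walk-formula : ∀ (y : Fin N → ℝ) {v} → LinkVertex τ v →
        d * w v * walk n X τ y v ≈ sum (λ u → b u v * y u) - w v * y v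
      walk-formula y {v} l = ≈-trans (≈-sym (sum-*ˡ (d * w v) (λ u → if does (linkEdge? τ u v) then fromℕ (linkWeight n X τ (⁅ u ⁆ ∪ ⁅ v ⁆)) ÷ fromℕ (linkWeight n X τ ⁅ v ⁆) * y u else 0#)))
        (≈-trans (sum-cong λ u → walk-term y l u (linkEdge? τ u v))
        (≈-trans (sum-- (λ u → b u v * y u) (λ u → ind (u ≡ v) * (w v * y u))) (+-congˡ (-‿cong (sum-pick v (λ u → w v * y u))))))

      gap′ : ∀ μ y → (∃[ v ] LinkVertex τ v × ¬ y v ≈ 0#) →
        (∀ {v} → LinkVertex τ v → sum (λ u → b u v * y u) - w v * y v ≈ d * μ * (w v * y v)) → μ ≤ lam ⊎ μ ≈ 1#
      gap′ μ y y≉0 h = conclude (gap τ face ∣τ∣<n μ (y , y≉0 , eigen))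
        where
        eigen : ∀ v → LinkVertex τ v → walk n X τ y v ≈ μ * y v
        eigen v l = *-cancelˡ-≈ (0<* 0<d (<-≤-trans 0<1 (w-link l))) (≈-trans (walk-formula y l) (≈-trans (h l)
          (solve 4 (λ d m w y → d :* m :* (w :* y) := d :* w :* (m :* y)) ≈-refl d μ (w v) (y v))))
        conclude : (- 1# ≤ μ × μ ≤ lam) ⊎ μ ≈ 1# → μ ≤ lam ⊎ μ ≈ 1#
        conclude (inj₁ (_ , p)) = inj₁ p
        conclude (inj₂ p) = inj₂ p

      module Graph = WeightedGraph (LinkVertex τ) (LinkEdge τ) b w d (D τ) lam 0<d 0<D 0<lam b-sym b-row 0≤b b-edge b-nonlink
        w-link w-nonlink w-total (λ {u} {v} → connected τ face ∣τ∣<n u v) gap′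

    -- `quad b φ` is the second moment of the sum of φ over the vertices of a top simplex above τ,
    -- and `w` integrates the sum of φ². φ has to vanish on τ, where `x v` is constantly 1 but the
    -- link weights are 0.
    link-variance : ∀ φ → (∀ {v} → v ∈ τ → φ v ≈ 0#) → ⟪ τ ⟫ (λ σ → sum λ v → φ v * x v σ) ≈ 0# →
      ⟪ τ ⟫ (λ σ → sum (λ v → φ v * x v σ) * sum (λ v → φ v * x v σ))
        ≤ (1# + d * lam) * ⟪ τ ⟫ (λ σ → sum λ v → φ v * φ v * x v σ)
    link-variance φ φ-τ mean-zero = ≤-resp₂ quad-b (*-congˡ (linear (λ v → φ v * φ v) λ p → ≈-trans (*-congʳ (φ-τ p)) (zeroˡ _))) (Graph.spectral-bound φ (≈-trans (linear φ φ-τ) mean-zero))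
      where
      restrict : ∀ (ψ : Fin N → ℝ) → (∀ {v} → v ∈ τ → ψ v ≈ 0#) → ∀ {σ} → Top σ → τ ⊆ σ → ∀ v → ψ v * x̂ v σ ≈ ψ v * x v σ
      restrict ψ ψ-τ {σ} p q v = by-cases em
        where
        by-cases : Dec (v ∈ τ) → ψ v * x̂ v σ ≈ ψ v * x v σ
        by-cases (yes m) = ≈-trans (*-congʳ (ψ-τ m)) (≈-trans (zeroˡ _) (≈-sym (≈-trans (*-congʳ (ψ-τ m)) (zeroˡ _))))
        by-cases (no m) = *-congˡ (≈-trans (x̂-removes-τ p q v) (≈-trans (+-congˡ (-‿cong (ind-no m))) (solve 1 (λ a → a :- :0 := a) ≈-refl (x v σ))))
      linear : ∀ (ψ : Fin N → ℝ) → (∀ {v} → v ∈ τ → ψ v ≈ 0#) → sum (λ v → w v * ψ v) ≈ ⟪ τ ⟫ (λ σ → sum λ v → ψ v * x v σ)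
      linear ψ ψ-τ = ≈-trans
        (sum-cong λ v → ≈-trans (*-comm (w v) (ψ v)) (≈-sym (⟪⟫-*ˡ τ (ψ v) (x̂ v))))
        (≈-trans (≈-sym (⟪⟫-sum τ (λ v σ → ψ v * x̂ v σ))) (⟪⟫-cong {τ} λ σ p q → sum-cong (restrict ψ ψ-τ p q)))
      quad-b : QuadraticForms.quad b φ ≈ ⟪ τ ⟫ (λ σ → sum (λ v → φ v * x v σ) * sum (λ v → φ v * x v σ))
      quad-b = begin
        sum (λ u → sum (λ v → b u v * (φ u * φ v)))
          ≈⟨ sum-cong (λ u → sum-cong λ v → ≈-trans (*-comm (b u v) (φ u * φ v)) (≈-sym (⟪⟫-*ˡ τ (φ u * φ v) (λ σ → x̂ u σ * x̂ v σ)))) ⟩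
        sum (λ u → sum (λ v → ⟪ τ ⟫ (λ σ → φ u * φ v * (x̂ u σ * x̂ v σ))))
          ≈⟨ sum-cong (λ u → ⟪⟫-sum τ (λ v σ → φ u * φ v * (x̂ u σ * x̂ v σ))) ⟨
        sum (λ u → ⟪ τ ⟫ (λ σ → sum λ v → φ u * φ v * (x̂ u σ * x̂ v σ)))
          ≈⟨ ⟪⟫-sum τ (λ u σ → sum λ v → φ u * φ v * (x̂ u σ * x̂ v σ)) ⟨
        ⟪ τ ⟫ (λ σ → sum λ u → sum λ v → φ u * φ v * (x̂ u σ * x̂ v σ))
          ≈⟨ ⟪⟫-cong {τ} (λ σ p q → square σ p q) ⟩
        ⟪ τ ⟫ (λ σ → sum (λ v → φ v * x v σ) * sum (λ v → φ v * x v σ)) ∎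
        where
        open ≈-Reasoning
        square : ∀ σ → Top σ → τ ⊆ σ → sum (λ u → sum λ v → φ u * φ v * (x̂ u σ * x̂ v σ)) ≈ sum (λ v → φ v * x v σ) * sum (λ v → φ v * x v σ)
        square σ p q = begin
          sum (λ u → sum λ v → φ u * φ v * (x̂ u σ * x̂ v σ))
            ≈⟨ sum-cong (λ u → sum-cong λ v → solve 4 (λ a c y z → a :* c :* (y :* z) := (a :* y) :* (c :* z)) ≈-refl (φ u) (φ v) (x̂ u σ) (x̂ v σ)) ⟩
          sum (λ u → sum λ v → (φ u * x̂ u σ) * (φ v * x̂ v σ))
            ≈⟨ sum-cong (λ u → ≈-trans (sum-*ˡ (φ u * x̂ u σ) (λ v → φ v * x̂ v σ)) (*-cong (restrict φ φ-τ p q u) (sum-cong (restrict φ φ-τ p q)))) ⟩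
          sum (λ u → (φ u * x u σ) * sum (λ v → φ v * x v σ))
            ≈⟨ sum-*ʳ (sum λ v → φ v * x v σ) (λ u → φ u * x u σ) ⟩
          sum (λ v → φ v * x v σ) * sum (λ v → φ v * x v σ) ∎

  -- Mixing

  0≤product : ∀ {k} {f : Fin k → ℝ} → (∀ i → 0# ≤ f i) → 0# ≤ product f
  0≤product {zero}  p = 0≤1
  0≤product {suc k} p = 0≤* (p zero) (0≤product (p ∘ suc))

  product≤1 : ∀ {k} {f : Fin k → ℝ} → (∀ i → 0# ≤ f i) → (∀ i → f i ≤ 1#) → product f ≤ 1#
  product≤1 {zero}  p q = ≤-refl
  product≤1 {suc k} p q = ≤-trans (*-mono-≤ (p zero) 0≤1 (q zero) (product≤1 (p ∘ suc) (q ∘ suc))) (≤-reflexive (*-identityˡ 1#))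

  module Mixing {N : ℕ} (n : ℕ) (X : Complex N) (pure : Pure n X) (connected : ConnectedLinks n X)
    (S : Fin (suc n) → Subset N) (partite : Partite n X S)
    (lam : ℝ) (0<lam : 0# < lam) (gap : SpectralGap n X lam) where

    open Complex X
    open Integral n X
    open Partite partite

    -- On a top simplex, side i ψ is the value of ψ at the vertex in S i.
    side : Fin (suc n) → (Fin N → ℝ) → Subset N → ℝ
    side i ψ σ = sum λ v → ind (v ∈ S i) * ψ v * x v σ

    side-evaluates : ∀ {σ} → Top σ → ∀ i → ∃[ v ] (v ∈ S i × v ∈ σ) × (∀ ψ → side i ψ σ ≈ ψ v)
    side-evaluates {σ} top i = at (∣p∣≡1⇒singleton (σ ∩ S i) (transversal σ top i))
      where
      at : ∃[ v ] σ ∩ S i ≡ ⁅ v ⁆ → ∃[ v ] (v ∈ S i × v ∈ σ) × (∀ ψ → side i ψ σ ≈ ψ v)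
      at (v₀ , e) = v₀ , (proj₂ v₀∈ , proj₁ v₀∈) , λ ψ → ≈-trans
          (sum-cong λ v → ≈-trans (solve 3 (λ a y c → a :* y :* c := (a :* c) :* y) ≈-refl (ind (v ∈ S i)) (ψ v) (x v σ))
            (*-congʳ (≈-trans (≈-sym (ind-× {v ∈ S i} {v ∈ σ})) (ind-cong forward backward))))
          (sum-pick v₀ ψ)
        where
        v₀∈ : v₀ ∈ σ × v₀ ∈ S i
        v₀∈ = x∈p∩q⁻ σ (S i) (≡.subst (v₀ ∈_) (≡.sym e) (x∈⁅x⁆ v₀))
        forward : ∀ {v} → v ∈ S i × v ∈ σ → v ≡ v₀
        forward {v} (p , q) = x∈⁅y⁆⇒x≡y v₀ (≡.subst (v ∈_) e (x∈p∩q⁺ (q , p)))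
        backward : ∀ {v} → v ≡ v₀ → v ∈ S i × v ∈ σ
        backward ≡.refl = proj₂ v₀∈ , proj₁ v₀∈

    side-map : ∀ {σ} → Top σ → ∀ i (ψ : Fin N → ℝ) (F : ℝ → ℝ) → (∀ {a b} → a ≈ b → F a ≈ F b) → side i (F ∘ ψ) σ ≈ F (side i ψ σ)
    side-map top i ψ F F-cong = let v , _ , ev = side-evaluates top i in ≈-trans (ev (F ∘ ψ)) (F-cong (≈-sym (ev ψ)))

    0≤side : ∀ {i ψ} → (∀ v → 0# ≤ ψ v) → ∀ σ → 0# ≤ side i ψ σ
    0≤side p σ = 0≤sum λ v → 0≤* (0≤* 0≤ind (p v)) 0≤ind

    side-mono : ∀ {i ψ ψ′} → (∀ v → ψ v ≤ ψ′ v) → ∀ σ → side i ψ σ ≤ side i ψ′ σ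
    side-mono p σ = sum-mono λ v → *-monoʳ 0≤ind (*-monoˡ 0≤ind (p v))

    side≤1 : ∀ {i ψ} → (∀ v → ψ v ≤ 1#) → ∀ {σ} → Top σ → side i ψ σ ≤ 1#
    side≤1 {i} {ψ} p top = let v , _ , ev = side-evaluates top i in ≤-trans (≤-reflexive (ev ψ)) (p v)

    ⟪⟫-side : ∀ τ i ψ F → sum (λ v → ind (v ∈ S i) * ψ v * ⟪ τ ∪ ⁅ v ⁆ ⟫ F) ≈ ⟪ τ ⟫ (λ σ → side i ψ σ * F σ)
    ⟪⟫-side τ i ψ F = ≈-trans
      (sum-cong λ v → ≈-trans (*-congˡ (⟪⟫-∪ τ v F)) (≈-sym (⟪⟫-*ˡ τ (ind (v ∈ S i) * ψ v) (λ σ → x v σ * F σ))))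
      (≈-trans (≈-sym (⟪⟫-sum τ (λ v σ → ind (v ∈ S i) * ψ v * (x v σ * F σ))))
      (⟪⟫-cong {τ} λ σ _ _ → ≈-trans
        (sum-cong λ v → ≈-sym (*-assoc (ind (v ∈ S i) * ψ v) (x v σ) (F σ)))
        (sum-*ʳ (F σ) (λ v → ind (v ∈ S i) * ψ v * x v σ))))

    ⟪⟫-side₁ : ∀ τ i ψ → sum (λ v → ind (v ∈ S i) * ψ v * D (τ ∪ ⁅ v ⁆)) ≈ ⟪ τ ⟫ (side i ψ)
    ⟪⟫-side₁ τ i ψ = ≈-trans (⟪⟫-side τ i ψ (λ _ → 1#)) (⟪⟫-cong {τ} λ σ _ _ → ≈-trans (*-comm _ _) (*-identityˡ (side i ψ σ)))

    -- The spectral bound for the function g - E g on S j and E h - h on S i.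
    covariance : ∀ {τ d′} → Face τ → suc (d′ ℕ.+ ∣ τ ∣) ≡ n → ∀ {i j} → i ≢ j →
      (∀ {v} → v ∈ S i → v ∉ τ) → (∀ {v} → v ∈ S j → v ∉ τ) →
      ∀ g h → (∀ v → 0# ≤ g v) → (∀ v → g v ≤ 1#) → (∀ v → 0# ≤ h v) → (∀ v → h v ≤ 1#) →
      ∀ {K} → ⟪ τ ⟫ (side j g) ≤ K → ⟪ τ ⟫ (side i h) ≤ K →
      ⟪ τ ⟫ (side j g) ÷ D τ * ⟪ τ ⟫ (side i h) - fromℕ n * lam * K ≤ ⟪ τ ⟫ (λ σ → side i h σ * side j g σ)
    covariance {τ} {d′} face size {i} {j} i≢j i∉τ j∉τ g h 0≤g g≤1 0≤h h≤1 {K} c≤K a≤K = ≤-by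
        (0≤+ (0≤half (≤-by0 (≤⇒0≤- -2ut≤) (solve 3 (λ u e k → (u :+ e :* k) :+ (u :+ e :* k) := e :* (k :+ k) :- (:- (u :+ u))) ≈-refl ut e K)))
             (≤⇒0≤- (*-monoʳ 0≤K (*-monoʳ (<⇒≤ 0<lam) d≤n))))
        (≈-trans (solve 4 (λ r m n k → r :- (m :- n) := (r :- m) :+ k :+ (n :- k)) ≈-refl r (mc * a) (fromℕ n * lam * K) (e * K)) (+-congʳ (+-congʳ (≈-sym ut-formula))))
      where
      A B U T : Subset N → ℝ
      a c r mc ma e ut δ : ℝ
      A = side i h
      B = side j g
      a = ⟪ τ ⟫ A
      c = ⟪ τ ⟫ B
      r = ⟪ τ ⟫ (λ σ → A σ * B σ)
      δ = D τ
      ma = a ÷ δ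
      mc = c ÷ δ
      e = fromℕ (suc d′) * lam
      U σ = B σ - mc
      T σ = A σ - ma
      ut = ⟪ τ ⟫ (λ σ → U σ * T σ)

      0<δ : 0# < δ
      0<δ = <-≤-trans 0<1 (1≤D pure face)

      0≤K : 0# ≤ K
      0≤K = ≤-trans (0≤⟪⟫ {τ} λ σ _ _ → 0≤side 0≤g σ) c≤K

      d≤n : fromℕ (suc d′) ≤ fromℕ n
      d≤n = fromℕ-mono (≡.subst (suc d′ ℕ.≤_) size (s≤s (ℕ.m≤m+n d′ ∣ τ ∣)))

      0≤half : ∀ {s} → 0# ≤ s + s → 0# ≤ s
      0≤half {s} p with ≤-total 0# s
      ... | inj₁ q = q
      ... | inj₂ q = ≤-trans p (≤-trans (+-mono-≤ ≤-refl q) (≤-reflexive (+-identityʳ s)))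

      ut-formula : ut ≈ r - mc * a
      ut-formula = begin
        ⟪ τ ⟫ (λ σ → (B σ - mc) * (A σ - ma))
          ≈⟨ ⟪⟫-cong {τ} (λ σ _ _ → solve 4 (λ A B m k → (B :- k) :* (A :- m) := (A :* B :- k :* A) :- (m :* B :- k :* m)) ≈-refl (A σ) (B σ) ma mc) ⟩
        ⟪ τ ⟫ (λ σ → (A σ * B σ - mc * A σ) - (ma * B σ - mc * ma))
          ≈⟨ ⟪⟫-- τ (λ σ → A σ * B σ - mc * A σ) (λ σ → ma * B σ - mc * ma) ⟩
        ⟪ τ ⟫ (λ σ → A σ * B σ - mc * A σ) - ⟪ τ ⟫ (λ σ → ma * B σ - mc * ma)
          ≈⟨ +-cong (≈-trans (⟪⟫-- τ (λ σ → A σ * B σ) (λ σ → mc * A σ)) (+-congˡ (-‿cong (⟪⟫-*ˡ τ mc A))))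
               (-‿cong (≈-trans (⟪⟫-- τ (λ σ → ma * B σ) (λ _ → mc * ma)) (+-cong (⟪⟫-*ˡ τ ma B) (-‿cong (⟪⟫-const τ (mc * ma)))))) ⟩
        (r - mc * a) - (ma * c - mc * ma * δ)
          ≈⟨ solve 5 (λ q m c k d → q :- (m :* c :- k :* m :* d) := q :- m :* (c :- d :* k)) ≈-refl (r - mc * a) ma c mc δ ⟩
        (r - mc * a) - ma * (c - δ * mc)
          ≈⟨ +-congˡ (-‿cong (*-congˡ (+-congˡ (-‿cong (*-÷ c 0<δ))))) ⟩
        (r - mc * a) - ma * (c - c)
          ≈⟨ solve 3 (λ q m c → q :- m :* (c :- c) := q) ≈-refl (r - mc * a) ma c ⟩
        r - mc * a ∎
        where open ≈-Reasoning

      -- The second moment is at most the mean because ψ² ≤ ψ on [0, 1]. This makes the error in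
      -- `covariance` proportional to K instead of D τ.
      variance≤mean : ∀ i ψ → (∀ v → 0# ≤ ψ v) → (∀ v → ψ v ≤ 1#) → let m = ⟪ τ ⟫ (side i ψ) ÷ δ in
        ⟪ τ ⟫ (λ σ → (side i ψ σ - m) * (side i ψ σ - m)) ≤ ⟪ τ ⟫ (side i ψ)
      variance≤mean i ψ 0≤ψ ψ≤1 = begin
        ⟪ τ ⟫ (λ σ → (Y σ - m) * (Y σ - m))
          ≈⟨ ⟪⟫-cong {τ} (λ σ _ _ → solve 2 (λ y m → (y :- m) :* (y :- m) := y :* y :- ((m :+ m) :* y :- m :* m)) ≈-refl (Y σ) m) ⟩
        ⟪ τ ⟫ (λ σ → Y σ * Y σ - ((m + m) * Y σ - m * m))
          ≈⟨ ≈-trans (⟪⟫-- τ (λ σ → Y σ * Y σ) (λ σ → (m + m) * Y σ - m * m)) (+-congˡ (-‿cong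
               (≈-trans (⟪⟫-- τ (λ σ → (m + m) * Y σ) (λ _ → m * m)) (+-cong (⟪⟫-*ˡ τ (m + m) Y) (-‿cong (⟪⟫-const τ (m * m))))))) ⟩
        ⟪ τ ⟫ (λ σ → Y σ * Y σ) - ((m + m) * y - m * m * δ)
          ≤⟨ +-mono-≤ (⟪⟫-mono {τ} λ σ p _ → ≤-trans (*-monoˡ (0≤side 0≤ψ σ) (side≤1 ψ≤1 p)) (≤-reflexive (≈-trans (*-comm _ _) (*-identityˡ _)))) ≤-refl ⟩
        y - ((m + m) * y - m * m * δ)
          ≈⟨ solve 3 (λ y m d → y :- ((m :+ m) :* y :- m :* m :* d) := y :- m :* y :- m :* (y :- d :* m)) ≈-refl y m δ ⟩
        y - m * y - m * (y - δ * m)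
          ≈⟨ +-congˡ (-‿cong (*-congˡ (+-congˡ (-‿cong (*-÷ y 0<δ))))) ⟩
        y - m * y - m * (y - y)
          ≤⟨ ≤-by 0≤my (solve 2 (λ y m → y :- (y :- m :* y :- m :* (y :- y)) := m :* y) ≈-refl y m) ⟩
        y ∎
        where
        open ≤-Reasoning
        Y = side i ψ
        y = ⟪ τ ⟫ Y
        m = y ÷ δ
        0≤y : 0# ≤ y
        0≤y = 0≤⟪⟫ {τ} λ σ _ _ → 0≤side 0≤ψ σ
        0≤my : 0# ≤ m * y
        0≤my = 0≤* (0≤÷ 0≤y 0<δ) 0≤y

      φ : Fin N → ℝ
      -- The sum of φ over a simplex is U - T. Its square contains -2 U T, so the upper spectral
      -- bound becomes a lower bound for the covariance. As the sides are disjoint, φ² contributes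
      -- U² + T² without a cross term.
      φ v = ind (v ∈ S j) * (g v - mc) - ind (v ∈ S i) * (h v - ma)

      φ-τ : ∀ {v} → v ∈ τ → φ v ≈ 0#
      φ-τ {v} p = ≈-trans (+-cong (*-congʳ (ind-no λ q → j∉τ q p)) (-‿cong (*-congʳ (ind-no λ q → i∉τ q p))))
        (solve 2 (λ a b → :0 :* a :- :0 :* b := :0) ≈-refl (g v - mc) (h v - ma))

      Σφ : ∀ {σ} → Top σ → sum (λ v → φ v * x v σ) ≈ U σ - T σ
      Σφ {σ} top = ≈-trans
        (sum-cong λ v → solve 3 (λ a b x → (a :- b) :* x := a :* x :- b :* x) ≈-refl (ind (v ∈ S j) * (g v - mc)) (ind (v ∈ S i) * (h v - ma)) (x v σ))
        (≈-trans (sum-- (λ v → ind (v ∈ S j) * (g v - mc) * x v σ) (λ v → ind (v ∈ S i) * (h v - ma) * x v σ))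
        (+-cong (side-map top j g (_- mc) +-congʳ) (-‿cong (side-map top i h (_- ma) +-congʳ))))

      Σφ² : ∀ {σ} → Top σ → sum (λ v → φ v * φ v * x v σ) ≈ U σ * U σ + T σ * T σ
      Σφ² {σ} top = ≈-trans (sum-cong square)
        (≈-trans (sum-+ (λ v → ind (v ∈ S j) * ((g v - mc) * (g v - mc)) * x v σ) (λ v → ind (v ∈ S i) * ((h v - ma) * (h v - ma)) * x v σ))
        (+-cong (side-map top j g (λ t → (t - mc) * (t - mc)) λ p → *-cong (+-congʳ p) (+-congʳ p))
                (side-map top i h (λ t → (t - ma) * (t - ma)) λ p → *-cong (+-congʳ p) (+-congʳ p))))
        where
        square : ∀ v → φ v * φ v * x v σ ≈ ind (v ∈ S j) * ((g v - mc) * (g v - mc)) * x v σ + ind (v ∈ S i) * ((h v - ma) * (h v - ma)) * x v σ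
        square v = begin
          φ v * φ v * x v σ
            ≈⟨ solve 5 (λ p q y z x → (p :* y :- q :* z) :* (p :* y :- q :* z) :* x
                 := (p :* p) :* (y :* y) :* x :+ (q :* q) :* (z :* z) :* x :- (p :* q) :* (y :* z :+ y :* z) :* x) ≈-refl (ind (v ∈ S j)) (ind (v ∈ S i)) (g v - mc) (h v - ma) (x v σ) ⟩
          ind (v ∈ S j) * ind (v ∈ S j) * y² * x v σ + ind (v ∈ S i) * ind (v ∈ S i) * z² * x v σ - ind (v ∈ S j) * ind (v ∈ S i) * yz * x v σ
            ≈⟨ +-cong (+-cong (*-congʳ (*-congʳ (ind-idem {v ∈ S j}))) (*-congʳ (*-congʳ (ind-idem {v ∈ S i})))) (-‿cong (*-congʳ (*-congʳ exclusive))) ⟩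
          ind (v ∈ S j) * y² * x v σ + ind (v ∈ S i) * z² * x v σ - 0# * yz * x v σ
            ≈⟨ solve 3 (λ a y x → a :- :0 :* y :* x := a) ≈-refl _ yz (x v σ) ⟩
          ind (v ∈ S j) * y² * x v σ + ind (v ∈ S i) * z² * x v σ ∎
          where
          open ≈-Reasoning
          y² = (g v - mc) * (g v - mc)
          z² = (h v - ma) * (h v - ma)
          yz = (g v - mc) * (h v - ma) + (g v - mc) * (h v - ma)
          exclusive : ind (v ∈ S j) * ind (v ∈ S i) ≈ 0#
          exclusive = ≈-trans (≈-sym (ind-× {v ∈ S j} {v ∈ S i})) (ind-no λ { (p , q) → disjoint i j i≢j (v , x∈p∩q⁺ (q , p)) })

      mean-zero : ⟪ τ ⟫ (λ σ → sum λ v → φ v * x v σ) ≈ 0#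
      mean-zero = begin
        ⟪ τ ⟫ (λ σ → sum λ v → φ v * x v σ)                   ≈⟨ ⟪⟫-cong {τ} (λ σ p _ → Σφ p) ⟩
        ⟪ τ ⟫ (λ σ → (B σ - mc) - (A σ - ma))                 ≈⟨ ⟪⟫-- τ U T ⟩
        ⟪ τ ⟫ (λ σ → B σ - mc) - ⟪ τ ⟫ (λ σ → A σ - ma)       ≈⟨ +-cong (centred B) (-‿cong (centred A)) ⟩
        0# - 0#                                               ≈⟨ -‿inverseʳ 0# ⟩
        0#                                                    ∎
        where
        open ≈-Reasoning
        centred : ∀ F → ⟪ τ ⟫ (λ σ → F σ - ⟪ τ ⟫ F ÷ δ) ≈ 0#
        centred F = ≈-trans (⟪⟫-- τ F (λ _ → ⟪ τ ⟫ F ÷ δ)) (≈-trans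
          (+-congˡ (-‿cong (≈-trans (⟪⟫-const τ _) (≈-trans (*-comm _ _) (*-÷ _ 0<δ))))) (-‿inverseʳ _))

      v : ℝ
      v = ⟪ τ ⟫ (λ σ → U σ * U σ + T σ * T σ)

      v≤ : v ≤ K + K
      v≤ = ≤-trans (≤-reflexive (⟪⟫-+ τ (λ σ → U σ * U σ) (λ σ → T σ * T σ)))
        (+-mono-≤ (≤-trans (variance≤mean j g 0≤g g≤1) c≤K) (≤-trans (variance≤mean i h 0≤h h≤1) a≤K))

      main : ⟪ τ ⟫ (λ σ → (U σ - T σ) * (U σ - T σ)) ≤ (1# + e) * v
      main = ≤-resp₂
        (⟪⟫-cong {τ} λ σ p _ → *-cong (Σφ p) (Σφ p)) (*-congˡ (⟪⟫-cong {τ} λ σ p _ → Σφ² p))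
        (LinkSpectrum.link-variance n X pure connected lam 0<lam gap τ face d′ size φ φ-τ mean-zero)

      expand : ⟪ τ ⟫ (λ σ → (U σ - T σ) * (U σ - T σ)) ≈ v - (ut + ut)
      expand = ≈-trans
        (⟪⟫-cong {τ} λ σ _ _ → solve 2 (λ u t → (u :- t) :* (u :- t) := (u :* u :+ t :* t) :- (u :* t :+ u :* t)) ≈-refl (U σ) (T σ))
        (≈-trans (⟪⟫-- τ (λ σ → U σ * U σ + T σ * T σ) (λ σ → U σ * T σ + U σ * T σ))
          (+-congˡ (-‿cong (⟪⟫-+ τ (λ σ → U σ * T σ) (λ σ → U σ * T σ)))))

      -- In v - 2 ut ≤ (1 + e) v the term v cancels, and what remains on the right is proportional
      -- to λ.
      -2ut≤ : - (ut + ut) ≤ e * (K + K)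
      -2ut≤ = ≤-trans
        (≤-by (≤⇒0≤- (≤-trans (≤-reflexive (≈-sym expand)) main)) (solve 3 (λ e v u → e :* v :- (:- u) := (:1 :+ e) :* v :- (v :- u)) ≈-refl e v (ut + ut)))
        (*-monoˡ (0≤* (0≤fromℕ (suc d′)) (<⇒≤ 0<lam)) v≤)

  module ConditionalMixing {N : ℕ} (n : ℕ) (X : Complex N) (pure : Pure n X) (connected : ConnectedLinks n X)
    (S : Fin (suc n) → Subset N) (partite : Partite n X S)
    (lam : ℝ) (0<lam : 0# < lam) (gap : SpectralGap n X lam) (V : Subset N) where

    open Complex X
    open Integral n X
    open Partite partite
    open Mixing n X pure connected S partite lam 0<lam gap

    V? : Fin N → ℝ
    V? v = ind (v ∈ V)

    G : Fin (suc n) → Subset N → ℝ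
    G i = side i V?

    μ : Fin (suc n) → Subset N → ℝ
    μ i τ = ⟪ τ ⟫ (G i) ÷ D τ

    private
      0≤G : ∀ i σ → 0# ≤ G i σ
      0≤G i σ = 0≤side {i} {V?} (λ _ → 0≤ind) σ

      0<D : ∀ {τ} → Face τ → 0# < D τ
      0<D face = <-≤-trans 0<1 (1≤D pure face)

    -- For a non-face both integrals vanish, so the unspecified value of `0# ⁻¹` does no harm and
    -- sums over all vertices v need no case distinction on whether τ ∪ {v} is a face.
    D*μ : ∀ i τ → D τ * μ i τ ≈ ⟪ τ ⟫ (G i)
    D*μ i τ = by-cases (face? τ)
      where
      by-cases : Dec (Face τ) → D τ * μ i τ ≈ ⟪ τ ⟫ (G i)
      by-cases (yes f) = *-÷ _ (0<D f)
      by-cases (no ¬f) = ≈-trans (*-congʳ (⟪⟫-nonface τ (λ _ → 1#) ¬f)) (≈-trans (zeroˡ _) (≈-sym (⟪⟫-nonface τ (G i) ¬f)))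

    0≤μ≤1 : ∀ i τ → 0# ≤ μ i τ × μ i τ ≤ 1#
    0≤μ≤1 i τ = by-cases (face? τ)
      where
      by-cases : Dec (Face τ) → 0# ≤ μ i τ × μ i τ ≤ 1#
      by-cases (yes f) = 0≤÷ (0≤⟪⟫ {τ} λ σ _ _ → 0≤G i σ) (0<D f) ,
        ÷-≤ (0<D f) (≤-trans (⟪⟫-mono {τ} λ σ p _ → side≤1 {i} {V?} (λ _ → ind≤1) p) (≤-reflexive (≈-sym (≈-trans (*-comm _ _) (*-identityˡ _)))))
      by-cases (no ¬f) = ≤-reflexive (≈-sym μ≈0) , ≤-trans (≤-reflexive μ≈0) 0≤1
        where
        μ≈0 : μ i τ ≈ 0#
        μ≈0 = ≈-trans (*-congʳ (⟪⟫-nonface τ (G i) ¬f)) (zeroˡ _)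

    -- Replace the densities μ (κ j) (τ ∪ v) by μ (κ j) τ one colour at a time.
    telescope : ∀ {τ} → Face τ → ∀ {i} → (∀ {v} → v ∈ S i → v ∉ τ) → ∀ {K} → 0# ≤ K →
      ∀ m (κ : Fin m → Fin (suc n)) → (∀ j → i ≢ κ j) → (∀ j {v} → v ∈ S (κ j) → v ∉ τ) →
      (∀ (j : Fin m) → ∃[ d′ ] suc (d′ ℕ.+ ∣ τ ∣) ≡ n) → (∀ j → ⟪ τ ⟫ (G (κ j)) ≤ K) →
      ∀ h → (∀ v → 0# ≤ h v) → (∀ v → h v ≤ 1#) → ⟪ τ ⟫ (side i h) ≤ K →
      product (λ j → μ (κ j) τ) * ⟪ τ ⟫ (side i h) - fromℕ m * (fromℕ n * lam * K)
        ≤ ⟪ τ ⟫ (side i (λ v → h v * product (λ j → μ (κ j) (τ ∪ ⁅ v ⁆))))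
    telescope {τ} face {i} i∉τ {K} 0≤K zero κ i≢κ κ∉τ size G≤K h 0≤h h≤1 h≤K = ≤-reflexive (≈-trans
      (solve 2 (λ a b → :1 :* a :- :0 :* b := a) ≈-refl (⟪ τ ⟫ (side i h)) (fromℕ n * lam * K))
      (⟪⟫-cong {τ} λ σ _ _ → sum-cong λ v → *-congʳ {x v σ} (*-congˡ {ind (v ∈ S i)} (≈-sym (≈-trans (*-comm _ _) (*-identityˡ (h v)))))))
    telescope {τ} face {i} i∉τ {K} 0≤K (suc m) κ i≢κ κ∉τ size G≤K h 0≤h h≤1 h≤K = begin
      -- The recursion handles the colours `κ ∘ suc` and gathers their conditional densities in
      -- `h′`; `covariance` then splits off `κ zero` with weight `h′`, which still lies in [0, 1]
      -- and has integral at most K. The error of the recursion is multiplied by μ₀ ≤ 1.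
      μ₀ * Π * a - (1# + fromℕ m) * E              ≤⟨ ≤-by (0≤+ (0≤* (0≤* (0≤fromℕ m) 0≤E) (≤⇒0≤- (proj₂ (0≤μ≤1 (κ zero) τ)))) (0≤* (proj₁ (0≤μ≤1 (κ zero) τ)) (≤⇒0≤- recurse)))
                                                        (solve 6 (λ u p a f e b → (u :* b :- e) :- (u :* p :* a :- (:1 :+ f) :* e) := f :* e :* (:1 :- u) :+ u :* (b :- (p :* a :- f :* e))) ≈-refl μ₀ Π a (fromℕ m) E (⟪ τ ⟫ (side i h′))) ⟩
      μ₀ * ⟪ τ ⟫ (side i h′) - E                   ≤⟨ covariance face (proj₂ (size zero)) (i≢κ zero) i∉τ (κ∉τ zero) V? h′ (λ _ → 0≤ind) (λ _ → ind≤1) 0≤h′ h′≤1 (G≤K zero) h′≤K ⟩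
      ⟪ τ ⟫ (λ σ → side i h′ σ * G (κ zero) σ)     ≈⟨ ⟪⟫-side τ i h′ (G (κ zero)) ⟨
      -- Conditioned on the vertex v in `S i`, the integral of `G (κ zero)` is `D` times the density
      -- at τ ∪ {v}; this density joins the weight as a function of v.
      sum (λ v → ind (v ∈ S i) * h′ v * ⟪ τ ∪ ⁅ v ⁆ ⟫ (G (κ zero)))
        ≈⟨ sum-cong (λ v → ≈-trans (*-congˡ (≈-sym (D*μ (κ zero) (τ ∪ ⁅ v ⁆))))
             (solve 5 (λ s h p d u → s :* (h :* p) :* (d :* u) := s :* (h :* (u :* p)) :* d) ≈-refl (ind (v ∈ S i)) (h v) (Πv v) (D (τ ∪ ⁅ v ⁆)) (μ (κ zero) (τ ∪ ⁅ v ⁆)))) ⟩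
      sum (λ v → ind (v ∈ S i) * (h v * (μ (κ zero) (τ ∪ ⁅ v ⁆) * Πv v)) * D (τ ∪ ⁅ v ⁆))
        ≈⟨ ⟪⟫-side₁ τ i (λ v → h v * (μ (κ zero) (τ ∪ ⁅ v ⁆) * Πv v)) ⟩
      ⟪ τ ⟫ (side i (λ v → h v * (μ (κ zero) (τ ∪ ⁅ v ⁆) * Πv v))) ∎
      where
      open ≤-Reasoning
      a E μ₀ Π : ℝ
      a = ⟪ τ ⟫ (side i h)
      E = fromℕ n * lam * K
      μ₀ = μ (κ zero) τ
      Π = product (λ j → μ (κ (suc j)) τ)
      Πv h′ : Fin N → ℝ
      Πv v = product (λ j → μ (κ (suc j)) (τ ∪ ⁅ v ⁆))
      h′ v = h v * Πv v
      0≤E : 0# ≤ E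
      0≤E = 0≤* (0≤* (0≤fromℕ n) (<⇒≤ 0<lam)) 0≤K
      0≤Πv : ∀ v → 0# ≤ Πv v
      0≤Πv v = 0≤product λ j → proj₁ (0≤μ≤1 (κ (suc j)) (τ ∪ ⁅ v ⁆))
      Πv≤1 : ∀ v → Πv v ≤ 1#
      Πv≤1 v = product≤1 (λ j → proj₁ (0≤μ≤1 (κ (suc j)) (τ ∪ ⁅ v ⁆))) (λ j → proj₂ (0≤μ≤1 (κ (suc j)) (τ ∪ ⁅ v ⁆)))
      0≤h′ : ∀ v → 0# ≤ h′ v
      0≤h′ v = 0≤* (0≤h v) (0≤Πv v)
      h′≤h : ∀ v → h′ v ≤ h v
      h′≤h v = ≤-trans (*-monoˡ (0≤h v) (Πv≤1 v)) (≤-reflexive (≈-trans (*-comm _ _) (*-identityˡ _)))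
      h′≤1 : ∀ v → h′ v ≤ 1#
      h′≤1 v = ≤-trans (h′≤h v) (h≤1 v)
      h′≤K : ⟪ τ ⟫ (side i h′) ≤ K
      h′≤K = ≤-trans (⟪⟫-mono {τ} λ σ _ _ → side-mono {i} h′≤h σ) h≤K
      recurse : Π * a - fromℕ m * E ≤ ⟪ τ ⟫ (side i h′)
      recurse = telescope face i∉τ 0≤K m (κ ∘ suc) (i≢κ ∘ suc) (λ j → κ∉τ (suc j)) (size ∘ suc) (G≤K ∘ suc) h 0≤h h≤1 h≤K

    -- Equal to n m (m - 1) / 2: `m * n` pays for telescoping over m colours, and `loss m` for
    -- mixing these colours after one more vertex is fixed.
    loss : ℕ → ℕ
    loss zero    = 0
    loss (suc m) = loss m ℕ.+ m ℕ.* n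

    -- Fix the vertex v of colour `κ zero` in V and apply induction above τ ∪ {v}. There only the
    -- bound 1 on the densities is available, but the resulting loss is weighted by the measure of
    -- the simplices with v in V, which is D τ · μ₀ ≤ D τ · M, so it stays proportional to M.
    -- `telescope` then brings the conditional densities back to those at τ.
    mixing : ∀ m (κ : Fin m → Fin (suc n)) → (∀ {j j′} → κ j ≡ κ j′ → j ≡ j′) →
      ∀ {τ} → Face τ → (∀ j {v} → v ∈ S (κ j) → v ∉ τ) → m ℕ.+ ∣ τ ∣ ≡ suc n →
      ∀ {M} → 0# ≤ M → (∀ j → μ (κ j) τ ≤ M) →
      D τ * (product (λ j → μ (κ j) τ) - fromℕ (loss m) * lam * M) ≤ ⟪ τ ⟫ (λ σ → product (λ j → G (κ j) σ))
    mixing zero κ κ-inj {τ} face κ∉τ size {M} 0≤M μ≤M = ≤-reflexive (solve 3 (λ d l m → d :* (:1 :- :0 :* l :* m) := d) ≈-refl (D τ) lam M)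
    mixing (suc m) κ κ-inj {τ} face κ∉τ size {M} 0≤M μ≤M = begin
      δ * (μ₀ * Π - fromℕ (loss m ℕ.+ m ℕ.* n) * lam * M)
        ≈⟨ *-congˡ (+-congˡ (-‿cong (*-congʳ (*-congʳ (≈-trans (fromℕ-+ (loss m) (m ℕ.* n)) (+-congˡ (fromℕ-* m n))))))) ⟩
      δ * (μ₀ * Π - (fromℕ (loss m) + fromℕ m * fromℕ n) * lam * M)
        ≤⟨ ≤-by (0≤* (0≤* (0≤fromℕ (loss m)) (<⇒≤ 0<lam)) (0≤* (<⇒≤ (0<D face)) (≤⇒0≤- (μ≤M zero))))
             (solve 8 (λ d u p c f n l M → (p :* (d :* u) :- f :* (n :* l :* (M :* d))) :- c :* l :* (d :* u) :- d :* (u :* p :- (c :+ f :* n) :* l :* M)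
                := c :* l :* (d :* (M :- u))) ≈-refl δ μ₀ Π (fromℕ (loss m)) (fromℕ m) (fromℕ n) lam M) ⟩
      (Π * (δ * μ₀) - fromℕ m * (fromℕ n * lam * (M * δ))) - fromℕ (loss m) * lam * (δ * μ₀)
        ≈⟨ +-cong (+-congʳ (*-congˡ (D*μ i τ))) (-‿cong (*-congˡ (D*μ i τ))) ⟩
      (Π * a - fromℕ m * (fromℕ n * lam * (M * δ))) - c * a
        ≤⟨ +-mono-≤ (telescope face (κ∉τ zero) (0≤* 0≤M (<⇒≤ (0<D face))) m (κ ∘ suc) (λ j p → zero≢suc (κ-inj p)) (λ j → κ∉τ (suc j)) room
             (λ j → mean≤ (suc j)) V? (λ _ → 0≤ind) (λ _ → ind≤1) (mean≤ zero)) ≤-refl ⟩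
      ⟪ τ ⟫ (side i (λ v → V? v * Πv v)) - c * a
        ≈⟨ +-cong (⟪⟫-side₁ τ i (λ v → V? v * Πv v)) (-‿cong (≈-trans (sum-*ˡ c (λ v → ind (v ∈ S i) * V? v * D (τ ∪ ⁅ v ⁆))) (*-congˡ (⟪⟫-side₁ τ i V?)))) ⟨
      sum (λ v → ind (v ∈ S i) * (V? v * Πv v) * D (τ ∪ ⁅ v ⁆)) - sum (λ v → c * (ind (v ∈ S i) * V? v * D (τ ∪ ⁅ v ⁆)))
        ≈⟨ sum-- (λ v → ind (v ∈ S i) * (V? v * Πv v) * D (τ ∪ ⁅ v ⁆)) (λ v → c * (ind (v ∈ S i) * V? v * D (τ ∪ ⁅ v ⁆))) ⟨
      sum (λ v → ind (v ∈ S i) * (V? v * Πv v) * D (τ ∪ ⁅ v ⁆) - c * (ind (v ∈ S i) * V? v * D (τ ∪ ⁅ v ⁆)))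
        ≤⟨ sum-mono conditional ⟩
      sum (λ v → ind (v ∈ S i) * V? v * ⟪ τ ∪ ⁅ v ⁆ ⟫ F)
        ≈⟨ ⟪⟫-side τ i V? F ⟩
      ⟪ τ ⟫ (λ σ → G i σ * F σ) ∎
      where
      open ≤-Reasoning
      i = κ zero
      F : Subset N → ℝ
      F σ = product (λ j → G (κ (suc j)) σ)
      Πv : Fin N → ℝ
      Πv v = product (λ j → μ (κ (suc j)) (τ ∪ ⁅ v ⁆))
      δ μ₀ Π a c : ℝ
      δ = D τ
      μ₀ = μ i τ
      Π = product (λ j → μ (κ (suc j)) τ)
      a = ⟪ τ ⟫ (G i)
      c = fromℕ (loss m) * lam
      zero≢suc : ∀ {j : Fin m} → Fin.zero ≢ suc j
      zero≢suc ()
      -- A second colour remaining means that the link of τ has dimension at least 1, as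
      -- `covariance` requires.
      room : Fin m → ∃[ d′ ] suc (d′ ℕ.+ ∣ τ ∣) ≡ n
      room j = at m size j
        where
        at : ∀ m → suc m ℕ.+ ∣ τ ∣ ≡ suc n → Fin m → ∃[ d′ ] suc (d′ ℕ.+ ∣ τ ∣) ≡ n
        at (suc m) e _ = m , ℕ.suc-injective e
      mean≤ : ∀ j → ⟪ τ ⟫ (G (κ j)) ≤ M * δ
      mean≤ j = ≤-trans (≤-reflexive (≈-sym (D*μ (κ j) τ))) (≤-trans (*-monoˡ (<⇒≤ (0<D face)) (μ≤M j)) (≤-reflexive (*-comm δ M)))
      conditional : ∀ v → ind (v ∈ S i) * (V? v * Πv v) * D (τ ∪ ⁅ v ⁆) - c * (ind (v ∈ S i) * V? v * D (τ ∪ ⁅ v ⁆)) ≤ ind (v ∈ S i) * V? v * ⟪ τ ∪ ⁅ v ⁆ ⟫ F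
      conditional v = ≤-trans (≤-reflexive (solve 5 (λ s g p d c → s :* (g :* p) :* d :- c :* (s :* g :* d) := s :* g :* (d :* (p :- c :* :1))) ≈-refl (ind (v ∈ S i)) (V? v) (Πv v) (D (τ ∪ ⁅ v ⁆)) c))
          (by-cases em (face? (τ ∪ ⁅ v ⁆)))
        where
        by-cases : Dec (v ∈ S i) → Dec (Face (τ ∪ ⁅ v ⁆)) →
          ind (v ∈ S i) * V? v * (D (τ ∪ ⁅ v ⁆) * (Πv v - c * 1#)) ≤ ind (v ∈ S i) * V? v * ⟪ τ ∪ ⁅ v ⁆ ⟫ F
        by-cases (no q) _ = ≤-reflexive (≈-trans (vanish _) (≈-sym (vanish _)))
          where
          vanish : ∀ b → ind (v ∈ S i) * V? v * b ≈ 0#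
          vanish b = ≈-trans (*-congʳ (≈-trans (*-congʳ (ind-no q)) (zeroˡ _))) (zeroˡ b)
        by-cases (yes q) (no ¬f) = *-monoˡ (0≤* 0≤ind 0≤ind) (≤-reflexive
          (≈-trans (*-congʳ (⟪⟫-nonface (τ ∪ ⁅ v ⁆) (λ _ → 1#) ¬f)) (≈-trans (zeroˡ _) (≈-sym (⟪⟫-nonface (τ ∪ ⁅ v ⁆) F ¬f)))))
        by-cases (yes q) (yes f) = *-monoˡ (0≤* 0≤ind 0≤ind)
          (mixing m (κ ∘ suc) (λ p → Fin.suc-injective (κ-inj p)) f κ∉τ∪v
            (≡.trans (≡.cong (m ℕ.+_) (∣p∪⁅v⁆∣ τ v (κ∉τ zero q))) (≡.trans (ℕ.+-suc m ∣ τ ∣) size))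
            0≤1 (λ j → proj₂ (0≤μ≤1 (κ (suc j)) (τ ∪ ⁅ v ⁆))))
          where
          κ∉τ∪v : ∀ j {u} → u ∈ S (κ (suc j)) → u ∉ τ ∪ ⁅ v ⁆
          κ∉τ∪v j {u} p r = in-or-equal (x∈p∪q⁻ τ ⁅ v ⁆ r)
            where
            in-or-equal : ¬ (u ∈ τ ⊎ u ∈ ⁅ v ⁆)
            in-or-equal (inj₁ s) = κ∉τ (suc j) p s
            in-or-equal (inj₂ s) = disjoint (κ (suc j)) i (λ e → zero≢suc (≡.sym (κ-inj e))) (v , x∈p∩q⁺ (≡.subst (_∈ S (κ (suc j))) (x∈⁅y⁆⇒x≡y v s) p , q))

  -- The overlap constant

  ^≤product : ∀ {k P} {f : Fin k → ℝ} → 0# ≤ P → (∀ i → P ≤ f i) → P ^ k ≤ product f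
  ^≤product {zero}  0≤P p = ≤-refl
  ^≤product {suc k} {P} {f} 0≤P p = *-mono-≤ 0≤P (0≤product λ i → ≤-trans 0≤P (p (suc i))) (p zero) (^≤product 0≤P (p ∘ suc))

  product-zero : ∀ {k} {f : Fin k → ℝ} i → f i ≈ 0# → product f ≈ 0#
  product-zero zero    p = ≈-trans (*-congʳ p) (zeroˡ _)
  product-zero (suc i) p = ≈-trans (*-congˡ (product-zero i p)) (zeroʳ _)

  argmax : ∀ {k} (f : Fin (suc k) → ℝ) → ∃[ i ] ∀ j → f j ≤ f i
  argmax {zero} f = zero , λ { zero → ≤-refl }
  argmax {suc k} f = compare (argmax (f ∘ suc))
    where
    compare : (∃[ i ] ∀ j → f (suc j) ≤ f (suc i)) → ∃[ i ] ∀ j → f j ≤ f i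
    compare (i , h) with ≤-total (f zero) (f (suc i))
    ... | inj₁ p = suc i , λ { zero → p ; (suc j) → h j }
    ... | inj₂ p = zero , λ { zero → ≤-refl ; (suc j) → ≤-trans (h j) p }

  greatest : (Q : ℕ → Set) → ∃ Q → ∀ b → (∀ k → Q k → k ℕ.≤ b) → ∃[ k ] Q k × (∀ j → Q j → j ℕ.≤ k)
  greatest Q (k , q) b bounded with em {Q b}
  ... | yes p = b , p , bounded
  greatest Q (k , q) zero bounded | no p = ⊥-elim (p (≡.subst Q (ℕ.n≤0⇒n≡0 (bounded k q)) q))
  greatest Q (k , q) (suc b) bounded | no p = greatest Q (k , q) b λ j r →
    ℕ.≤-pred (ℕ.≤∧≢⇒< (bounded j r) λ e → p (≡.subst Q e r))

  least : (Q : ℕ → Set) → ∃ Q → ∃[ k ] Q k × (∀ j → Q j → k ℕ.≤ j)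
  least Q (k , q) = <-rec (λ k → Q k → ∃[ k ] Q k × (∀ j → Q j → k ℕ.≤ j)) step k q
    where
    step : ∀ k → (∀ {j} → j ℕ.< k → Q j → ∃[ k ] Q k × (∀ j → Q j → k ℕ.≤ j)) → Q k → ∃[ k ] Q k × (∀ j → Q j → k ℕ.≤ j)
    step k rec q with em {∃[ j ] j ℕ.< k × Q j}
    ... | yes (j , lt , r) = rec lt r
    ... | no h = k , q , λ j r → ℕ.≮⇒≥ λ lt → h (j , lt , r)

  -- Existence of the overlap

  module _ {N : ℕ} (n : ℕ) (X : Complex N) (pure : Pure n X) where
    open Complex X
    open Integral n X

    0<#top : 0# < fromℕ (#top n X)
    0<#top = <-≤-trans 0<1 (≤-trans (1≤D pure face-∅) (≤-reflexive (≈-sym #top≈D∅)))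

    private
      T : ℝ
      T = fromℕ (#top n X)

      Attained : (Fin N → Point n) → ℕ → Set
      Attained f k = ∃[ x ] covered n X em f x ≡ k

      Maximal : (Fin N → Point n) → ℕ → Set
      Maximal f k = Attained f k × (∀ j → Attained f j → j ℕ.≤ k)

      maximal : ∀ f → ∃ (Maximal f)
      maximal f = greatest (Attained f) (_ , (λ _ → 0#) , ≡.refl) (length (subsets N))
        λ { k (x , ≡.refl) → List.length-filter (λ _ → em) (subsets N) }

      ratio-mono : ∀ {j k} → j ℕ.≤ k → fromℕ j ÷ T ≤ fromℕ k ÷ T
      ratio-mono le = *-monoʳ (<⇒≤ (0<⁻¹ 0<#top)) (fromℕ-mono le)

      Ratio : (Fin N → Point n) → ℝ → Set
      Ratio f t = ∃[ x ] t ≈ fromℕ (covered n X em f x) ÷ T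

      maximum : ∀ {f k} → Maximal f k → IsMaximum (Ratio f) (fromℕ k ÷ T)
      maximum ((x , ≡.refl) , h) = (x , ≈-refl) , λ { s (x′ , e) → ≤-trans (≤-reflexive e) (ratio-mono (h _ (x′ , ≡.refl))) }

    -- Maximum and minimum range over infinitely many points and maps, but both are attained because
    -- the counts are natural numbers, bounded by the number of subsets.
    overlap-≥ : ∀ c → (∀ f → ∃[ x ] T * c ≤ fromℕ (covered n X em f x)) → ∃[ r ] IsOverlap n X em r × c ≤ r
    overlap-≥ c bound = conclude (least (λ k → ∃[ f ] Maximal f k) (_ , (λ _ _ → 0#) , proj₂ (maximal (λ _ _ → 0#))))
      where
      conclude : ∃[ k ] (∃[ f ] Maximal f k) × (∀ j → (∃[ f ] Maximal f j) → k ℕ.≤ j) → ∃[ r ] IsOverlap n X em r × c ≤ r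
      conclude (k , (f , maxf) , minimal) = fromℕ k ÷ T , ((f , maximum maxf) , below) ,
          ≤-÷ 0<#top (≤-trans (proj₂ (bound f)) (fromℕ-mono (proj₂ maxf _ (_ , ≡.refl))))
        where
        below : ∀ s → ∃[ f ] IsMaximum (Ratio f) s → fromℕ k ÷ T ≤ s
        below s (f′ , _ , h) = at (maximal f′)
          where
          at : ∃ (Maximal f′) → fromℕ k ÷ T ≤ s
          at (k′ , maxf′@((x , ≡.refl) , _)) = ≤-trans (ratio-mono (minimal k′ (f′ , maxf′))) (h _ (x , ≈-refl))

  -- A lower bound for the constant `C n`

  module _ (m : ℕ) where

    private
      n = suc m

      term : Fin n → ℝ
      term i = let k = toℕ i in
        fromℕ (n !) * (fromℕ ((n ℕ.+ 1 ∸ k) ℕ.^ (n ∸ k)) ÷ fromℕ ((n ∸ k ∸ 1) !))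
          * (fromℕ ((k ℕ.+ 1) ℕ.* (k ℕ.+ 2) ℕ.^ (n ∸ k)) - fromℕ ((k ℕ.+ 1) ℕ.^ (n ∸ k ℕ.+ 1)))

      0≤term : ∀ i → 0# ≤ term i
      0≤term i = 0≤* (0≤* (0≤fromℕ (n !)) (0≤÷ (0≤fromℕ ((n ℕ.+ 1 ∸ k) ℕ.^ (n ∸ k))) (0<fromℕ (ℕ.1≤n! (n ∸ toℕ i ∸ 1))))) (≤⇒0≤- (fromℕ-mono powers))
        where
        k = toℕ i
        powers : (k ℕ.+ 1) ℕ.^ (n ∸ k ℕ.+ 1) ℕ.≤ (k ℕ.+ 1) ℕ.* (k ℕ.+ 2) ℕ.^ (n ∸ k)
        powers = ℕ.≤-trans (ℕ.≤-reflexive (≡.cong ((k ℕ.+ 1) ℕ.^_) (ℕ.+-comm (n ∸ k) 1)))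
          (ℕ.*-monoʳ-≤ (k ℕ.+ 1) (ℕ.^-monoˡ-≤ (n ∸ k) (ℕ.+-monoʳ-≤ k (s≤s z≤n))))

      square≤power : ∀ m → suc m ℕ.* suc m ℕ.≤ (suc m ℕ.+ 1) ℕ.^ suc m
      square≤power zero    = s≤s z≤n
      square≤power (suc m) = ℕ.≤-trans
        (ℕ.*-mono-≤ (ℕ.m≤m+n (2 ℕ.+ m) 1) (ℕ.≤-trans (ℕ.m≤m+n (2 ℕ.+ m) 1) (ℕ.≤-reflexive (≡.sym (ℕ.*-identityʳ _)))))
        (ℕ.*-monoʳ-≤ (2 ℕ.+ m ℕ.+ 1) (ℕ.*-monoʳ-≤ (2 ℕ.+ m ℕ.+ 1) (ℕ.m^n>0 (2 ℕ.+ m ℕ.+ 1) m)))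

      n!-ratio : ∀ a → fromℕ (n !) * (a ÷ fromℕ (m !)) ≈ fromℕ n * a
      n!-ratio a = ≈-trans (*-congʳ (fromℕ-* n (m !))) (≈-trans (*-assoc _ _ _) (*-congˡ (*-÷ a (0<fromℕ (ℕ.1≤n! m)))))

      -- For k = 0 the factorials leave n, and the term is n (n + 1)^n (2^n - 1), where n² ≤ (n +
      -- 1)^n and 1 ≤ 2^n - 1.
      first-term : fromℕ (n ℕ.* (n ℕ.* n)) ≤ term zero
      first-term = begin
        fromℕ (n ℕ.* (n ℕ.* n))                            ≤⟨ fromℕ-mono (ℕ.*-monoʳ-≤ n (square≤power m)) ⟩
        fromℕ (n ℕ.* (n ℕ.+ 1) ℕ.^ n)                      ≈⟨ fromℕ-* n ((n ℕ.+ 1) ℕ.^ n) ⟩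
        fromℕ n * a                                        ≈⟨ n!-ratio a ⟨
        b                                                  ≈⟨ ≈-trans (*-comm _ _) (*-identityˡ b) ⟨
        b * 1#                                             ≤⟨ *-monoˡ 0≤b 1≤difference ⟩
        b * (fromℕ (1 ℕ.* 2 ℕ.^ n) - fromℕ (1 ℕ.^ (n ℕ.+ 1)))   ∎
        where
        open ≤-Reasoning
        a b : ℝ
        a = fromℕ ((n ℕ.+ 1) ℕ.^ n)
        b = fromℕ (n !) * (a ÷ fromℕ (m !))
        0≤b : 0# ≤ b
        0≤b = 0≤* (0≤fromℕ (n !)) (0≤÷ (0≤fromℕ ((n ℕ.+ 1) ℕ.^ n)) (0<fromℕ (ℕ.1≤n! m)))
        2≤2^n : 2 ℕ.≤ 1 ℕ.* 2 ℕ.^ n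
        2≤2^n = ℕ.≤-trans (ℕ.*-monoʳ-≤ 2 (ℕ.m^n>0 2 m)) (ℕ.≤-reflexive (≡.sym (ℕ.*-identityˡ _)))
        1≤difference : 1# ≤ fromℕ (1 ℕ.* 2 ℕ.^ n) - fromℕ (1 ℕ.^ (n ℕ.+ 1))
        1≤difference = ≤-trans (≤-by (≤⇒0≤- (fromℕ-mono 2≤2^n)) (solve 1 (λ t → (t :- :1) :- :1 := t :- (:1 :+ (:1 :+ :0))) ≈-refl (fromℕ (1 ℕ.* 2 ℕ.^ n))))
          (≤-reflexive (+-congˡ (-‿cong (≈-trans (≈-sym fromℕ-1) (≈-reflexive (≡.cong fromℕ (≡.sym (ℕ.^-zeroˡ (n ℕ.+ 1)))))))))

    n³≤C : fromℕ (n ℕ.* (n ℕ.* n)) ≤ C n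
    n³≤C = ≤-trans first-term (term≤sum 0≤term zero)

  -- From the pierced point to the overlap bound

  module _ {N : ℕ} (m : ℕ) (P : ℝ) (isPach : IsPachConstant (suc m) P)
    (X : Complex N) (pure : Pure (suc m) X) (connected : ConnectedLinks (suc m) X)
    (S : Fin (suc (suc m)) → Subset N) (partite : Partite (suc m) X S) (regular : PartiteRegular (suc m) X S)
    (lam : ℝ) (0<lam : 0# < lam) (gap : SpectralGap (suc m) X lam) where

    private
      n : ℕ
      n = suc m

    open Complex X
    open Integral n X
    open Partite partite
    open Mixing n X pure connected S partite lam 0<lam gap

    module _ (f : Fin N → Point n) where
      -- `zero` is the coordinate in which f is perturbed; it exists because n is a successor.
      open Pach {n} {N} zero P isPach S disjoint f

      module _ (V : Subset N) (dense : Dense V) (y : Point n) (pierced : Pierced V y) where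
        open ConditionalMixing n X pure connected S partite lam 0<lam gap V

        private
          0≤P : 0# ≤ P
          0≤P = <⇒≤ (proj₁ isPach)

          0<D∅ : 0# < D ∅
          0<D∅ = <-≤-trans 0<1 (1≤D pure face-∅)

          -- Summing over the top simplices by their vertex in `S i` counts each such vertex with
          -- its degree, which is the constant of partite-regularity.
          regular-side : ∀ i → ∃[ K ] 0# ≤ K × (∀ ψ → ⟪ ∅ ⟫ (side i ψ) ≈ K * sum (λ v → ind (v ∈ S i) * ψ v))
          regular-side i = at (regular i)
            where
            at : ∃[ k ] (∀ v → v ∈ S i → degree n X ⁅ v ⁆ ≡ k) → ∃[ K ] 0# ≤ K × (∀ ψ → ⟪ ∅ ⟫ (side i ψ) ≈ K * sum (λ v → ind (v ∈ S i) * ψ v))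
            at (k , deg) = fromℕ k , 0≤fromℕ k , λ ψ → ≈-trans (≈-sym (⟪⟫-side₁ ∅ i ψ))
              (≈-trans (sum-cong (summand ψ)) (sum-*ˡ (fromℕ k) (λ v → ind (v ∈ S i) * ψ v)))
              where
              summand : ∀ ψ v → ind (v ∈ S i) * ψ v * D (∅ ∪ ⁅ v ⁆) ≈ fromℕ k * (ind (v ∈ S i) * ψ v)
              summand ψ v = by-cases em
                where
                by-cases : Dec (v ∈ S i) → ind (v ∈ S i) * ψ v * D (∅ ∪ ⁅ v ⁆) ≈ fromℕ k * (ind (v ∈ S i) * ψ v)
                by-cases (yes p) = ≈-trans (*-comm _ _) (*-congʳ (≈-trans (≈-reflexive (≡.cong D (∪-identityˡ ⁅ v ⁆)))
                  (≈-trans (≈-sym (degree≈D ⁅ v ⁆)) (≈-reflexive (≡.cong fromℕ (deg v p))))))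
                by-cases (no p) = ≈-trans (*-congʳ (*-congʳ (ind-no p))) (≈-trans
                  (solve 3 (λ y d k → :0 :* y :* d := k :* (:0 :* y)) ≈-refl (ψ v) _ (fromℕ k)) (*-congˡ (*-congʳ (≈-sym (ind-no p)))))

          -- Every top simplex has exactly one vertex in `S i`, so D ∅ is the common degree K times
          -- the size of `S i`; the factor K is then common to both sides of `dense`.
          P≤μ : ∀ i → P ≤ μ i ∅
          P≤μ i = ≤-÷ 0<D∅ (at (regular-side i))
            where
            at : ∃[ K ] 0# ≤ K × (∀ ψ → ⟪ ∅ ⟫ (side i ψ) ≈ K * sum (λ v → ind (v ∈ S i) * ψ v)) → D ∅ * P ≤ ⟪ ∅ ⟫ (G i)
            at (K , 0≤K , formula) = begin
              D ∅ * P                                                  ≈⟨ *-congʳ (⟪⟫-cong {∅} λ σ p _ → let _ , _ , ev = side-evaluates p i in ev (λ _ → 1#)) ⟨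
              ⟪ ∅ ⟫ (side i (λ _ → 1#)) * P                            ≈⟨ *-congʳ (≈-trans (formula (λ _ → 1#)) (*-congˡ (sum-cong λ v → ≈-trans (*-comm (ind (v ∈ S i)) 1#) (*-identityˡ _)))) ⟩
              K * sum (λ v → ind (v ∈ S i)) * P                        ≈⟨ solve 3 (λ k s p → k :* s :* p := k :* (p :* s)) ≈-refl K (sum (λ v → ind (v ∈ S i))) P ⟩
              K * (P * sum (λ v → ind (v ∈ S i)))                      ≤⟨ *-monoˡ 0≤K (dense i) ⟩
              K * sum (λ v → ind (v ∈ S i) * ind (v ∈ V))              ≈⟨ formula V? ⟨
              ⟪ ∅ ⟫ (G i)                                              ∎
              where open ≤-Reasoning

          largest = argmax (λ i → μ i ∅)
          i₀ = proj₁ largest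
          M = μ i₀ ∅

          0≤M : 0# ≤ M
          0≤M = ≤-trans 0≤P (P≤μ i₀)

          -- Among the n + 1 factors the largest is kept and the other n are bounded by P. The
          -- removal lemma for sums is used in the multiplicative monoid.
          M*Pⁿ≤product : M * P ^ n ≤ product (λ i → μ i ∅)
          M*Pⁿ≤product = ≤-trans (*-monoˡ 0≤M (^≤product {f = removeAt (λ i → μ i ∅) i₀} 0≤P λ j → P≤μ _))
            (≤-reflexive (≈-sym (Algebra.Properties.CommutativeMonoid.Sum.sum-remove *-commutativeMonoid {i = i₀} (λ i → μ i ∅))))

          -- The exact value is n k (k + 1) / 2; at k = n the bound is the n³ that the first term of
          -- `C n` dominates.
          loss≤ : ∀ k → loss (suc k) ℕ.≤ n ℕ.* (k ℕ.* k)
          loss≤ zero    = ℕ.≤-reflexive (≡.sym (ℕ.*-zeroʳ n))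
          loss≤ (suc k) = ℕ.≤-trans (ℕ.+-monoˡ-≤ (suc k ℕ.* n) (loss≤ k)) (ℕ.≤-trans
            (ℕ.≤-reflexive (≡.trans (≡.cong (n ℕ.* (k ℕ.* k) ℕ.+_) (ℕ.*-comm (suc k) n)) (≡.sym (ℕ.*-distribˡ-+ n (k ℕ.* k) (suc k)))))
            (ℕ.*-monoʳ-≤ n (ℕ.≤-trans (ℕ.≤-reflexive (ℕ.+-comm (k ℕ.* k) (suc k)))
              (ℕ.+-monoʳ-≤ (suc k) (ℕ.*-monoʳ-≤ k (ℕ.n≤1+n k))))))

          loss≤C : fromℕ (loss (suc n)) ≤ C n
          loss≤C = ≤-trans (fromℕ-mono (loss≤ n)) (n³≤C m)

          -- If a vertex of σ lies outside V, one factor is zero. Otherwise the vertices of σ, one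
          -- from each side, form a choice from V, and y lies in the hull of their images.
          product≤covered : ∀ σ → Top σ → product (λ i → G i σ) ≤ ind (Conv (Image f σ) y)
          product≤covered σ top = by-cases em
            where
            c : Fin (suc n) → Fin N
            c i = proj₁ (side-evaluates top i)
            c∈S : ∀ i → c i ∈ S i
            c∈S i = proj₁ (proj₁ (proj₂ (side-evaluates top i)))
            c∈σ : ∀ i → c i ∈ σ
            c∈σ i = proj₂ (proj₁ (proj₂ (side-evaluates top i)))
            G≈ : ∀ i → G i σ ≈ V? (c i)
            G≈ i = proj₂ (proj₂ (side-evaluates top i)) V?
            by-cases : Dec (∃[ i ] c i ∉ V) → product (λ i → G i σ) ≤ ind (Conv (Image f σ) y)
            by-cases (yes (i , p)) = ≤-trans (≤-reflexive (product-zero {f = λ i → G i σ} i (≈-trans (G≈ i) (ind-no p)))) 0≤ind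
            by-cases (no p) = ≤-trans (product≤1 {f = λ i → G i σ} (λ i → 0≤side {i} {V?} (λ _ → 0≤ind) σ) (λ i → side≤1 {i} {V?} (λ _ → ind≤1) top))
              (≤-reflexive (≈-sym (ind-yes (hull⇒conv (pierced c λ i → c∈S i , stable i em)))))
              where
              stable : ∀ i → Dec (c i ∈ V) → c i ∈ V
              stable i (yes q) = q
              stable i (no q)  = ⊥-elim (p (i , q))
              hull⇒conv : Hull (f ∘ c) y → Conv (Image f σ) y
              hull⇒conv (t , (t≥0 , Σt) , Σ≈) = suc n , t , f ∘ c , t≥0 , Σt , (λ i → c i , c∈σ i , λ _ → ≈-refl) , Σ≈

          E Q q : ℝ
          E = fromℕ (loss (suc n)) * lam
          Q = product (λ i → μ i ∅)
          q = P ^ n - C n * lam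

          E≤ : E ≤ C n * lam
          E≤ = *-monoʳ (<⇒≤ 0<lam) loss≤C

          expansion : D ∅ * (Q - E * M) ≤ fromℕ (covered n X em f y)
          expansion = ≤-trans
            (mixing (suc n) id id face-∅ (λ _ _ → ∉⊥) (≡.trans (≡.cong (suc n ℕ.+_) (∣⊥∣≡0 N)) (ℕ.+-identityʳ (suc n))) 0≤M (proj₂ largest))
            (≤-trans (⟪⟫-mono {∅} λ σ p _ → product≤covered σ p) (≤-reflexive (⟪∅⟫-ind (λ _ → em))))

          bracket : P * q ≤ Q - E * M ⊎ P * q ≤ 0#
          bracket with ≤-total 0# q
          ... | inj₂ q≤0 = inj₂ (≤-trans (*-monoˡ 0≤P q≤0) (≤-reflexive (zeroʳ P)))
          -- Only for q ≥ 0 may P be enlarged to M in P q; then M Pⁿ is at most Q and M C λ at least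
          -- the error. For q ≤ 0 the claimed bound is not positive, and any count satisfies it.
          ... | inj₁ 0≤q = inj₁ (≤-trans (*-monoʳ 0≤q (P≤μ i₀)) (≤-by
            (0≤+ (≤⇒0≤- M*Pⁿ≤product) (0≤* 0≤M (≤⇒0≤- E≤)))
            (solve 5 (λ Q e M p c → (Q :- e :* M) :- M :* (p :- c) := (Q :- M :* p) :+ M :* (c :- e)) ≈-refl Q E M (P ^ n) (C n * lam))))

        covered-≥ : fromℕ (#top n X) * overlapBound n P lam ≤ fromℕ (covered n X em f y)
        covered-≥ = ≤-trans (≤-reflexive (*-congʳ #top≈D∅)) (by-cases bracket)
          where
          by-cases : P * q ≤ Q - E * M ⊎ P * q ≤ 0# → D ∅ * (P * q) ≤ fromℕ (covered n X em f y)
          by-cases (inj₁ p) = ≤-trans (*-monoˡ (<⇒≤ 0<D∅) p) expansion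
          by-cases (inj₂ p) = ≤-trans (*-monoˡ (<⇒≤ 0<D∅) p) (≤-trans (≤-reflexive (zeroʳ _)) (0≤fromℕ (covered n X em f y)))

      heavily-covered : ∃[ x ] fromℕ (#top n X) * overlapBound n P lam ≤ fromℕ (covered n X em f x)
      heavily-covered = at pierce
        where
        at : ∃[ V ] Dense V × ∃ (Pierced V) → ∃[ x ] fromℕ (#top n X) * overlapBound n P lam ≤ fromℕ (covered n X em f x)
        at (V , dense , y , pierced) = y , covered-≥ V dense y pierced

    overlap-bound : ∃[ r ] IsOverlap n X em r × overlapBound n P lam ≤ r
    overlap-bound = overlap-≥ n X pure (overlapBound n P lam) heavily-covered

theorem8p5 : (em : ExcludedMiddle 0ℓ) (R : Reals) (let open Reals R) (let open Real R) →
    (n : ℕ) → 1 ℕ.≤ n →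
    (P : ℝ) → IsPachConstant n P →
    (N : ℕ) (X : Complex N) → Pure n X → ConnectedLinks n X →
    (S : Fin (suc n) → Subset N) → Partite n X S → PartiteRegular n X S →
    (lam : ℝ) → 0# < lam → lam < 1# → SpectralGap n X lam →
    ∃[ r ] IsOverlap n X em r × overlapBound n P lam ≤ r
theorem8p5 em R (suc m) _ P isPach N X pure connected S partite regular lam 0<lam _ gap =
  OverlapBound.overlap-bound em R m P isPach X pure connected S partite regular lam 0<lam gap
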